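{- Fix real numbers $d>4$ and $\epsilon>0$. Let $G$ be a finite group of order $n$, let $S$ be a random sequence of density $d$ in $G$ (that is, of length $k=d\log_2 n$, with entries drawn independently and uniformly from $G$), and let the hash functions $\eta:G\to\mathcal{C}$ used by the Pollard-$\rho$ short product algorithm described in the context be random oracles. Then the Pollard-$\rho$ algorithm can be implemented so that, for almost all $S$ (that is, with probability over the choice of $S$ tending to $1$ as $n\to\infty$) and for every target $z\in\pi(\mathcal{P}(S))$, on input $(S,z)$ it outputs a subsequence of $S$ whose product is $z$ using an expected number $O(\sqrt{n})$ of group operations and storage for $O(n^{\epsilon})$ group elements. Here the expectation is over the random choices made by the algorithm (the elements $w$ and the random oracles $\eta$), and the implied constants depend only on $d$ and $\epsilon$.
   Context: **Computational model.** $G$ is a finite group of order $n$, written multiplicatively, given as a generic (black-box) group: elements have unique identifiers, and multiplication, inversion, and generation of random elements are performed by a black box. Time is the number of group operations (black-box calls, including those used for any precomputation); space is the number of group elements simultaneously stored. Evaluating a hash function is not counted as a group operation and its description is not counted in the storage. Bit-strings of length $O(\log n)$ (in particular, elements of the set $\mathcal{C}$ below) count as $O(1)$ group elements of storage. **Notation.** For a finite sequence $S$ in $G$ of length $k$, its density is $d=k/\log_2 n$ (rounding $k$ to an integer is ignored). $\mathcal{P}(S)$ is the set of all subsequences of $S$, represented by subsets of the index set $\{1,\dots,k\}$ (so there are $2^k$ of them). For a sequence $y=(y_1,\dots,y_m)$ of elements of $G$, $\pi(y)=y_1y_2\cdots y_m\in G$ is its ordered product (the empty product being the identity), and $\mu(y)=(y_m^{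 -1},\dots,y_1^{ -1})$. Write $S=AB$ as the concatenation of two sequences $A$ and $B$ of roughly equal length (lengths differing by at most one). Given $z\in G$, put $\mathcal{A}=\mathcal{P}(A)$ and $\mathcal{B}=\{z\mu(y): y\in\mathcal{P}(B)\}$, where $z\mu(y)$ is the sequence $(z,y_m^{ -1},\dots,y_1^{ -1})$ and the elements of $\mathcal{B}$ are again indexed by $y\in\mathcal{P}(B)$. Let $\mathcal{C}=\mathcal{A}\sqcup\mathcal{B}$ be the disjoint union; $\pi$ is also regarded as a map $\mathcal{C}\to G$. A random oracle $\eta:G\to\mathcal{C}$ is a function drawn uniformly at random from the set of all functions $G\to\mathcal{C}$. For such $\eta$, put $\phi=\eta\circ\pi:\mathcal{C}\to\mathcal{C}$, and let $\phi^{(i)}$ denote its $i$-fold iterate. **Pollard-$\rho$ algorithm.** Input: a finite sequence $S$ in $G$ and a target $z\in\pi(\mathcal{P}(S))$. Output: a subsequence of $S$ whose product is $z$. 1. Pick a random element $w\in\mathcal{C}$ and a hash function $\eta:G\to\mathcal{C}$ (here: a fresh random oracle each time this step is executed). 2. Find the least $i>0$ and $j\ge 0$ such that $\phi^{(i+j)}(w)=\phi^{(j)}(w)$ (using, for example, Floyd's cycle-finding algorithm, which stores only two elements of $\mathcal{C}$ at a time). 3. If $j=0$, return to Step 1. 4. Let $s=\phi^{(i+j-1)}(w)$ and $t=\phi^{(j-1)}(w)$. 5. If $\pi(s)\ne\pi(t)$, return to Step 1. 6. If $s\in\mathcal{A}$ and $t=z\mu(y)\in\mathcal{B}$, output the concatenation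 $sy$ and terminate. 7. If $t\in\mathcal{A}$ and $s=z\mu(y)\in\mathcal{B}$, output the concatenation $ty$ and terminate. 8. Return to Step 1. An implementation of this algorithm is free to choose how the product map $\pi$ is evaluated; in particular it may precompute and store group elements (such as partial products of entries of $S$ or of their inverses) before starting and use them in evaluating $\pi$. -}

module Defs where

open import Algebra.Structures using (IsGroup)
open import Data.Bool using (Bool; true; if_then_else_)
open import Data.Fin using (Fin)
open import Data.Fin.Properties using (_≟_)
open import Data.Fin.Subset using (Subset; inside; outside)
open import Data.Integer using (+_)
open import Data.List as List using (List; []; _∷_; foldr; map; reverse; length; allFin; cartesianProduct; cartesianProductWith)
open import Data.Nat as ℕ using (ℕ; zero; suc; NonZero)
open import Data.Nat.GeneralisedArithmetic using (iterate)
open import Data.Product using (Σ-syntax; ∃; ∃-syntax; _×_; _,_)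
open import Data.Rational using (ℚ; 0ℚ; 1ℚ; _/_; _+_; _*_; _≤_; _<_)
open import Data.Sum using (_⊎_; inj₁; inj₂)
open import Data.Vec as Vec using (Vec; []; _∷_; _++_; lookup; take; drop; replicate; _[_]≔_)
open import Function.Bundles using (_⇔_; _↣_)
open import Relation.Binary.PropositionalEquality using (_≡_; _≢_)
open import Relation.Nullary using (¬_)
open import Relation.Nullary.Decidable using (⌊_⌋)

-- Dedekind reals.  q ∈ lower means q < x, and q ∈ upper means x < q.

record ℝ : Set₁ where
  field
    lower upper     : ℚ → Set
    lower-inhabited : ∃ lower
    upper-inhabited : ∃ upper
    lower-rounded   : ∀ q → lower q ⇔ (∃[ r ] (q < r × lower r))
    upper-rounded   : ∀ q → upper q ⇔ (∃[ r ] (r < q × upper r))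
    disjoint        : ∀ q → ¬ (lower q × upper q)
    located         : ∀ {q r} → q < r → lower q ⊎ upper r

_<ᴿ_ : ℚ → ℝ → Set
q <ᴿ x = ℝ.lower x q

_ᴿ<_ : ℝ → ℚ → Set
x ᴿ< q = ℝ.upper x q

-- |k − d·log₂ n| ≤ 1 for d > 0 and n ≥ 1.  The inequality d·log₂ n ≤ k + 1 is
-- tested on the rationals p/q < d, and k − 1 ≤ d·log₂ n on the rationals
-- p/q > d; all logarithms and denominators are cleared.

HasDensity : ℝ → (n k : ℕ) → Set
HasDensity d n k = ∀ (p q : ℕ) .{{_ : NonZero q}} →
  ((+ p / q) <ᴿ d → n ℕ.^ p ℕ.≤ 2 ℕ.^ (q ℕ.* suc k)) ×
  (d ᴿ< (+ p / q) → 2 ℕ.^ (q ℕ.* k) ℕ.≤ 2 ℕ.^ q ℕ.* n ℕ.^ p)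

-- s ≤ K·n^ε for ε > 0 and n ≥ 1: s ≤ K·n^(p/q) for all rationals p/q > ε.

_≤_·_^ᴿ_ : (s K n : ℕ) → ℝ → Set
s ≤ K · n ^ᴿ ε = ∀ (p q : ℕ) .{{_ : NonZero q}} →
  ε ᴿ< (+ p / q) → s ℕ.^ q ℕ.≤ K ℕ.^ q ℕ.* n ℕ.^ p

-- x ≤ K·√n, for x ≥ 0.

_≤_·√_ : ℚ → (K n : ℕ) → Set
x ≤ K ·√ n = x * x ≤ + (K ℕ.* K ℕ.* n) / 1

-- Expectation of f for the uniform distribution on the entries of a list
-- (always used for duplicate-free enumerations of nonempty finite sets).

mean : {A : Set} → List A → (A → ℚ) → ℚ
mean []          f = 0ℚ
mean xs@(_ ∷ _) f = foldr (λ x s → f x + s) 0ℚ xs * (+ 1 / length xs)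

-- The event P has probability at least p.  P need not be decidable, so it is
-- bounded below by a decidable subevent.

Probability≥ : {A : Set} → List A → (A → Set) → ℚ → Set
Probability≥ {A} xs P p =
  Σ[ E ∈ (A → Bool) ]
    (p ≤ mean xs (λ x → if E x then 1ℚ else 0ℚ)) × (∀ x → E x ≡ true → P x)

allVecs : {A : Set} → List A → ∀ m → List (Vec A m)
allVecs xs zero    = [] ∷ []
allVecs xs (suc m) = cartesianProductWith _∷_ xs (allVecs xs m)

allSubsets : ∀ m → List (Subset m)
allSubsets = allVecs (inside ∷ outside ∷ [])

-- A black-box group of order n.  Its elements are represented by their unique
-- identifiers, which are numbered by Fin n.

record BlackBoxGroup (n : ℕ) : Set where
  infixl 7 _∙_
  field
    _∙_     : Fin n → Fin n → Fin n
    ε       : Fin n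
    _⁻¹     : Fin n → Fin n
    isGroup : IsGroup _≡_ _∙_ ε _⁻¹

-- S = AB with A and B of lengths a and b.  A subset x of the index set of A
-- stands for an element of 𝒜 as inj₁ x; a subset y of the index set of B
-- stands for the element zμ(y) of ℬ as inj₂ y.

𝒞 : (a b : ℕ) → Set
𝒞 a b = Subset a ⊎ Subset b

all𝒞 : ∀ a b → List (𝒞 a b)
all𝒞 a b = map inj₁ (allSubsets a) List.++ map inj₂ (allSubsets b)

-- A function η : G → 𝒞, given by its table of values.

Oracle : (n a b : ℕ) → Set
Oracle n a b = Vec (𝒞 a b) n

-- The random choices of one execution of Step 1.

Draw : (n a b : ℕ) → Set
Draw n a b = 𝒞 a b × Oracle n a b

allDraws : ∀ n a b → List (Draw n a b)
allDraws n a b = cartesianProduct (all𝒞 a b) (allVecs (all𝒞 a b) n)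

subsequence : ∀ {A : Set} {m} → Vec A m → Subset m → List A
subsequence []      []            = []
subsequence (x ∷ v) (inside  ∷ p) = x ∷ subsequence v p
subsequence (x ∷ v) (outside ∷ p) = subsequence v p

-- How one pass through Steps 1–8 ends.  The result unfinished does not occur
-- in the algorithm; it marks a machine that has exceeded its step bound.

data Result (k : ℕ) : Set where
  found      : Subset k → Result k
  retry      : Result k
  unfinished : Result k

module Products {n} (G : BlackBoxGroup n) where
  open BlackBoxGroup G

  product : List (Fin n) → Fin n
  product = foldr _∙_ ε

  μ : List (Fin n) → List (Fin n)
  μ y = reverse (map _⁻¹ y)

  -- z ∈ π(𝒫(S))
  Representable : ∀ {k} → Vec (Fin n) k → Fin n → Set
  Representable S z = ∃[ x ] (product (subsequence S x) ≡ z)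

module PollardRho {n} (G : BlackBoxGroup n) (a b : ℕ) (S : Vec (Fin n) (a ℕ.+ b)) (z : Fin n) where
  open BlackBoxGroup G
  open Products G

  sequenceOf : 𝒞 a b → List (Fin n)
  sequenceOf (inj₁ x) = subsequence (take a S) x
  sequenceOf (inj₂ y) = z ∷ μ (subsequence (drop a S) y)

  π : 𝒞 a b → Fin n
  π c = product (sequenceOf c)

  φ : Oracle n a b → 𝒞 a b → 𝒞 a b
  φ η c = lookup η (π c)

  φ^ : Oracle n a b → ℕ → 𝒞 a b → 𝒞 a b
  φ^ η i w = iterate (φ η) w i

  record IsLeastCycle (η : Oracle n a b) (w : 𝒞 a b) (i j : ℕ) : Set where
    field
      positive : 0 ℕ.< i
      cycle    : φ^ η (i ℕ.+ j) w ≡ φ^ η j w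
      least    : ∀ i′ j′ → 0 ℕ.< i′ → φ^ η (i′ ℕ.+ j′) w ≡ φ^ η j′ w →
                 i ℕ.≤ i′ × j ℕ.≤ j′

  steps6-8 : 𝒞 a b → 𝒞 a b → Result (a ℕ.+ b)
  steps6-8 (inj₁ x) (inj₂ y) = found (x ++ y)
  steps6-8 (inj₂ y) (inj₁ x) = found (x ++ y)
  steps6-8 (inj₁ _) (inj₁ _) = retry
  steps6-8 (inj₂ _) (inj₂ _) = retry

  -- Steps 2–8 with the given w and η end with the given result.  In the last
  -- two constructors the j of the algorithm is suc j.

  data Attempt (w : 𝒞 a b) (η : Oracle n a b) : Result (a ℕ.+ b) → Set where
    noTail      : ∀ {i} → IsLeastCycle η w i 0 → Attempt w η retry
    noCollision : ∀ {i j} → IsLeastCycle η w i (suc j) →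
                  π (φ^ η (i ℕ.+ j) w) ≢ π (φ^ η j w) → Attempt w η retry
    collision   : ∀ {i j} → IsLeastCycle η w i (suc j) →
                  π (φ^ η (i ℕ.+ j) w) ≡ π (φ^ η j w) →
                  Attempt w η (steps6-8 (φ^ η (i ℕ.+ j) w) (φ^ η j w))

-- Operations on r registers, each holding one group element; the first
-- argument is the destination.  Only black-box calls cost time.

data Operation (r : ℕ) : Set where
  mul  : Fin r → Fin r → Fin r → Operation r
  inv  : Fin r → Fin r → Operation r
  copy : Fin r → Fin r → Operation r

cost : ∀ {r} → Operation r → ℕ
cost (mul _ _ _) = 1
cost (inv _ _)   = 1
cost (copy _ _)  = 0

data Instruction (r : ℕ) (Q C : Set) (k : ℕ) : Set where
  operate : Operation r → Q → Instruction r Q C k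
  query   : Fin r → (C → Q) → Instruction r Q C k   -- apply η to a register
  stop    : Result k → Instruction r Q C k

-- A generic-group program.  It first runs a straight-line precomputation and
-- then makes attempts, each started by a new random w.  Apart from the group
-- elements in its registers it remembers only its state, which must be
-- encodable in a number of words of suc (a + b) bits; a word can hold an
-- element of 𝒞.  The next instruction may depend on the state and on the
-- identifiers in the registers, but the program does not depend on the group.

record Machine (n a b : ℕ) : Set₁ where
  field
    extra : ℕ

  -- One register for each entry of S, one for z, and extra ones.
  registers : ℕ
  registers = (a ℕ.+ b) ℕ.+ suc extra

  field
    precomputation : List (Operation registers)
    State          : Set
    words          : ℕ
    encode         : State ↣ Vec (Vec Bool (suc (a ℕ.+ b))) words
    begin          : 𝒞 a b → State
    next           : State → Vec (Fin n) registers →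
                     Instruction registers State (𝒞 a b) (a ℕ.+ b)
    maxSteps       : ℕ    -- in one attempt

  storage : ℕ
  storage = registers ℕ.+ words

module Execution {n} (G : BlackBoxGroup n) {a b} (M : Machine n a b)
                 (S : Vec (Fin n) (a ℕ.+ b)) (z : Fin n) where
  open BlackBoxGroup G
  open Products G
  open Machine M

  Memory : Set
  Memory = Vec (Fin n) registers

  perform : Operation registers → Memory → Memory
  perform (mul t x y) m = m [ t ]≔ (lookup m x ∙ lookup m y)
  perform (inv t x)   m = m [ t ]≔ (lookup m x ⁻¹)
  perform (copy t x)  m = m [ t ]≔ lookup m x

  performAll : List (Operation registers) → Memory → Memory
  performAll []         m = m
  performAll (op ∷ ops) m = performAll ops (perform op m)

  precomputed : Memory
  precomputed = performAll precomputation (S ++ (z ∷ replicate extra ε))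

  precomputationCost : ℕ
  precomputationCost = foldr (λ op c → cost op ℕ.+ c) 0 precomputation

  record Run : Set where
    constructor ⟨_,_,_⟩
    field
      result : Result (a ℕ.+ b)
      time   : ℕ
      memory : Memory
  open Run public

  run : ℕ → Oracle n a b → State → Memory → Run
  run zero        η s m = ⟨ unfinished , 0 , m ⟩
  run (suc steps) η s m with next s m
  ... | operate op s′ =
    let later = run steps η s′ (perform op m)
    in  ⟨ result later , cost op ℕ.+ time later , memory later ⟩
  ... | query x κ = run steps η (κ (lookup η (lookup m x))) m
  ... | stop res  = ⟨ res , 0 , m ⟩

  attempt : Memory → Draw n a b → Run
  attempt m (w , η) = run maxSteps η (begin w) m

  -- Register contents with which an attempt can start.

  data Reachable : Memory → Set where
    first : Reachable precomputed
    again : ∀ {m} → Reachable m → (draw : Draw n a b) →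
            result (attempt m draw) ≡ retry →
            Reachable (memory (attempt m draw))

  -- The machine carries out the Pollard-ρ algorithm on input (S , z).

  Implements : Set
  Implements = ∀ {m} → Reachable m → ∀ w η →
    PollardRho.Attempt G a b S z w η (result (attempt m (w , η)))

  -- Expected time spent in at most t attempts, when the first one starts
  -- with register contents m.

  attemptsTime : ℕ → Memory → ℚ
  attemptsTime zero    m = 0ℚ
  attemptsTime (suc t) m = mean (allDraws n a b) λ draw →
    let r = attempt m draw in + time r / 1 + remaining (result r) (memory r)
    where
    remaining : Result (a ℕ.+ b) → Memory → ℚ
    remaining (found _)  m′ = 0ℚ
    remaining retry      m′ = attemptsTime t m′
    remaining unfinished m′ = 0ℚ

  expectedTime : ℕ → ℚ
  expectedTime t = + precomputationCost / 1 + attemptsTime t precomputed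

  -- Probability that at most t attempts output no subsequence with product z.

  failure : ℕ → Memory → ℚ
  failure zero    m = 1ℚ
  failure (suc t) m = mean (allDraws n a b) λ draw →
    let r = attempt m draw in remaining (result r) (memory r)
    where
    remaining : Result (a ℕ.+ b) → Memory → ℚ
    remaining (found x)  m′ =
      if ⌊ product (subsequence S x) ≟ z ⌋ then 0ℚ else 1ℚ
    remaining retry      m′ = failure t m′
    remaining unfinished m′ = 1ℚ

  -- With probability 1 a subsequence with product z is output.

  Succeeds : Set
  Succeeds = ∀ (δ : ℚ) → 0ℚ < δ → ∃[ t ] (failure t precomputed ≤ δ)

  -- The expected number of group operations is the supremum over t of
  -- expectedTime t.

  ExpectedTime≤_·√n : ℕ → Set
  ExpectedTime≤ K ·√n = ∀ t → expectedTime t ≤ K ·√ n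

record Implementation (n a b : ℕ) : Set₁ where
  field
    machine : Machine n a b
    correct : ∀ (G : BlackBoxGroup n) S z → Products.Representable G S z →
              Execution.Implements G machine S z
  open Machine machine public using (storage)

-- The probability that a uniformly random sequence S of length k in a group
-- of order n satisfies P is at least p.

RandomSequence≥ : ∀ n k → ℚ → (Vec (Fin n) k → Set) → Set
RandomSequence≥ n k p P = Probability≥ (allVecs (allFin n) k) P p

{-# OPTIONS --safe #-}
module Submission where

-- Write f(g) = n·P(g) − 1 for the deviation from uniformity of the product of a
-- random subsequence of A.  Prepending s to A replaces f(g) by the mean of f(g)
-- and f(s⁻¹g), and Σ f = 0, so for random s the expectation of Σ f² is halved.
-- Hence Σ f² is about n²/2^a on average; for d > 4 this tends to 0, and for
-- almost all S every group element has nearly the same number of representations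
-- in 𝒜, and likewise in ℬ, whatever z is.
--
-- For such S the oracle can be sampled lazily.  After h distinct positions the
-- next one collides with probability of order h/n, which gives O(√n) expected
-- steps, and a collision joins 𝒜 and ℬ with probability at least 1/9 given the
-- past, so O(1) attempts suffice on average.
--
-- Floyd's algorithm finds the collision with storage for a few elements of 𝒞.
-- A constant number of group operations per step suffices once the indices are
-- cut into a constant number of chunks and the products of all the subsets of
-- each chunk are tabulated, which takes O(n^ε) registers.

open import Defs
open import Algebra.Bundles using (Group)
import Algebra.Properties.Group as GroupProperties
open import Data.Bool using (Bool; true; false; if_then_else_; not)
import Data.Bool.Properties as Bool
open import Data.Fin as Fin using (Fin; _↑ˡ_; _↑ʳ_; inject₁; fromℕ; toℕ)
open import Data.Fin.Patterns using (0F; 1F; 2F; 3F; 4F; 5F; 6F)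
open import Data.Fin.Properties using (_≟_; suc-injective; injective⇒≤; ↑ʳ-injective; toℕ-inject₁; toℕ-fromℕ; toℕ-↑ˡ; toℕ-↑ʳ; toℕ<n)
open import Data.Fin.Subset using (Subset; inside; outside)
open import Data.Integer as ℤ using (+_)
import Data.Integer.Properties as ℤ
open import Data.List as List using (List; []; _∷_; length; map; allFin; cartesianProductWith; foldr)
import Data.List.Properties as List
open import Data.List.Membership.Propositional using (_∈_; find)
open import Data.List.Membership.Propositional.Properties using (∈-allFin; ∈-lookup; ∈-++⁺ˡ; ∈-++⁺ʳ; ∈-map⁺; ∈-cartesianProductWith⁺)
open import Data.List.Relation.Unary.All as All using (All; []; _∷_)
open import Data.List.Relation.Unary.All.Properties using (¬Any⇒All¬)
open import Data.List.Relation.Unary.AllPairs using (AllPairs; []; _∷_)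
open import Data.List.Relation.Unary.Any as Any using (Any; any?; here; there)
open import Data.List.Relation.Unary.Any.Properties using (lookup-index)
open import Data.Nat as ℕ using (ℕ; zero; suc; _∸_; _⊓_; ∣_-_∣; NonZero; s≤s; z≤n)
import Data.Nat.Properties as ℕ
open import Data.Nat.DivMod using (m/n*n≤m; m≡m%n+[m/n]*n; m%n<n)
open import Data.Nat.GeneralisedArithmetic using (iterate)
open import Data.Nat.Solver using () renaming (module +-*-Solver to ℕ-Solver)
open import Data.Product using (Σ-syntax; ∃-syntax; _×_; _,_; proj₁; proj₂; map₂)
open import Data.Rational using (ℚ; mkℚ; 0ℚ; 1ℚ; ½; -½; _/_; _+_; _*_; _-_; -_; _≤_; _<_; nonNegative; positive; toℚᵘ)
import Data.Rational.Properties as ℚ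
open import Data.Rational.Solver using (module +-*-Solver)
import Data.Rational.Unnormalised as ℚᵘ
open ℚᵘ using (mkℚᵘ; *≡*; *≤*)
import Data.Rational.Unnormalised.Properties as ℚᵘ
open import Data.Sum as Sum using (_⊎_; inj₁; inj₂)
import Data.Sum.Properties as Sum
open import Data.Vec as Vec using (Vec; []; _∷_; _++_; lookup; take; drop; replicate; tabulate; _[_]≔_)
import Data.Vec.Properties as Vec
open import Function using (_∘_; _⟨_⟩_)
open import Function.Bundles using (mk↣; Equivalence)
open import Relation.Binary.Definitions using (DecidableEquality; tri<; tri≈; tri>)
open import Relation.Binary.PropositionalEquality using (_≡_; _≢_; refl; sym; trans; cong; cong₂; subst; subst₂; module ≡-Reasoning)
open import Relation.Nullary using (Dec; yes; no; ¬_; contradiction)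
open import Relation.Nullary.Decidable using (⌊_⌋; _×-dec_)

open +-*-Solver using (solve; con; _:=_; _:+_; _:*_; _:-_; :-_)
open ℕ-Solver using () renaming (solve to solveℕ; con to conℕ; _:=_ to _⊜_; _:+_ to _⊕_; _:*_ to _⊗_; _:^_ to _⊛_)
open Equivalence using (to; from)

-- Since `a` is about k/2, 2^a is about n^(d/2), which outgrows n² because d > 4. The sum of squares
-- runs over the whole group, so its smallness controls every single deviation. This covers all
-- targets at once: the products of ℬ are z p⁻¹ for p in π(𝒫(B)), and p ↦ z p⁻¹ is a bijection of G.
--
-- The analysis follows repeated products, not repeated elements of 𝒞. A lazily sampled oracle
-- notices a repeated product at once, and `success` and `duration` are defined from this event as
-- functions of the draw alone. They do not depend on what earlier attempts left in the registers,
-- so all attempts obey the same bounds. Two facts link them to the machine: its time is at most a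
-- constant times the duration, and if the first two positions with equal products lie in different
-- halves of 𝒞, the attempt does not end in `retry`.
--
-- Balance means frequencies between ½ and 3/2 of the uniform one. Each half of 𝒞 has weight at
-- least ⅓, and 1/9 is (⅓ · ½) / (3/2). The table must also be built within O(√n) operations, so a
-- chunk has O(n^(1/4)) subsets even when ε is large.

private variable
  A B C : Set

-- Rational arithmetic

-- Opaque, because + n / 1 unfolds to a computation of greatest common divisors.
opaque
  ι : ℕ → ℚ
  ι n = + n / 1

  -- With the value 0 at 0, `mean-Σ` covers the empty list and `recip-*` needs no side condition.
  recip : ℕ → ℚ
  recip zero    = 0ℚ
  recip (suc n) = + 1 / suc n

  ι-def : ∀ n → + n / 1 ≡ ι n
  ι-def n = refl

  recip-def : ∀ n → + 1 / suc n ≡ recip (suc n)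
  recip-def n = refl

  ι-0 : ι 0 ≡ 0ℚ
  ι-0 = refl

  ι-1 : ι 1 ≡ 1ℚ
  ι-1 = refl

  0<ι : ∀ n → 0ℚ < ι (suc n)
  0<ι n = ℚ.positive⁻¹ (ι (suc n)) ⦃ ℚ.normalize-pos (suc n) 1 ⦄

  recip-0 : recip 0 ≡ 0ℚ
  recip-0 = refl

  ι-+ : ∀ m n → ι (m ℕ.+ n) ≡ ι m + ι n
  ι-+ m n = ℚ.toℚᵘ-injective (begin
    toℚᵘ (ι (m ℕ.+ n))                 ≈⟨ ℚ.toℚᵘ-fromℚᵘ (mkℚᵘ (+ (m ℕ.+ n)) 0) ⟩
    mkℚᵘ (+ (m ℕ.+ n)) 0               ≈⟨ *≡* (cong (ℤ._* + 1) (cong₂ ℤ._+_ (sym (ℤ.*-identityʳ (+ m))) (sym (ℤ.*-identityʳ (+ n))))) ⟩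
    mkℚᵘ (+ m) 0 ℚᵘ.+ mkℚᵘ (+ n) 0     ≈⟨ ℚᵘ.+-cong (ℚᵘ.≃-sym (ℚ.toℚᵘ-fromℚᵘ (mkℚᵘ (+ m) 0))) (ℚᵘ.≃-sym (ℚ.toℚᵘ-fromℚᵘ (mkℚᵘ (+ n) 0))) ⟩
    toℚᵘ (ι m) ℚᵘ.+ toℚᵘ (ι n)         ≈⟨ ℚᵘ.≃-sym (ℚ.toℚᵘ-homo-+ (ι m) (ι n)) ⟩
    toℚᵘ (ι m + ι n)                   ∎)
    where
    open ℚᵘ.≃-Reasoning

  ι-* : ∀ m n → ι (m ℕ.* n) ≡ ι m * ι n
  ι-* m n = ℚ.toℚᵘ-injective (begin
    toℚᵘ (ι (m ℕ.* n))                 ≈⟨ ℚ.toℚᵘ-fromℚᵘ (mkℚᵘ (+ (m ℕ.* n)) 0) ⟩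
    mkℚᵘ (+ (m ℕ.* n)) 0               ≈⟨ *≡* (cong (ℤ._* + 1) (ℤ.pos-* m n)) ⟩
    mkℚᵘ (+ m) 0 ℚᵘ.* mkℚᵘ (+ n) 0     ≈⟨ ℚᵘ.*-cong (ℚᵘ.≃-sym (ℚ.toℚᵘ-fromℚᵘ (mkℚᵘ (+ m) 0))) (ℚᵘ.≃-sym (ℚ.toℚᵘ-fromℚᵘ (mkℚᵘ (+ n) 0))) ⟩
    toℚᵘ (ι m) ℚᵘ.* toℚᵘ (ι n)         ≈⟨ ℚᵘ.≃-sym (ℚ.toℚᵘ-homo-* (ι m) (ι n)) ⟩
    toℚᵘ (ι m * ι n)                   ∎)
    where
    open ℚᵘ.≃-Reasoning

  ι-mono : ∀ {m n} → m ℕ.≤ n → ι m ≤ ι n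
  ι-mono {m} {n} m≤n = ℚ.toℚᵘ-cancel-≤
    (ℚᵘ.≤-respˡ-≃ (ℚᵘ.≃-sym (ℚ.toℚᵘ-fromℚᵘ (mkℚᵘ (+ m) 0)))
      (ℚᵘ.≤-respʳ-≃ (ℚᵘ.≃-sym (ℚ.toℚᵘ-fromℚᵘ (mkℚᵘ (+ n) 0)))
        (*≤* (ℤ.*-monoʳ-≤-nonNeg (+ 1) (ℤ.+≤+ m≤n)))))

  0≤ι : ∀ n → 0ℚ ≤ ι n
  0≤ι n = ι-mono {0} {n} ℕ.z≤n

  ι*recip : ∀ n → ι (suc n) * recip (suc n) ≡ 1ℚ
  ι*recip n = ℚ.toℚᵘ-injective (begin
    toℚᵘ (ι (suc n) * recip (suc n))          ≈⟨ ℚ.toℚᵘ-homo-* (ι (suc n)) (recip (suc n)) ⟩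
    toℚᵘ (ι (suc n)) ℚᵘ.* toℚᵘ (recip (suc n)) ≈⟨ ℚᵘ.*-cong (ℚ.toℚᵘ-fromℚᵘ (mkℚᵘ (+ suc n) 0)) (ℚ.toℚᵘ-fromℚᵘ (mkℚᵘ (+ 1) n)) ⟩
    mkℚᵘ (+ suc n) 0 ℚᵘ.* mkℚᵘ (+ 1) n      ≈⟨ *≡* (cong +_ (trans (ℕ.*-identityʳ _) (trans (ℕ.*-comm (suc n) 1) (cong (1 ℕ.*_) (sym (ℕ.+-identityʳ (suc n))))))) ⟩
    toℚᵘ 1ℚ                                 ∎)
    where
    open ℚᵘ.≃-Reasoning

  0≤recip : ∀ n → 0ℚ ≤ recip n
  0≤recip zero    = ℚ.≤-refl
  0≤recip (suc n) = ℚ.nonNegative⁻¹ (recip (suc n)) ⦃ ℚ.normalize-nonNeg 1 (suc n) ⦄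

*-mono-≤ˡ : ∀ {p q} r → 0ℚ ≤ r → p ≤ q → r * p ≤ r * q
*-mono-≤ˡ r 0≤r = ℚ.*-monoˡ-≤-nonNeg r ⦃ nonNegative 0≤r ⦄

*-mono-≤ʳ : ∀ {p q} r → 0ℚ ≤ r → p ≤ q → p * r ≤ q * r
*-mono-≤ʳ r 0≤r = ℚ.*-monoʳ-≤-nonNeg r ⦃ nonNegative 0≤r ⦄

0≤* : ∀ {p q} → 0ℚ ≤ p → 0ℚ ≤ q → 0ℚ ≤ p * q
0≤* {p} 0≤p 0≤q = subst (_≤ p * _) (ℚ.*-zeroʳ p) (*-mono-≤ˡ p 0≤p 0≤q)

0≤+ : ∀ {p q} → 0ℚ ≤ p → 0ℚ ≤ q → 0ℚ ≤ p + q
0≤+ = ℚ.+-mono-≤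

-- Most rational inequalities below are proved by naming the nonnegative difference `r`; the
-- remaining identity is left to the ring solver.
≤-excess : ∀ {p q} r → 0ℚ ≤ r → q ≡ p + r → p ≤ q
≤-excess {p} r 0≤r refl = subst (_≤ p + r) (ℚ.+-identityʳ p) (ℚ.+-monoʳ-≤ p 0≤r)

0≤difference : ∀ {p q} → p ≤ q → 0ℚ ≤ q - p
0≤difference {p} {q} p≤q = subst (_≤ q - p) (ℚ.+-inverseʳ p) (ℚ.+-monoˡ-≤ (- p) p≤q)

0≤square : ∀ p → 0ℚ ≤ p * p
0≤square p with ℚ.≤-total 0ℚ p
... | inj₁ 0≤p = 0≤* 0≤p 0≤p
... | inj₂ p≤0 = subst (0ℚ ≤_) (solve 1 (λ p → (:- p) :* (:- p) := p :* p) refl p)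
                   (0≤* (ℚ.neg-antimono-≤ p≤0) (ℚ.neg-antimono-≤ p≤0))

recip-* : ∀ m n → recip (m ℕ.* n) ≡ recip m * recip n
recip-* zero    n       = trans recip-0 (sym (trans (cong (_* recip n) recip-0) (ℚ.*-zeroˡ (recip n))))
recip-* (suc m) zero    = trans (cong recip (ℕ.*-zeroʳ (suc m))) (trans recip-0 (sym (trans (cong (recip (suc m) *_) recip-0) (ℚ.*-zeroʳ (recip (suc m))))))
recip-* (suc m) (suc n) = begin
  k                                             ≡⟨ solve 1 (λ k → k := con 1ℚ :* con 1ℚ :* k) refl k ⟩
  1ℚ * 1ℚ * k                                   ≡⟨ cong₂ (λ x y → x * y * k) (ι*recip m) (ι*recip n) ⟨
  (x * recip (suc m)) * (y * recip (suc n)) * k     ≡⟨ solve 5 (λ x x′ y y′ k → (x :* x′) :* (y :* y′) :* k := (x :* y :* k) :* (x′ :* y′)) refl x (recip (suc m)) y (recip (suc n)) k ⟩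
  (x * y * k) * (recip (suc m) * recip (suc n))     ≡⟨ cong (λ u → u * k * (recip (suc m) * recip (suc n))) (ι-* (suc m) (suc n)) ⟨
  (ι (suc m ℕ.* suc n) * k) * (recip (suc m) * recip (suc n)) ≡⟨ cong (_* (recip (suc m) * recip (suc n))) (ι*recip _) ⟩
  1ℚ * (recip (suc m) * recip (suc n))              ≡⟨ ℚ.*-identityˡ _ ⟩
  recip (suc m) * recip (suc n)                     ∎
  where
  open ≡-Reasoning
  x = ι (suc m)
  y = ι (suc n)
  k = recip (suc m ℕ.* suc n)

-- Finite sums and means

Σ : List A → (A → ℚ) → ℚ
Σ []       f = 0ℚ
Σ (x ∷ xs) f = f x + Σ xs f

foldr-Σ : ∀ (xs : List A) f → foldr (λ x s → f x + s) 0ℚ xs ≡ Σ xs f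
foldr-Σ []       f = refl
foldr-Σ (x ∷ xs) f = cong (_+_ (f x)) (foldr-Σ xs f)

Σ-cong : ∀ (xs : List A) {f g} → (∀ x → f x ≡ g x) → Σ xs f ≡ Σ xs g
Σ-cong []       f≡g = refl
Σ-cong (x ∷ xs) f≡g = cong₂ _+_ (f≡g x) (Σ-cong xs f≡g)

Σ-mono : ∀ (xs : List A) {f g} → (∀ x → f x ≤ g x) → Σ xs f ≤ Σ xs g
Σ-mono []       f≤g = ℚ.≤-refl
Σ-mono (x ∷ xs) f≤g = ℚ.+-mono-≤ (f≤g x) (Σ-mono xs f≤g)

Σ-+ : ∀ (xs : List A) f g → Σ xs (λ x → f x + g x) ≡ Σ xs f + Σ xs g
Σ-+ []       f g = refl
Σ-+ (x ∷ xs) f g = trans (cong (_+_ (f x + g x)) (Σ-+ xs f g))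
  (solve 4 (λ a b c d → (a :+ b) :+ (c :+ d) := (a :+ c) :+ (b :+ d)) refl (f x) (g x) (Σ xs f) (Σ xs g))

Σ-* : ∀ (xs : List A) c f → Σ xs (λ x → c * f x) ≡ c * Σ xs f
Σ-* []       c f = sym (ℚ.*-zeroʳ c)
Σ-* (x ∷ xs) c f = trans (cong (_+_ (c * f x)) (Σ-* xs c f)) (sym (ℚ.*-distribˡ-+ c (f x) (Σ xs f)))

Σ-const : ∀ (xs : List A) c → Σ xs (λ _ → c) ≡ ι (length xs) * c
Σ-const []       c = sym (trans (cong (_* c) ι-0) (ℚ.*-zeroˡ c))
Σ-const (x ∷ xs) c = begin
  c + Σ xs (λ _ → c)        ≡⟨ cong (_+_ c) (Σ-const xs c) ⟩
  c + ι (length xs) * c     ≡⟨ solve 2 (λ c l → c :+ l :* c := (con 1ℚ :+ l) :* c) refl c (ι (length xs)) ⟩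
  (1ℚ + ι (length xs)) * c  ≡⟨ cong (_* c) (trans (ι-+ 1 (length xs)) (cong (_+ ι (length xs)) ι-1)) ⟨
  ι (suc (length xs)) * c   ∎
  where open ≡-Reasoning

Σ-++ : ∀ (xs ys : List A) f → Σ (xs List.++ ys) f ≡ Σ xs f + Σ ys f
Σ-++ []       ys f = sym (ℚ.+-identityˡ _)
Σ-++ (x ∷ xs) ys f = trans (cong (_+_ (f x)) (Σ-++ xs ys f)) (sym (ℚ.+-assoc (f x) (Σ xs f) (Σ ys f)))

Σ-map : ∀ (h : A → B) xs f → Σ (map h xs) f ≡ Σ xs (λ x → f (h x))
Σ-map h []       f = refl
Σ-map h (x ∷ xs) f = cong (_+_ (f (h x))) (Σ-map h xs f)

Σ-cartesianProductWith : ∀ (h : A → B → C) xs ys f →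
  Σ (cartesianProductWith h xs ys) f ≡ Σ xs (λ x → Σ ys (λ y → f (h x y)))
Σ-cartesianProductWith h []       ys f = refl
Σ-cartesianProductWith h (x ∷ xs) ys f =
  trans (Σ-++ (map (h x) ys) _ f) (cong₂ _+_ (Σ-map (h x) ys f) (Σ-cartesianProductWith h xs ys f))

Σ-swap : ∀ (xs : List A) (ys : List B) (f : A → B → ℚ) →
  Σ xs (λ x → Σ ys (λ y → f x y)) ≡ Σ ys (λ y → Σ xs (λ x → f x y))
Σ-swap []       ys f = sym (trans (Σ-const ys 0ℚ) (ℚ.*-zeroʳ (ι (length ys))))
Σ-swap (x ∷ xs) ys f = trans (cong (_+_ (Σ ys (f x))) (Σ-swap xs ys f)) (sym (Σ-+ ys (f x) _))

length-cartesianProductWith : ∀ (h : A → B → C) xs ys →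
  length (cartesianProductWith h xs ys) ≡ length xs ℕ.* length ys
length-cartesianProductWith h []       ys = refl
length-cartesianProductWith h (x ∷ xs) ys =
  trans (List.length-++ (map (h x) ys)) (cong₂ ℕ._+_ (List.length-map (h x) ys) (length-cartesianProductWith h xs ys))

mean-Σ : ∀ (xs : List A) f → mean xs f ≡ Σ xs f * recip (length xs)
mean-Σ []       f = sym (ℚ.*-zeroˡ (recip 0))
mean-Σ (x ∷ xs) f = cong₂ _*_ (foldr-Σ (x ∷ xs) f) (recip-def (length xs))

mean-cong : ∀ (xs : List A) {f g} → (∀ x → f x ≡ g x) → mean xs f ≡ mean xs g
mean-cong xs {f} {g} f≡g = trans (mean-Σ xs f) (trans (cong (_* recip (length xs)) (Σ-cong xs f≡g)) (sym (mean-Σ xs g)))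

mean-mono : ∀ (xs : List A) {f g} → (∀ x → f x ≤ g x) → mean xs f ≤ mean xs g
mean-mono xs {f} {g} f≤g rewrite mean-Σ xs f | mean-Σ xs g =
  *-mono-≤ʳ (recip (length xs)) (0≤recip (length xs)) (Σ-mono xs f≤g)

mean-+ : ∀ (xs : List A) f g → mean xs (λ x → f x + g x) ≡ mean xs f + mean xs g
mean-+ xs f g rewrite mean-Σ xs (λ x → f x + g x) | mean-Σ xs f | mean-Σ xs g | Σ-+ xs f g =
  ℚ.*-distribʳ-+ (recip (length xs)) (Σ xs f) (Σ xs g)

mean-* : ∀ (xs : List A) c f → mean xs (λ x → c * f x) ≡ c * mean xs f
mean-* xs c f rewrite mean-Σ xs (λ x → c * f x) | mean-Σ xs f | Σ-* xs c f = ℚ.*-assoc c (Σ xs f) _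

-- Matching on the constructor exposes the cons cell on which `mean` computes.
data NonEmpty {A : Set} : List A → Set where
  nonEmpty : ∀ {x xs} → NonEmpty (x ∷ xs)

mean-const : ∀ {xs : List A} → NonEmpty xs → ∀ c → mean xs (λ _ → c) ≡ c
mean-const {xs = xs@(_ ∷ ys)} nonEmpty c = begin
  mean xs (λ _ → c)                      ≡⟨ mean-Σ xs (λ _ → c) ⟩
  Σ xs (λ _ → c) * recip (length xs)     ≡⟨ cong (_* recip (length xs)) (Σ-const xs c) ⟩
  ι (length xs) * c * recip (length xs)  ≡⟨ solve 3 (λ a b c → a :* b :* c := (a :* c) :* b) refl (ι (length xs)) c (recip (length xs)) ⟩
  ι (length xs) * recip (length xs) * c  ≡⟨ cong (_* c) (ι*recip (length ys)) ⟩
  1ℚ * c                               ≡⟨ ℚ.*-identityˡ c ⟩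
  c                                    ∎
  where open ≡-Reasoning

0≤mean : ∀ (xs : List A) {f} → (∀ x → 0ℚ ≤ f x) → 0ℚ ≤ mean xs f
0≤mean xs {f} 0≤f = subst (_≤ mean xs f) mean-0 (mean-mono xs 0≤f)
  where
  mean-0 : mean xs (λ _ → 0ℚ) ≡ 0ℚ
  mean-0 = trans (mean-cong xs (λ _ → sym (ℚ.*-zeroˡ 0ℚ))) (trans (mean-* xs 0ℚ (λ _ → 0ℚ)) (ℚ.*-zeroˡ (mean xs (λ _ → 0ℚ))))

mean-cartesianProductWith : ∀ (h : A → B → C) xs ys f →
  mean (cartesianProductWith h xs ys) f ≡ mean xs (λ x → mean ys (λ y → f (h x y)))
mean-cartesianProductWith h xs ys f = begin
  mean (cartesianProductWith h xs ys) f        ≡⟨ mean-Σ (cartesianProductWith h xs ys) f ⟩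
  Σ (cartesianProductWith h xs ys) f * recip (length (cartesianProductWith h xs ys))
    ≡⟨ cong₂ _*_ (Σ-cartesianProductWith h xs ys f) (trans (cong recip (length-cartesianProductWith h xs ys)) (recip-* (length xs) (length ys))) ⟩
  s * (recip (length xs) * recip (length ys))      ≡⟨ solve 3 (λ a b c → a :* (b :* c) := c :* a :* b) refl s (recip (length xs)) (recip (length ys)) ⟩
  recip (length ys) * s * recip (length xs)        ≡⟨ cong (_* recip (length xs)) (Σ-* xs (recip (length ys)) _) ⟨
  Σ xs (λ x → recip (length ys) * Σ ys (λ y → f (h x y))) * recip (length xs)
    ≡⟨ cong (_* recip (length xs)) (Σ-cong xs (λ x → trans (ℚ.*-comm (recip (length ys)) _) (sym (mean-Σ ys (λ y → f (h x y)))))) ⟩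
  Σ xs (λ x → mean ys (λ y → f (h x y))) * recip (length xs) ≡⟨ mean-Σ xs _ ⟨
  mean xs (λ x → mean ys (λ y → f (h x y)))    ∎
  where
  open ≡-Reasoning
  s = Σ xs (λ x → Σ ys (λ y → f (h x y)))

mean-Σ-swap : ∀ (xs : List A) (ys : List B) (f : A → B → ℚ) →
  mean xs (λ x → Σ ys (f x)) ≡ Σ ys (λ y → mean xs (λ x → f x y))
mean-Σ-swap xs ys f = begin
  mean xs (λ x → Σ ys (f x))                        ≡⟨ mean-Σ xs _ ⟩
  Σ xs (λ x → Σ ys (f x)) * recip (length xs)         ≡⟨ cong (_* recip (length xs)) (Σ-swap xs ys f) ⟩
  Σ ys (λ y → Σ xs (λ x → f x y)) * recip (length xs) ≡⟨ ℚ.*-comm _ (recip (length xs)) ⟩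
  recip (length xs) * Σ ys (λ y → Σ xs (λ x → f x y)) ≡⟨ Σ-* ys (recip (length xs)) _ ⟨
  Σ ys (λ y → recip (length xs) * Σ xs (λ x → f x y)) ≡⟨ Σ-cong ys (λ y → trans (ℚ.*-comm (recip (length xs)) _) (sym (mean-Σ xs _))) ⟩
  Σ ys (λ y → mean xs (λ x → f x y))                ∎
  where open ≡-Reasoning

mean-swap : ∀ (xs : List A) (ys : List B) (f : A → B → ℚ) →
  mean xs (λ x → mean ys (f x)) ≡ mean ys (λ y → mean xs (λ x → f x y))
mean-swap xs ys f = begin
  mean xs (λ x → mean ys (f x))                     ≡⟨ mean-cong xs (λ x → trans (mean-Σ ys (f x)) (ℚ.*-comm (Σ ys (f x)) (recip (length ys)))) ⟩
  mean xs (λ x → recip (length ys) * Σ ys (f x))      ≡⟨ mean-* xs (recip (length ys)) _ ⟩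
  recip (length ys) * mean xs (λ x → Σ ys (f x))      ≡⟨ cong (recip (length ys) *_) (mean-Σ-swap xs ys f) ⟩
  recip (length ys) * Σ ys (λ y → mean xs (λ x → f x y)) ≡⟨ ℚ.*-comm (recip (length ys)) _ ⟩
  Σ ys (λ y → mean xs (λ x → f x y)) * recip (length ys) ≡⟨ mean-Σ ys _ ⟨
  mean ys (λ y → mean xs (λ x → f x y))             ∎
  where open ≡-Reasoning

-- Equidistribution of the products over subsets

⟦_⟧ : Dec A → ℚ
⟦ d ⟧ = if ⌊ d ⌋ then 1ℚ else 0ℚ

⟦⟧-cong : (p : Dec A) (q : Dec B) → (A → B) → (B → A) → ⟦ p ⟧ ≡ ⟦ q ⟧
⟦⟧-cong (yes _) (yes _) f g = refl
⟦⟧-cong (yes a) (no ¬b) f g = contradiction (f a) ¬b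
⟦⟧-cong (no ¬a) (yes b) f g = contradiction (g b) ¬a
⟦⟧-cong (no _)  (no _)  f g = refl

⟦⟧-idem : (p : Dec A) → ⟦ p ⟧ * ⟦ p ⟧ ≡ ⟦ p ⟧
⟦⟧-idem (yes _) = refl
⟦⟧-idem (no _)  = refl

⟦⟧-yes : (p : Dec A) → A → ⟦ p ⟧ ≡ 1ℚ
⟦⟧-yes (yes _) a = refl
⟦⟧-yes (no ¬a) a = contradiction a ¬a

⟦⟧-no : (p : Dec A) → ¬ A → ⟦ p ⟧ ≡ 0ℚ
⟦⟧-no (yes a) ¬a = contradiction a ¬a
⟦⟧-no (no _)  ¬a = refl

0≤⟦⟧ : (p : Dec A) → 0ℚ ≤ ⟦ p ⟧
0≤⟦⟧ (yes _) = ℚ.nonNegative⁻¹ 1ℚ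
0≤⟦⟧ (no _)  = ℚ.≤-refl

Σ-0 : ∀ (xs : List A) {f} → (∀ x → f x ≡ 0ℚ) → Σ xs f ≡ 0ℚ
Σ-0 xs f≡0 = trans (Σ-cong xs f≡0) (trans (Σ-const xs 0ℚ) (ℚ.*-zeroʳ (ι (length xs))))

0≤Σ : ∀ (xs : List A) {f} → (∀ x → 0ℚ ≤ f x) → 0ℚ ≤ Σ xs f
0≤Σ []       0≤f = ℚ.≤-refl
0≤Σ (x ∷ xs) 0≤f = 0≤+ (0≤f x) (0≤Σ xs 0≤f)

member≤Σ : ∀ {xs : List A} {f} → (∀ x → 0ℚ ≤ f x) → ∀ {x} → x ∈ xs → f x ≤ Σ xs f
member≤Σ {xs = x ∷ xs} {f} 0≤f (here refl) =
  ≤-excess (Σ xs f) (0≤Σ xs 0≤f) refl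
member≤Σ {xs = y ∷ xs} {f} 0≤f (there x∈xs) =
  ℚ.≤-trans (member≤Σ 0≤f x∈xs) (≤-excess (f y) (0≤f y) (ℚ.+-comm (f y) (Σ xs f)))

Σ-allFin-suc : ∀ n (f : Fin (suc n) → ℚ) → Σ (allFin (suc n)) f ≡ f Fin.zero + Σ (allFin n) (f ∘ Fin.suc)
Σ-allFin-suc n f = cong (_+_ (f Fin.zero)) (trans (cong (λ xs → Σ xs f) (sym (List.map-tabulate (λ i → i) Fin.suc))) (Σ-map Fin.suc (allFin n) f))

Σ-delta : ∀ n (h : Fin n) (f : Fin n → ℚ) → Σ (allFin n) (λ g → ⟦ h ≟ g ⟧ * f g) ≡ f h
Σ-delta (suc n) Fin.zero f = begin
  Σ (allFin (suc n)) (λ g → ⟦ Fin.zero ≟ g ⟧ * f g) ≡⟨ Σ-allFin-suc n (λ g → ⟦ Fin.zero ≟ g ⟧ * f g) ⟩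
  1ℚ * f Fin.zero + Σ (allFin n) (λ g → 0ℚ * f (Fin.suc g)) ≡⟨ cong₂ _+_ (ℚ.*-identityˡ (f Fin.zero)) (Σ-0 (allFin n) (λ g → ℚ.*-zeroˡ (f (Fin.suc g)))) ⟩
  f Fin.zero + 0ℚ ≡⟨ ℚ.+-identityʳ _ ⟩
  f Fin.zero ∎
  where open ≡-Reasoning
Σ-delta (suc n) (Fin.suc h) f = begin
  Σ (allFin (suc n)) (λ g → ⟦ Fin.suc h ≟ g ⟧ * f g) ≡⟨ Σ-allFin-suc n (λ g → ⟦ Fin.suc h ≟ g ⟧ * f g) ⟩
  0ℚ * f Fin.zero + Σ (allFin n) (λ g → ⟦ Fin.suc h ≟ Fin.suc g ⟧ * f (Fin.suc g))
    ≡⟨ cong₂ _+_ (ℚ.*-zeroˡ (f Fin.zero)) (Σ-cong (allFin n) (λ g → cong (_* f (Fin.suc g)) (⟦⟧-cong (Fin.suc h ≟ Fin.suc g) (h ≟ g) suc-injective (cong Fin.suc)))) ⟩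
  0ℚ + Σ (allFin n) (λ g → ⟦ h ≟ g ⟧ * f (Fin.suc g)) ≡⟨ ℚ.+-identityˡ _ ⟩
  Σ (allFin n) (λ g → ⟦ h ≟ g ⟧ * f (Fin.suc g)) ≡⟨ Σ-delta n h (f ∘ Fin.suc) ⟩
  f (Fin.suc h) ∎
  where open ≡-Reasoning

-- Each term is expanded against a Kronecker delta. After the sums are exchanged, the inner one
-- ranges over the preimages of h, and `from h` is the only one.
Σ-reindex : ∀ n (to from : Fin n → Fin n) → (∀ g h → to g ≡ h → from h ≡ g) → (∀ g h → from h ≡ g → to g ≡ h) →
  ∀ f → Σ (allFin n) (f ∘ to) ≡ Σ (allFin n) f
Σ-reindex n to from to⇒from from⇒to f = begin
  Σ (allFin n) (λ g → f (to g))                                          ≡⟨ Σ-cong (allFin n) (λ g → sym (Σ-delta n (to g) f)) ⟩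
  Σ (allFin n) (λ g → Σ (allFin n) (λ h → ⟦ to g ≟ h ⟧ * f h))           ≡⟨ Σ-swap (allFin n) (allFin n) _ ⟩
  Σ (allFin n) (λ h → Σ (allFin n) (λ g → ⟦ to g ≟ h ⟧ * f h))           ≡⟨ Σ-cong (allFin n) (λ h → Σ-cong (allFin n) (λ g → cong (_* f h) (⟦⟧-cong (to g ≟ h) (from h ≟ g) (to⇒from g h) (from⇒to g h)))) ⟩
  Σ (allFin n) (λ h → Σ (allFin n) (λ g → ⟦ from h ≟ g ⟧ * f h))         ≡⟨ Σ-cong (allFin n) (λ h → Σ-delta n (from h) (λ _ → f h)) ⟩
  Σ (allFin n) f                                                         ∎
  where open ≡-Reasoning

Σ-allFin-const : ∀ n c → Σ (allFin n) (λ _ → c) ≡ ι n * c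
Σ-allFin-const n c = trans (Σ-const (allFin n) c) (cong (λ m → ι m * c) (List.length-tabulate (λ (i : Fin n) → i)))

-2ℚ : ℚ
-2ℚ = - (+ 2 / 1)

opaque
  unfolding recip
  recip-1 : recip 1 ≡ 1ℚ
  recip-1 = refl
  recip-2 : recip 2 ≡ ½
  recip-2 = refl

mean-Subset-suc : ∀ {m} (f : Subset (suc m) → ℚ) →
  mean (allSubsets (suc m)) f ≡ ½ * (mean (allSubsets m) (f ∘ (inside ∷_)) + mean (allSubsets m) (f ∘ (outside ∷_)))
mean-Subset-suc {m} f = trans (mean-cartesianProductWith _∷_ (inside ∷ outside ∷ []) (allSubsets m) f)
  (solve 2 (λ x y → (x :+ (y :+ con 0ℚ)) :* con ½ := con ½ :* (x :+ y)) refl (mean (allSubsets m) (f ∘ (inside ∷_))) (mean (allSubsets m) (f ∘ (outside ∷_))))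

length-allSubsets : ∀ m → length (allSubsets m) ≡ 2 ℕ.^ m
length-allSubsets zero    = refl
length-allSubsets (suc m) = trans (length-cartesianProductWith _∷_ (inside ∷ outside ∷ []) (allSubsets m)) (cong (2 ℕ.*_) (length-allSubsets m))

cartesianProductWith-nonEmpty : ∀ (h : A → B → C) {xs ys} → NonEmpty xs → NonEmpty ys →
  NonEmpty (List.cartesianProductWith h xs ys)
cartesianProductWith-nonEmpty h nonEmpty nonEmpty = nonEmpty

allVecs-nonEmpty : ∀ {xs : List A} → NonEmpty xs → ∀ m → NonEmpty (allVecs xs m)
allVecs-nonEmpty ne zero    = nonEmpty
allVecs-nonEmpty ne (suc m) = cartesianProductWith-nonEmpty _∷_ ne (allVecs-nonEmpty ne m)

allSubsets-nonEmpty : ∀ m → NonEmpty (allSubsets m)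
allSubsets-nonEmpty = allVecs-nonEmpty nonEmpty

allFin-nonEmpty : ∀ {n} → Fin n → NonEmpty (allFin n)
allFin-nonEmpty {suc n} _ = nonEmpty

square-bounds : ∀ {f} → f * f ≤ ½ * ½ → (-½ ≤ f) × (f ≤ ½)
square-bounds {f} f²≤¼ = lower , upper
  where
  too-large : ∀ x → ½ < x → ½ * ½ < x * x
  too-large x ½<x = ℚ.<-trans (ℚ.*-monoˡ-<-pos ½ ½<x) (ℚ.*-monoʳ-<-pos x ⦃ positive (ℚ.<-trans (ℚ.positive⁻¹ ½) ½<x) ⦄ ½<x)
  upper : f ≤ ½
  upper with f ℚ.≤? ½
  ... | yes f≤½ = f≤½
  ... | no  f≰½ = contradiction (ℚ.<-≤-trans (too-large f (ℚ.≰⇒> f≰½)) f²≤¼) (ℚ.<-irrefl refl)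
  lower : -½ ≤ f
  lower with -½ ℚ.≤? f
  ... | yes -½≤f = -½≤f
  ... | no  -½≰f = contradiction
    (ℚ.<-≤-trans (too-large (- f) (ℚ.neg-antimono-< (ℚ.≰⇒> -½≰f)))
      (subst (_≤ ½ * ½) (solve 1 (λ f → f :* f := (:- f) :* (:- f)) refl f) f²≤¼)) (ℚ.<-irrefl refl)

module GroupFacts {n} (G : BlackBoxGroup n) where
  open BlackBoxGroup G public
  open Products G public

  group : Group _ _
  group = record { isGroup = isGroup }

  open Group group public using (assoc; identityˡ; identityʳ; inverseˡ; inverseʳ)
  open GroupProperties group public using (⁻¹-anti-homo-∙; ⁻¹-involutive; ε⁻¹≈ε)

  cancel-left : ∀ s g → s ∙ (s ⁻¹ ∙ g) ≡ g
  cancel-left s g = trans (sym (assoc s (s ⁻¹) g)) (trans (cong (_∙ g) (inverseʳ s)) (identityˡ g))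

  cancel-left⁻¹ : ∀ s g → s ⁻¹ ∙ (s ∙ g) ≡ g
  cancel-left⁻¹ s g = trans (sym (assoc (s ⁻¹) s g)) (trans (cong (_∙ g) (inverseˡ s)) (identityˡ g))

  cancel-right⁻¹ : ∀ s g → g ∙ s ⁻¹ ∙ s ≡ g
  cancel-right⁻¹ s g = trans (assoc g (s ⁻¹) s) (trans (cong (g ∙_) (inverseˡ s)) (identityʳ g))

  product-++ : ∀ xs ys → product (xs List.++ ys) ≡ product xs ∙ product ys
  product-++ []       ys = sym (identityˡ _)
  product-++ (x ∷ xs) ys = trans (cong (x ∙_) (product-++ xs ys)) (sym (assoc x _ _))

  product-μ : ∀ ys → product (μ ys) ≡ product ys ⁻¹
  product-μ []       = sym ε⁻¹≈ε
  product-μ (y ∷ ys) = begin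
    product (List.reverse (y ⁻¹ ∷ map _⁻¹ ys))   ≡⟨ cong product (List.unfold-reverse (y ⁻¹) (map _⁻¹ ys)) ⟩
    product (μ ys List.++ (y ⁻¹ ∷ []))           ≡⟨ product-++ (μ ys) _ ⟩
    product (μ ys) ∙ (y ⁻¹ ∙ ε)                  ≡⟨ cong₂ _∙_ (product-μ ys) (identityʳ (y ⁻¹)) ⟩
    product ys ⁻¹ ∙ y ⁻¹                         ≡⟨ ⁻¹-anti-homo-∙ y (product ys) ⟨
    (y ∙ product ys) ⁻¹                          ∎
    where open ≡-Reasoning

module Equidistribution {n} (G : BlackBoxGroup n) where
  open GroupFacts G

  frequency : ∀ {a} → Vec (Fin n) a → Fin n → ℚ
  frequency {a} A g = mean (allSubsets a) (λ x → ⟦ product (subsequence A x) ≟ g ⟧)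

  -- Defined by recursion on the sequence, so that the effect of one more random entry on the energy
  -- is visible by unfolding; `frequency-deviation` identifies it with n · frequency - 1.
  deviation : ∀ {a} → Vec (Fin n) a → Fin n → ℚ
  deviation []      g = ι n * ⟦ ε ≟ g ⟧ - 1ℚ
  deviation (s ∷ A) g = ½ * (deviation A (s ⁻¹ ∙ g) + deviation A g)

  frequency-deviation : ∀ {a} (A : Vec (Fin n) a) g → ι n * frequency A g ≡ 1ℚ + deviation A g
  frequency-deviation [] g = trans (cong (ι n *_) (mean-const (allSubsets-nonEmpty 0) ⟦ ε ≟ g ⟧))
    (solve 1 (λ x → x := con 1ℚ :+ (x :- con 1ℚ)) refl _)
  frequency-deviation (s ∷ A) g = begin
    ι n * frequency (s ∷ A) g
      ≡⟨ cong (ι n *_) (mean-Subset-suc (λ x → ⟦ product (subsequence (s ∷ A) x) ≟ g ⟧)) ⟩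
    ι n * (½ * (mean (allSubsets _) (λ x → ⟦ s ∙ product (subsequence A x) ≟ g ⟧) + frequency A g))
      ≡⟨ cong (λ u → ι n * (½ * (u + frequency A g))) (mean-cong (allSubsets _) (λ x → ⟦⟧-cong (s ∙ product (subsequence A x) ≟ g) (product (subsequence A x) ≟ s ⁻¹ ∙ g) (λ eq → trans (sym (cancel-left⁻¹ s _)) (cong (s ⁻¹ ∙_) eq)) (λ eq → trans (cong (s ∙_) eq) (cancel-left s g)))) ⟩
    ι n * (½ * (frequency A (s ⁻¹ ∙ g) + frequency A g))
      ≡⟨ solve 3 (λ n x y → n :* (con ½ :* (x :+ y)) := con ½ :* (n :* x :+ n :* y)) refl (ι n) _ _ ⟩
    ½ * (ι n * frequency A (s ⁻¹ ∙ g) + ι n * frequency A g)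
      ≡⟨ cong₂ (λ u v → ½ * (u + v)) (frequency-deviation A (s ⁻¹ ∙ g)) (frequency-deviation A g) ⟩
    ½ * ((1ℚ + deviation A (s ⁻¹ ∙ g)) + (1ℚ + deviation A g))
      ≡⟨ solve 2 (λ x y → con ½ :* ((con 1ℚ :+ x) :+ (con 1ℚ :+ y)) := con 1ℚ :+ con ½ :* (x :+ y)) refl (deviation A (s ⁻¹ ∙ g)) (deviation A g) ⟩
    1ℚ + deviation (s ∷ A) g ∎
    where open ≡-Reasoning

  ΣG : (Fin n → ℚ) → ℚ
  ΣG = Σ (allFin n)

  ΣG-translate : ∀ s f → ΣG (λ g → f (s ⁻¹ ∙ g)) ≡ ΣG f
  ΣG-translate s = Σ-reindex n (s ⁻¹ ∙_) (s ∙_)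
    (λ g h eq → trans (cong (s ∙_) (sym eq)) (cancel-left s g))
    (λ g h eq → trans (cong (s ⁻¹ ∙_) (sym eq)) (cancel-left⁻¹ s h))

  ΣG-reflect : ∀ g f → ΣG (λ s → f (s ⁻¹ ∙ g)) ≡ ΣG f
  ΣG-reflect g = Σ-reindex n (λ s → s ⁻¹ ∙ g) (λ h → g ∙ h ⁻¹)
    (λ s h eq → trans (cong (λ u → g ∙ u ⁻¹) (sym eq))
                  (trans (cong (g ∙_) (trans (⁻¹-anti-homo-∙ (s ⁻¹) g) (cong (g ⁻¹ ∙_) (⁻¹-involutive s)))) (cancel-left g s)))
    (λ s h eq → trans (cong (λ u → u ⁻¹ ∙ g) (sym eq))
                  (trans (cong (_∙ g) (trans (⁻¹-anti-homo-∙ g (h ⁻¹)) (cong (_∙ g ⁻¹) (⁻¹-involutive h)))) (cancel-right⁻¹ g h)))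

  ΣG-deviation : ∀ {a} (A : Vec (Fin n) a) → ΣG (deviation A) ≡ 0ℚ
  ΣG-deviation [] = begin
    ΣG (λ g → ι n * ⟦ ε ≟ g ⟧ - 1ℚ)                     ≡⟨ Σ-cong (allFin n) (λ g → cong (_- 1ℚ) (ℚ.*-comm (ι n) _)) ⟩
    ΣG (λ g → ⟦ ε ≟ g ⟧ * ι n - 1ℚ)                     ≡⟨ Σ-+ (allFin n) (λ g → ⟦ ε ≟ g ⟧ * ι n) (λ _ → - 1ℚ) ⟩
    ΣG (λ g → ⟦ ε ≟ g ⟧ * ι n) + ΣG (λ _ → - 1ℚ)        ≡⟨ cong₂ _+_ (Σ-delta n ε (λ _ → ι n)) (Σ-allFin-const n (- 1ℚ)) ⟩
    ι n + ι n * - 1ℚ                                    ≡⟨ solve 1 (λ n → n :+ n :* con (- 1ℚ) := con 0ℚ) refl (ι n) ⟩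
    0ℚ                                                  ∎
    where open ≡-Reasoning
  ΣG-deviation (s ∷ A) = begin
    ΣG (deviation (s ∷ A))                                       ≡⟨ Σ-* (allFin n) ½ _ ⟩
    ½ * ΣG (λ g → deviation A (s ⁻¹ ∙ g) + deviation A g)        ≡⟨ cong (½ *_) (Σ-+ (allFin n) _ (deviation A)) ⟩
    ½ * (ΣG (λ g → deviation A (s ⁻¹ ∙ g)) + ΣG (deviation A))   ≡⟨ cong₂ (λ u v → ½ * (u + v)) (trans (ΣG-translate s (deviation A)) (ΣG-deviation A)) (ΣG-deviation A) ⟩
    ½ * (0ℚ + 0ℚ)                                                ≡⟨⟩
    0ℚ                                                           ∎
    where open ≡-Reasoning

  energy : ∀ {a} → Vec (Fin n) a → ℚ
  energy A = ΣG (λ g → deviation A g * deviation A g)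

  0≤energy : ∀ {a} (A : Vec (Fin n) a) → 0ℚ ≤ energy A
  0≤energy A = 0≤Σ (allFin n) (λ g → 0≤square (deviation A g))

  -- The exact value is n² - n, and the excess is n.
  energy-[] : energy [] ≤ ι n * ι n
  energy-[] = ≤-excess (ι n) (0≤ι n) (sym (begin
    energy [] + ι n
      ≡⟨ cong (_+ ι n) (Σ-cong (allFin n) (λ g → trans (solve 2 (λ n x → (n :* x :- con 1ℚ) :* (n :* x :- con 1ℚ) := n :* n :* (x :* x) :+ (con -2ℚ :* n :* x :+ con 1ℚ)) refl (ι n) ⟦ ε ≟ g ⟧)
          (trans (cong (λ u → ι n * ι n * u + (-2ℚ * ι n * ⟦ ε ≟ g ⟧ + 1ℚ)) (⟦⟧-idem (ε ≟ g)))
            (solve 2 (λ n x → n :* n :* x :+ (con -2ℚ :* n :* x :+ con 1ℚ) := x :* (n :* n :+ con -2ℚ :* n) :+ con 1ℚ) refl (ι n) ⟦ ε ≟ g ⟧)))) ⟩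
    ΣG (λ g → ⟦ ε ≟ g ⟧ * (ι n * ι n + -2ℚ * ι n) + 1ℚ) + ι n
      ≡⟨ cong (_+ ι n) (Σ-+ (allFin n) _ (λ _ → 1ℚ)) ⟩
    ΣG (λ g → ⟦ ε ≟ g ⟧ * (ι n * ι n + -2ℚ * ι n)) + ΣG (λ _ → 1ℚ) + ι n
      ≡⟨ cong (_+ ι n) (cong₂ _+_ (Σ-delta n ε (λ _ → ι n * ι n + -2ℚ * ι n)) (Σ-allFin-const n 1ℚ)) ⟩
    ι n * ι n + -2ℚ * ι n + ι n * 1ℚ + ι n
      ≡⟨ solve 1 (λ n → n :* n :+ con -2ℚ :* n :+ n :* con 1ℚ :+ n := n :* n) refl (ι n) ⟩
    ι n * ι n ∎))
    where open ≡-Reasoning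

  -- The cross term Σ_g f(g)f(s⁻¹g) averages to zero over s because Σ f = 0.
  mean-energy : ∀ {a} (A : Vec (Fin n) a) → mean (allFin n) (λ s → energy (s ∷ A)) ≡ ½ * energy A
  mean-energy A = begin
    mean (allFin n) (λ s → energy (s ∷ A))
      ≡⟨ mean-cong (allFin n) expand ⟩
    mean (allFin n) (λ s → ½ * energy A + ½ * ΣG (λ g → f g * f (s ⁻¹ ∙ g)))
      ≡⟨ mean-+ (allFin n) _ _ ⟩
    mean (allFin n) (λ _ → ½ * energy A) + mean (allFin n) (λ s → ½ * ΣG (λ g → f g * f (s ⁻¹ ∙ g)))
      ≡⟨ cong₂ _+_ (mean-const (allFin-nonEmpty ε) (½ * energy A)) cross ⟩
    ½ * energy A + 0ℚ
      ≡⟨ ℚ.+-identityʳ _ ⟩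
    ½ * energy A ∎
    where
    open ≡-Reasoning
    f = deviation A

    expand : ∀ s → energy (s ∷ A) ≡ ½ * energy A + ½ * ΣG (λ g → f g * f (s ⁻¹ ∙ g))
    expand s = begin
      energy (s ∷ A)
        ≡⟨ Σ-cong (allFin n) (λ g → solve 2 (λ x y → con ½ :* (x :+ y) :* (con ½ :* (x :+ y)) := con (½ * ½) :* (x :* x) :+ (con (½ * ½) :* (y :* y) :+ con ½ :* (y :* x))) refl (f (s ⁻¹ ∙ g)) (f g)) ⟩
      ΣG (λ g → ½ * ½ * (f (s ⁻¹ ∙ g) * f (s ⁻¹ ∙ g)) + (½ * ½ * (f g * f g) + ½ * (f g * f (s ⁻¹ ∙ g))))
        ≡⟨ trans (Σ-+ (allFin n) _ _) (cong (_+_ (ΣG (λ g → ½ * ½ * (f (s ⁻¹ ∙ g) * f (s ⁻¹ ∙ g))))) (Σ-+ (allFin n) _ _)) ⟩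
      ΣG (λ g → ½ * ½ * (f (s ⁻¹ ∙ g) * f (s ⁻¹ ∙ g))) + (ΣG (λ g → ½ * ½ * (f g * f g)) + ΣG (λ g → ½ * (f g * f (s ⁻¹ ∙ g))))
        ≡⟨ cong₂ _+_ (trans (Σ-* (allFin n) (½ * ½) _) (cong (½ * ½ *_) (ΣG-translate s (λ g → f g * f g)))) (cong₂ _+_ (Σ-* (allFin n) (½ * ½) _) (Σ-* (allFin n) ½ _)) ⟩
      ½ * ½ * energy A + (½ * ½ * energy A + ½ * ΣG (λ g → f g * f (s ⁻¹ ∙ g)))
        ≡⟨ solve 2 (λ d x → con (½ * ½) :* d :+ (con (½ * ½) :* d :+ con ½ :* x) := con ½ :* d :+ con ½ :* x) refl (energy A) (ΣG (λ g → f g * f (s ⁻¹ ∙ g))) ⟩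
      ½ * energy A + ½ * ΣG (λ g → f g * f (s ⁻¹ ∙ g)) ∎

    cross : mean (allFin n) (λ s → ½ * ΣG (λ g → f g * f (s ⁻¹ ∙ g))) ≡ 0ℚ
    cross = begin
      mean (allFin n) (λ s → ½ * ΣG (λ g → f g * f (s ⁻¹ ∙ g)))     ≡⟨ mean-* (allFin n) ½ _ ⟩
      ½ * mean (allFin n) (λ s → ΣG (λ g → f g * f (s ⁻¹ ∙ g)))     ≡⟨ cong (½ *_) (mean-Σ-swap (allFin n) (allFin n) (λ s g → f g * f (s ⁻¹ ∙ g))) ⟩
      ½ * ΣG (λ g → mean (allFin n) (λ s → f g * f (s ⁻¹ ∙ g)))     ≡⟨ cong (½ *_) (Σ-0 (allFin n) (λ g → trans (mean-* (allFin n) (f g) _)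
          (trans (cong (f g *_) (trans (mean-Σ (allFin n) _) (trans (cong (_* recip (length (allFin n))) (trans (ΣG-reflect g f) (ΣG-deviation A))) (ℚ.*-zeroˡ (recip (length (allFin n))))))) (ℚ.*-zeroʳ (f g))))) ⟩
      ½ * 0ℚ                                                        ≡⟨⟩
      0ℚ                                                            ∎

  -- The two averages are exchanged so that the first entry is averaged against a fixed tail. Then
  -- `mean-energy` gives one factor ½ for each of the `a` entries.
  mean-energy-take : ∀ a b → mean (allVecs (allFin n) (a ℕ.+ b)) (λ S → energy (take a S)) ≡ recip (2 ℕ.^ a) * energy []
  mean-energy-take zero b = begin
    mean (allVecs (allFin n) b) (λ _ → energy [])   ≡⟨ mean-const (allVecs-nonEmpty (allFin-nonEmpty ε) b) (energy []) ⟩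
    energy []                                       ≡⟨ ℚ.*-identityˡ (energy []) ⟨
    1ℚ * energy []                                  ≡⟨ cong (_* energy []) recip-1 ⟨
    recip 1 * energy []                             ∎
    where open ≡-Reasoning
  mean-energy-take (suc a) b = begin
    mean (allVecs (allFin n) (suc a ℕ.+ b)) (λ S → energy (take (suc a) S))
      ≡⟨ mean-cartesianProductWith _∷_ (allFin n) Ss (λ S → energy (take (suc a) S)) ⟩
    mean (allFin n) (λ s → mean Ss (λ S → energy (s ∷ take a S)))
      ≡⟨ mean-swap (allFin n) Ss (λ s S → energy (s ∷ take a S)) ⟩
    mean Ss (λ S → mean (allFin n) (λ s → energy (s ∷ take a S)))
      ≡⟨ mean-cong Ss (λ S → mean-energy (take a S)) ⟩
    mean Ss (λ S → ½ * energy (take a S))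
      ≡⟨ mean-* Ss ½ (λ S → energy (take a S)) ⟩
    ½ * mean Ss (λ S → energy (take a S))
      ≡⟨ cong₂ _*_ (sym recip-2) (mean-energy-take a b) ⟩
    recip 2 * (recip (2 ℕ.^ a) * energy [])
      ≡⟨ ℚ.*-assoc (recip 2) (recip (2 ℕ.^ a)) (energy []) ⟨
    recip 2 * recip (2 ℕ.^ a) * energy []
      ≡⟨ cong (_* energy []) (recip-* 2 (2 ℕ.^ a)) ⟨
    recip (2 ℕ.^ suc a) * energy [] ∎
    where
    open ≡-Reasoning
    Ss = allVecs (allFin n) (a ℕ.+ b)

  mean-drop : ∀ a b (f : Vec (Fin n) b → ℚ) →
    mean (allVecs (allFin n) (a ℕ.+ b)) (λ S → f (drop a S)) ≡ mean (allVecs (allFin n) b) f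
  mean-drop zero    b f = refl
  mean-drop (suc a) b f = begin
    mean (allVecs (allFin n) (suc a ℕ.+ b)) (λ S → f (drop (suc a) S))
      ≡⟨ mean-cartesianProductWith _∷_ (allFin n) Ss (λ S → f (drop (suc a) S)) ⟩
    mean (allFin n) (λ s → mean Ss (λ S → f (drop a S)))
      ≡⟨ mean-const (allFin-nonEmpty ε) (mean Ss (λ S → f (drop a S))) ⟩
    mean Ss (λ S → f (drop a S))
      ≡⟨ mean-drop a b f ⟩
    mean (allVecs (allFin n) b) f ∎
    where
    open ≡-Reasoning
    Ss = allVecs (allFin n) (a ℕ.+ b)

  -- `take b S` and `S` have the lengths `b` and `b + 0`, which are not definitionally equal, so
  -- they are compared through a function `f` that accepts every length.
  take-all : ∀ {b} (S : Vec (Fin n) (b ℕ.+ 0)) → ∀ {f : ∀ {c} → Vec (Fin n) c → ℚ} → f (take b S) ≡ f S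
  take-all {zero}  []      {f} = refl
  take-all {suc b} (s ∷ S) {f} = take-all S {λ A → f (s ∷ A)}

  mean-energy-drop : ∀ a b → mean (allVecs (allFin n) (a ℕ.+ b)) (λ S → energy (drop a S)) ≡ recip (2 ℕ.^ b) * energy []
  mean-energy-drop a b = begin
    mean (allVecs (allFin n) (a ℕ.+ b)) (λ S → energy (drop a S))   ≡⟨ mean-drop a b energy ⟩
    mean (allVecs (allFin n) b) energy                              ≡⟨ mean-energy-all b ⟩
    recip (2 ℕ.^ b) * energy []                                     ∎
    where
    open ≡-Reasoning
    mean-energy-all : ∀ b → mean (allVecs (allFin n) b) energy ≡ recip (2 ℕ.^ b) * energy []
    mean-energy-all b = subst (λ c → mean (allVecs (allFin n) c) energy ≡ recip (2 ℕ.^ b) * energy []) (ℕ.+-identityʳ b)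
      (trans (mean-cong (allVecs (allFin n) (b ℕ.+ 0)) (λ S → sym (take-all S {energy}))) (mean-energy-take b 0))

  -- The bound holds at all elements g simultaneously, which is what makes it usable for every
  -- target.
  Balanced : ∀ {a} → Vec (Fin n) a → Set
  Balanced A = ∀ g → (½ ≤ ι n * frequency A g) × (ι n * frequency A g ≤ 1ℚ + ½)

  -- One square is at most the whole sum of squares, so every deviation has absolute value at most
  -- ½.
  energy-balanced : ∀ {a} (A : Vec (Fin n) a) → energy A ≤ ½ * ½ → Balanced A
  energy-balanced A small g =
    subst (½ ≤_) (sym (frequency-deviation A g)) (ℚ.+-monoʳ-≤ 1ℚ (proj₁ bounds)) ,
    subst (_≤ 1ℚ + ½) (sym (frequency-deviation A g)) (ℚ.+-monoʳ-≤ 1ℚ (proj₂ bounds))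
    where
    f = deviation A g
    f²≤¼ : f * f ≤ ½ * ½
    f²≤¼ = ℚ.≤-trans (member≤Σ {f = λ g → deviation A g * deviation A g} (λ g → 0≤square (deviation A g)) (∈-allFin g)) small
    bounds : (-½ ≤ f) × (f ≤ ½)
    bounds = square-bounds f²≤¼

  -- Markov's inequality for the sum of the energies of the two halves.
  balanced-likely : ∀ a b r → ι n * ι n * (recip (2 ℕ.^ a) + recip (2 ℕ.^ b)) ≤ r →
    RandomSequence≥ n (a ℕ.+ b) (1ℚ - (1ℚ + 1ℚ) * (1ℚ + 1ℚ) * r) (λ S → Balanced (take a S) × Balanced (drop a S))
  balanced-likely a b r bound = (λ S → ⌊ E? S ⌋) , likely , sound
    where
    Ss = allVecs (allFin n) (a ℕ.+ b)
    total : Vec (Fin n) (a ℕ.+ b) → ℚ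
    total S = energy (take a S) + energy (drop a S)
    E? : ∀ S → Dec (total S ≤ ½ * ½)
    E? S = total S ℚ.≤? ½ * ½
    4ℚ = (1ℚ + 1ℚ) * (1ℚ + 1ℚ)

    sound : ∀ S → ⌊ E? S ⌋ ≡ true → Balanced (take a S) × Balanced (drop a S)
    sound S eq with E? S
    ... | yes small = energy-balanced (take a S) (ℚ.≤-trans (≤-excess _ (0≤energy (drop a S)) refl) small)
                    , energy-balanced (drop a S) (ℚ.≤-trans (≤-excess _ (0≤energy (take a S)) (ℚ.+-comm (energy (take a S)) (energy (drop a S)))) small)
    ... | no _ with () ← eq

    -- The threshold for the total energy is ¼, whence the factor 4.
    markov : ∀ S → 1ℚ + - 4ℚ * total S ≤ ⟦ E? S ⟧
    markov S with E? S
    ... | yes _ = ≤-excess (4ℚ * total S) (0≤* (ℚ.nonNegative⁻¹ 4ℚ) (0≤+ (0≤energy (take a S)) (0≤energy (drop a S))))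
                    (solve 1 (λ t → con 1ℚ := con 1ℚ :+ con (- 4ℚ) :* t :+ con 4ℚ :* t) refl (total S))
    ... | no large = ≤-excess (4ℚ * (total S - ½ * ½)) (0≤* (ℚ.nonNegative⁻¹ 4ℚ) (0≤difference (ℚ.<⇒≤ (ℚ.≰⇒> large))))
                    (solve 1 (λ t → con 0ℚ := con 1ℚ :+ con (- 4ℚ) :* t :+ con 4ℚ :* (t :- con (½ * ½))) refl (total S))

    mean-total : mean Ss total ≤ r
    mean-total = begin
      mean Ss total
        ≡⟨ trans (mean-+ Ss (λ S → energy (take a S)) (λ S → energy (drop a S))) (cong₂ _+_ (mean-energy-take a b) (mean-energy-drop a b)) ⟩
      recip (2 ℕ.^ a) * energy [] + recip (2 ℕ.^ b) * energy []
        ≡⟨ ℚ.*-distribʳ-+ (energy []) (recip (2 ℕ.^ a)) (recip (2 ℕ.^ b)) ⟨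
      (recip (2 ℕ.^ a) + recip (2 ℕ.^ b)) * energy []
        ≤⟨ *-mono-≤ˡ (recip (2 ℕ.^ a) + recip (2 ℕ.^ b)) (0≤+ (0≤recip (2 ℕ.^ a)) (0≤recip (2 ℕ.^ b))) energy-[] ⟩
      (recip (2 ℕ.^ a) + recip (2 ℕ.^ b)) * (ι n * ι n)
        ≡⟨ ℚ.*-comm (recip (2 ℕ.^ a) + recip (2 ℕ.^ b)) (ι n * ι n) ⟩
      ι n * ι n * (recip (2 ℕ.^ a) + recip (2 ℕ.^ b))
        ≤⟨ bound ⟩
      r ∎
      where open ℚ.≤-Reasoning

    likely : 1ℚ - 4ℚ * r ≤ mean Ss (λ S → ⟦ E? S ⟧)
    likely = begin
      1ℚ - 4ℚ * r
        ≤⟨ ℚ.+-monoʳ-≤ 1ℚ (ℚ.neg-antimono-≤ (*-mono-≤ˡ 4ℚ (ℚ.nonNegative⁻¹ 4ℚ) mean-total)) ⟩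
      1ℚ - 4ℚ * mean Ss total
        ≡⟨ cong (_+_ 1ℚ) (ℚ.neg-distribˡ-* 4ℚ (mean Ss total)) ⟩
      1ℚ + - 4ℚ * mean Ss total
        ≡⟨ cong₂ _+_ (mean-const (allVecs-nonEmpty (allFin-nonEmpty ε) (a ℕ.+ b)) 1ℚ) (mean-* Ss (- 4ℚ) total) ⟨
      mean Ss (λ _ → 1ℚ) + mean Ss (λ S → - 4ℚ * total S)
        ≡⟨ mean-+ Ss (λ _ → 1ℚ) (λ S → - 4ℚ * total S) ⟨
      mean Ss (λ S → 1ℚ + - 4ℚ * total S)
        ≤⟨ mean-mono Ss markov ⟩
      mean Ss (λ S → ⟦ E? S ⟧) ∎
      where open ℚ.≤-Reasoning

-- The distribution of π on 𝒞

side : ∀ {a b} → 𝒞 a b → Bool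
side (inj₁ _) = true
side (inj₂ _) = false

⅓ ⅙ : ℚ
⅓ = + 1 / 3
⅙ = + 1 / 6

all𝒞-nonEmpty : ∀ a b → NonEmpty (all𝒞 a b)
all𝒞-nonEmpty a b with allSubsets a | allSubsets-nonEmpty a
... | _ | nonEmpty = nonEmpty

-- The probability that a uniform element of 𝒞 lies in 𝒜. With the arguments exchanged it is the
-- probability of ℬ.
weight : ℕ → ℕ → ℚ
weight a b = ι (2 ℕ.^ a) * recip (2 ℕ.^ a ℕ.+ 2 ℕ.^ b)

0≤weight : ∀ a b → 0ℚ ≤ weight a b
0≤weight a b = 0≤* (0≤ι (2 ℕ.^ a)) (0≤recip (2 ℕ.^ a ℕ.+ 2 ℕ.^ b))

ι*recip′ : ∀ n → 0 ℕ.< n → ι n * recip n ≡ 1ℚ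
ι*recip′ (suc n) _ = ι*recip n

0<2^ : ∀ a → 0 ℕ.< 2 ℕ.^ a
0<2^ a = ℕ.m^n>0 2 a

weights : ∀ a b → weight a b + weight b a ≡ 1ℚ
weights a b = begin
  weight a b + ι (2 ℕ.^ b) * recip (2 ℕ.^ b ℕ.+ 2 ℕ.^ a) ≡⟨ cong (λ m → weight a b + ι (2 ℕ.^ b) * recip m) (ℕ.+-comm (2 ℕ.^ b) (2 ℕ.^ a)) ⟩
  ι (2 ℕ.^ a) * r + ι (2 ℕ.^ b) * r    ≡⟨ ℚ.*-distribʳ-+ r (ι (2 ℕ.^ a)) (ι (2 ℕ.^ b)) ⟨
  (ι (2 ℕ.^ a) + ι (2 ℕ.^ b)) * r      ≡⟨ cong (_* r) (ι-+ (2 ℕ.^ a) (2 ℕ.^ b)) ⟨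
  ι (2 ℕ.^ a ℕ.+ 2 ℕ.^ b) * r          ≡⟨ ι*recip′ _ (ℕ.<-≤-trans (0<2^ a) (ℕ.m≤m+n (2 ℕ.^ a) (2 ℕ.^ b))) ⟩
  1ℚ                                   ∎
  where
  open ≡-Reasoning
  r = recip (2 ℕ.^ a ℕ.+ 2 ℕ.^ b)

mean-all𝒞 : ∀ a b (f : 𝒞 a b → ℚ) → mean (all𝒞 a b) f ≡
  weight a b * mean (allSubsets a) (f ∘ inj₁) + weight b a * mean (allSubsets b) (f ∘ inj₂)
mean-all𝒞 a b f = begin
  mean (all𝒞 a b) f
    ≡⟨ mean-Σ (all𝒞 a b) f ⟩
  Σ (all𝒞 a b) f * recip (length (all𝒞 a b))
    ≡⟨ cong₂ _*_ (trans (Σ-++ (map inj₁ (allSubsets a)) (map inj₂ (allSubsets b)) f) (cong₂ _+_ (Σ-map inj₁ (allSubsets a) f) (Σ-map inj₂ (allSubsets b) f)))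
         (cong recip (trans (List.length-++ (map inj₁ (allSubsets a))) (cong₂ ℕ._+_ (trans (List.length-map inj₁ (allSubsets a)) (length-allSubsets a)) (trans (List.length-map inj₂ (allSubsets b)) (length-allSubsets b))))) ⟩
  (Σ (allSubsets a) (f ∘ inj₁) + Σ (allSubsets b) (f ∘ inj₂)) * r
    ≡⟨ cong (_* r) (cong₂ _+_ (Σ-mean a (f ∘ inj₁)) (Σ-mean b (f ∘ inj₂))) ⟩
  (ι (2 ℕ.^ a) * mA + ι (2 ℕ.^ b) * mB) * r
    ≡⟨ solve 5 (λ x y r u v → (x :* u :+ y :* v) :* r := x :* r :* u :+ y :* r :* v) refl (ι (2 ℕ.^ a)) (ι (2 ℕ.^ b)) r mA mB ⟩
  weight a b * mA + ι (2 ℕ.^ b) * r * mB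
    ≡⟨ cong (λ m → weight a b * mA + ι (2 ℕ.^ b) * recip m * mB) (ℕ.+-comm (2 ℕ.^ a) (2 ℕ.^ b)) ⟩
  weight a b * mA + weight b a * mB ∎
  where
  open ≡-Reasoning
  r = recip (2 ℕ.^ a ℕ.+ 2 ℕ.^ b)
  mA = mean (allSubsets a) (f ∘ inj₁)
  mB = mean (allSubsets b) (f ∘ inj₂)
  Σ-mean : ∀ m (h : _ → ℚ) → Σ (allSubsets m) h ≡ ι (2 ℕ.^ m) * mean (allSubsets m) h
  Σ-mean m h = begin
    s                                              ≡⟨ ℚ.*-identityʳ s ⟨
    s * 1ℚ                                         ≡⟨ cong (s *_) (ι*recip′ (2 ℕ.^ m) (0<2^ m)) ⟨
    s * (ι (2 ℕ.^ m) * recip (2 ℕ.^ m))            ≡⟨ solve 3 (λ s x y → s :* (x :* y) := x :* (s :* y)) refl s (ι (2 ℕ.^ m)) (recip (2 ℕ.^ m)) ⟩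
    ι (2 ℕ.^ m) * (s * recip (2 ℕ.^ m))            ≡⟨ cong (λ l → ι (2 ℕ.^ m) * (s * recip l)) (length-allSubsets m) ⟨
    ι (2 ℕ.^ m) * (s * recip (length (allSubsets m))) ≡⟨ cong (ι (2 ℕ.^ m) *_) (mean-Σ (allSubsets m) h) ⟨
    ι (2 ℕ.^ m) * mean (allSubsets m) h            ∎
    where s = Σ (allSubsets m) h

-- From b ≤ a + 1 it follows that 2^a + 2^b ≤ 3 · 2^a.
⅓≤weight : ∀ a b → b ℕ.≤ suc a → ⅓ ≤ weight a b
⅓≤weight a b b≤1+a = begin
  ⅓                                        ≡⟨ solve 1 (λ t → con ⅓ := con ⅓ :* con 1ℚ) refl 0ℚ ⟩
  ⅓ * 1ℚ                                   ≡⟨ cong (⅓ *_) (ι*recip′ t (ℕ.<-≤-trans (0<2^ a) (ℕ.m≤m+n (2 ℕ.^ a) (2 ℕ.^ b)))) ⟨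
  ⅓ * (ι t * recip t)                      ≤⟨ *-mono-≤ˡ ⅓ (ℚ.nonNegative⁻¹ ⅓) (*-mono-≤ʳ (recip t) (0≤recip t) (ι-mono t≤3A)) ⟩
  ⅓ * (ι (M ℕ.+ (M ℕ.+ M)) * recip t)      ≡⟨ cong (λ u → ⅓ * (u * recip t)) (trans (ι-+ M (M ℕ.+ M)) (cong (_+_ (ι M)) (ι-+ M M))) ⟩
  ⅓ * ((ι M + (ι M + ι M)) * recip t)      ≡⟨ solve 2 (λ x r → con ⅓ :* ((x :+ (x :+ x)) :* r) := x :* r) refl (ι M) (recip t) ⟩
  weight a b                               ∎
  where
  open ℚ.≤-Reasoning
  M = 2 ℕ.^ a
  t = 2 ℕ.^ a ℕ.+ 2 ℕ.^ b
  t≤3A : t ℕ.≤ M ℕ.+ (M ℕ.+ M)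
  t≤3A = ℕ.+-monoʳ-≤ M (ℕ.≤-trans (ℕ.^-monoʳ-≤ 2 b≤1+a) (ℕ.≤-reflexive (cong (M ℕ.+_) (ℕ.+-identityʳ M))))

∣-∣≤1 : ∀ a b → ∣ a - b ∣ ℕ.≤ 1 → a ℕ.≤ suc b × b ℕ.≤ suc a
∣-∣≤1 a b ∣a-b∣≤1 =
  ℕ.≤-trans (ℕ.m≤n+∣m-n∣ a b) (ℕ.≤-trans (ℕ.+-monoʳ-≤ b ∣a-b∣≤1) (ℕ.≤-reflexive (ℕ.+-comm b 1))) ,
  ℕ.≤-trans (ℕ.m≤n+∣n-m∣ b a) (ℕ.≤-trans (ℕ.+-monoʳ-≤ a ∣a-b∣≤1) (ℕ.≤-reflexive (ℕ.+-comm a 1)))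

module Measure {n} (G : BlackBoxGroup n) (a b : ℕ) (S : Vec (Fin n) (a ℕ.+ b)) (z : Fin n) where
  open GroupFacts G
  open Equidistribution G
  open PollardRho G a b S z

  mass : Fin n → Bool → ℚ
  mass g σ = mean (all𝒞 a b) (λ c → ⟦ π c ≟ g ⟧ * ⟦ side c Bool.≟ σ ⟧)

  -- z p⁻¹ = g exactly when p = g⁻¹ z. The target only permutes the points at which the frequencies
  -- of B are taken.
  frequency-inj₂ : ∀ g → mean (allSubsets b) (λ y → ⟦ π (inj₂ y) ≟ g ⟧) ≡ frequency (drop a S) (g ⁻¹ ∙ z)
  frequency-inj₂ g = mean-cong (allSubsets b) λ y → let p = product (subsequence (drop a S) y) in
    ⟦⟧-cong (π (inj₂ y) ≟ g) (p ≟ g ⁻¹ ∙ z)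
      (λ eq → begin
        p                   ≡⟨ ⁻¹-involutive p ⟨
        p ⁻¹ ⁻¹             ≡⟨ cancel-right⁻¹ z _ ⟨
        p ⁻¹ ⁻¹ ∙ z ⁻¹ ∙ z  ≡⟨ cong (_∙ z) (⁻¹-anti-homo-∙ z (p ⁻¹)) ⟨
        (z ∙ p ⁻¹) ⁻¹ ∙ z   ≡⟨ cong (λ u → (z ∙ u) ⁻¹ ∙ z) (product-μ (subsequence (drop a S) y)) ⟨
        π (inj₂ y) ⁻¹ ∙ z   ≡⟨ cong (λ u → u ⁻¹ ∙ z) eq ⟩
        g ⁻¹ ∙ z            ∎)
      (λ eq → begin
        π (inj₂ y)          ≡⟨ cong (z ∙_) (product-μ (subsequence (drop a S) y)) ⟩
        z ∙ p ⁻¹            ≡⟨ cong (λ u → z ∙ u ⁻¹) eq ⟩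
        z ∙ (g ⁻¹ ∙ z) ⁻¹   ≡⟨ cong (z ∙_) (trans (⁻¹-anti-homo-∙ (g ⁻¹) z) (cong (z ⁻¹ ∙_) (⁻¹-involutive g))) ⟩
        z ∙ (z ⁻¹ ∙ g)      ≡⟨ cancel-left z g ⟩
        g                   ∎)
    where open ≡-Reasoning

  module _ (∣a-b∣≤1 : ∣ a - b ∣ ℕ.≤ 1) (balanced : Balanced (take a S) × Balanced (drop a S)) where
    private
      a≤1+b = proj₁ (∣-∣≤1 a b ∣a-b∣≤1)
      b≤1+a = proj₂ (∣-∣≤1 a b ∣a-b∣≤1)

      *1 : ∀ x → x * 1ℚ ≡ x
      *1 = ℚ.*-identityʳ

      third : ∀ w m → 0ℚ ≤ w → ⅓ ≤ w → ½ ≤ ι n * m → ⅙ ≤ ι n * (w * m)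
      third w m 0≤w ⅓≤w ½≤nm = begin
        ⅓ * ½            ≤⟨ *-mono-≤ˡ ⅓ (ℚ.nonNegative⁻¹ ⅓) ½≤nm ⟩
        ⅓ * (ι n * m)    ≤⟨ *-mono-≤ʳ (ι n * m) (ℚ.≤-trans (ℚ.nonNegative⁻¹ ½) ½≤nm) ⅓≤w ⟩
        w * (ι n * m)    ≡⟨ solve 3 (λ w n m → w :* (n :* m) := n :* (w :* m)) refl w (ι n) m ⟩
        ι n * (w * m)    ∎
        where open ℚ.≤-Reasoning

    -- The weight of the chosen half is at least ⅓, and within it g has at least half of the uniform
    -- frequency.
    mass-lower : ∀ g σ → ⅙ ≤ ι n * mass g σ
    mass-lower g true = subst (λ u → ⅙ ≤ ι n * u) (sym eq)
      (third (weight a b) (frequency (take a S) g) (0≤weight a b) (⅓≤weight a b b≤1+a) (proj₁ (proj₁ balanced g)))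
      where
      eq : mass g true ≡ weight a b * frequency (take a S) g
      eq = trans (mean-all𝒞 a b (λ c → ⟦ π c ≟ g ⟧ * ⟦ side c Bool.≟ true ⟧))
        (trans (cong₂ (λ u v → weight a b * u + weight b a * v)
            (mean-cong (allSubsets a) (λ x → *1 ⟦ π (inj₁ x) ≟ g ⟧))
            (trans (mean-cong (allSubsets b) (λ y → ℚ.*-zeroʳ ⟦ π (inj₂ y) ≟ g ⟧)) (mean-const (allSubsets-nonEmpty b) 0ℚ)))
          (solve 3 (λ w v f → w :* f :+ v :* con 0ℚ := w :* f) refl (weight a b) (weight b a) (frequency (take a S) g)))
    mass-lower g false = subst (λ u → ⅙ ≤ ι n * u) (sym eq)
      (third (weight b a) (frequency (drop a S) (g ⁻¹ ∙ z)) (0≤weight b a) (⅓≤weight b a a≤1+b) (proj₁ (proj₂ balanced (g ⁻¹ ∙ z))))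
      where
      eq : mass g false ≡ weight b a * frequency (drop a S) (g ⁻¹ ∙ z)
      eq = trans (mean-all𝒞 a b (λ c → ⟦ π c ≟ g ⟧ * ⟦ side c Bool.≟ false ⟧))
        (trans (cong₂ (λ u v → weight a b * u + weight b a * v)
            (trans (mean-cong (allSubsets a) (λ y → ℚ.*-zeroʳ ⟦ π (inj₁ y) ≟ g ⟧)) (mean-const (allSubsets-nonEmpty a) 0ℚ))
            (trans (mean-cong (allSubsets b) (λ y → *1 ⟦ π (inj₂ y) ≟ g ⟧)) (frequency-inj₂ g)))
          (solve 3 (λ w v f → w :* con 0ℚ :+ v :* f := v :* f) refl (weight a b) (weight b a) (frequency (drop a S) (g ⁻¹ ∙ z))))

    mass-upper : ∀ g → ι n * mean (all𝒞 a b) (λ c → ⟦ π c ≟ g ⟧) ≤ 1ℚ + ½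
    mass-upper g = begin
      ι n * mean (all𝒞 a b) (λ c → ⟦ π c ≟ g ⟧)
        ≡⟨ cong (ι n *_) (trans (mean-all𝒞 a b (λ c → ⟦ π c ≟ g ⟧)) (cong (λ u → weight a b * fA + weight b a * u) (frequency-inj₂ g))) ⟩
      ι n * (weight a b * fA + weight b a * fB)
        ≡⟨ solve 5 (λ n v w x y → n :* (v :* x :+ w :* y) := v :* (n :* x) :+ w :* (n :* y)) refl (ι n) (weight a b) (weight b a) fA fB ⟩
      weight a b * (ι n * fA) + weight b a * (ι n * fB)
        ≤⟨ ℚ.+-mono-≤ (*-mono-≤ˡ (weight a b) (0≤weight a b) (proj₂ (proj₁ balanced g))) (*-mono-≤ˡ (weight b a) (0≤weight b a) (proj₂ (proj₂ balanced (g ⁻¹ ∙ z)))) ⟩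
      weight a b * (1ℚ + ½) + weight b a * (1ℚ + ½)
        ≡⟨ ℚ.*-distribʳ-+ (1ℚ + ½) (weight a b) (weight b a) ⟨
      (weight a b + weight b a) * (1ℚ + ½)
        ≡⟨ cong (_* (1ℚ + ½)) (weights a b) ⟩
      1ℚ * (1ℚ + ½)
        ≡⟨⟩
      1ℚ + ½ ∎
      where
      open ℚ.≤-Reasoning
      fA = frequency (take a S) g
      fB = frequency (drop a S) (g ⁻¹ ∙ z)

-- The random walk

-- The principle of deferred decisions: overwriting one coordinate of a uniform vector by an
-- independent uniform value leaves the distribution unchanged.
mean-resample : ∀ {xs : List A} → NonEmpty xs → ∀ {m} (i : Fin m) (f : Vec A m → ℚ) →
  mean (allVecs xs m) f ≡ mean xs (λ x → mean (allVecs xs m) (λ v → f (v [ i ]≔ x)))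
mean-resample {xs = xs} ne {suc m} Fin.zero f = begin
  mean (allVecs xs (suc m)) f                              ≡⟨ mean-cartesianProductWith _∷_ xs vs f ⟩
  mean xs (λ x → mean vs (λ v → f (x ∷ v)))                ≡⟨ mean-cong xs (λ x → mean-const ne (mean vs (λ v → f (x ∷ v)))) ⟨
  mean xs (λ x → mean xs (λ y → mean vs (λ v → f (x ∷ v)))) ≡⟨ mean-cong xs (λ x → mean-cartesianProductWith _∷_ xs vs (λ v → f (v [ Fin.zero ]≔ x))) ⟨
  mean xs (λ x → mean (allVecs xs (suc m)) (λ v → f (v [ Fin.zero ]≔ x))) ∎
  where
  open ≡-Reasoning
  vs = allVecs xs m
mean-resample {xs = xs} ne {suc m} (Fin.suc i) f = begin
  mean (allVecs xs (suc m)) f                              ≡⟨ mean-cartesianProductWith _∷_ xs vs f ⟩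
  mean xs (λ y → mean vs (λ v → f (y ∷ v)))                ≡⟨ mean-cong xs (λ y → mean-resample ne i (λ v → f (y ∷ v))) ⟩
  mean xs (λ y → mean xs (λ x → mean vs (λ v → f (y ∷ v [ i ]≔ x)))) ≡⟨ mean-swap xs xs (λ y x → mean vs (λ v → f (y ∷ v [ i ]≔ x))) ⟩
  mean xs (λ x → mean xs (λ y → mean vs (λ v → f (y ∷ v [ i ]≔ x)))) ≡⟨ mean-cong xs (λ x → mean-cartesianProductWith _∷_ xs vs (λ v → f (v [ Fin.suc i ]≔ x))) ⟨
  mean xs (λ x → mean (allVecs xs (suc m)) (λ v → f (v [ Fin.suc i ]≔ x))) ∎
  where
  open ≡-Reasoning
  vs = allVecs xs m

⟦⟧-× : ∀ {P Q : Set} (p : Dec P) (q : Dec Q) → ⟦ p ⟧ * ⟦ q ⟧ ≡ ⟦ p ×-dec q ⟧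
⟦⟧-× (yes _) (yes _) = refl
⟦⟧-× (yes _) (no _)  = refl
⟦⟧-× (no _)  (yes _) = refl
⟦⟧-× (no _)  (no _)  = refl

-- At most one of pairwise exclusive events occurs. It lets the numbers of hits, whose means are
-- linear in the history, stand in for the events themselves.
Σ-⟦⟧≤⟦any⟧ : ∀ {P : A → Set} (P? : ∀ x → Dec (P x)) {xs} → AllPairs (λ x y → ¬ (P x × P y)) xs →
  Σ xs (λ x → ⟦ P? x ⟧) ≤ ⟦ any? P? xs ⟧
Σ-⟦⟧≤⟦any⟧ P? [] = ℚ.≤-refl
Σ-⟦⟧≤⟦any⟧ {A = A} {P = P} P? {x ∷ xs} (exclusive ∷ rest) with P? x
... | yes px = ℚ.≤-reflexive (trans (cong (_+_ 1ℚ) (none xs exclusive)) (ℚ.+-identityʳ 1ℚ))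
  where
  none : ∀ ys → All (λ y → ¬ (P x × P y)) ys → Σ ys (λ y → ⟦ P? y ⟧) ≡ 0ℚ
  none [] [] = refl
  none (y ∷ ys) (e ∷ es) = trans (cong₂ _+_ (⟦⟧-no (P? y) (λ py → e (px , py))) (none ys es)) (ℚ.+-identityʳ 0ℚ)
... | no _ with any? P? xs | Σ-⟦⟧≤⟦any⟧ P? rest
...   | yes _ | bound = subst (_≤ 1ℚ) (sym (ℚ.+-identityˡ (Σ xs (λ y → ⟦ P? y ⟧)))) bound
...   | no  _ | bound = subst (_≤ 0ℚ) (sym (ℚ.+-identityˡ (Σ xs (λ y → ⟦ P? y ⟧)))) bound

AllPairs-map : ∀ {R S : A → A → Set} → (∀ {x y} → R x y → S x y) → ∀ {xs} → AllPairs R xs → AllPairs S xs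
AllPairs-map f []       = []
AllPairs-map f (p ∷ ps) = All.map f p ∷ AllPairs-map f ps

-- The quotient of the lower bound ⅙ for the mass of one side and the upper bound 3/2 for the whole
-- mass at a group element.
1/9 : ℚ
1/9 = + 1 / 9

≤-scale : ∀ {n} → Fin n → ∀ {p q} → ι n * p ≤ ι n * q → p ≤ q
≤-scale {suc n} _ = ℚ.*-cancelˡ-≤-pos (ι (suc n)) ⦃ positive (0<ι n) ⦄

anElement : ∀ {xs : List A} → NonEmpty xs → A
anElement (nonEmpty {x}) = x

ι-suc : ∀ m → ι m + 1ℚ ≡ ι (suc m)
ι-suc m = trans (cong (_+_ (ι m)) (sym ι-1)) (trans (sym (ι-+ m 1)) (cong ι (ℕ.+-comm m 1)))

iterate-suc : ∀ (f : A → A) x t → iterate f x (suc t) ≡ f (iterate f x t)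
iterate-suc f x zero    = refl
iterate-suc f x (suc t) = iterate-suc f (f x) t

module RandomWalk {C : Set} (cs : List C) (ne : NonEmpty cs) {n : ℕ} (π : C → Fin n) (side : C → Bool) where

  Distinct : List C → Set
  Distinct = AllPairs (λ c d → π c ≢ π d)

  Opposite : C → C → Set
  Opposite c d = (π c ≡ π d) × (side c ≡ not (side d))

  opposite? : ∀ c d → Dec (Opposite c d)
  opposite? c d = (π c ≟ π d) ×-dec (side c Bool.≟ not (side d))

  collides? : ∀ c H → Dec (Any (λ d → π c ≡ π d) H)
  collides? c = any? (λ d → π c ≟ π d)

  opposes? : ∀ c H → Dec (Any (Opposite c) H)
  opposes? c = any? (opposite? c)

  -- One recursion for the length of the walk and for its success: `step` is earned at every
  -- position with a new product, `end` at the first repeated product.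
  module Reward (step : ℚ) (end : List C → C → ℚ) where

    -- Never reads η at a point of π(H): with H the positions already visited,
    -- those are the entries of the oracle that have been exposed.
    value : ℕ → List C → Vec C n → C → ℚ
    value zero    H η c = 0ℚ
    value (suc f) H η c = if ⌊ collides? c H ⌋ then end H c else step + value f (c ∷ H) η (lookup η (π c))

    value-collision : ∀ f {H} η {c} → Any (λ d → π c ≡ π d) H → value (suc f) H η c ≡ end H c
    value-collision f {H} η {c} collides with collides? c H
    ... | yes _ = refl
    ... | no ¬collides = contradiction collides ¬collides

    value-step : ∀ f {H} η {c} → ¬ Any (λ d → π c ≡ π d) H →
      value (suc f) H η c ≡ step + value f (c ∷ H) η (lookup η (π c))
    value-step f {H} η {c} ¬collides with collides? c H
    ... | yes collides = contradiction collides ¬collides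
    ... | no _ = refl

    value-update : ∀ f H η c {g} x → Any (λ d → g ≡ π d) H → value f H (η [ g ]≔ x) c ≡ value f H η c
    value-update zero    H η c x visited = refl
    value-update (suc f) H η c {g} x visited with collides? c H
    ... | yes _ = refl
    ... | no ¬collides = cong (_+_ step) (trans
      (value-update f (c ∷ H) η _ x (there visited))
      (cong (value f (c ∷ H) η) (Vec.lookup∘update′ (λ πc≡g → ¬collides (subst (λ h → Any (λ d → h ≡ π d) H) (sym πc≡g) visited)) η x)))

    average : ℕ → List C → ℚ
    average f H = mean cs (λ c → mean (allVecs cs n) (λ η → value f H η c))

    -- If c does not collide, the entry of η at π c has not been exposed. By `mean-resample` it may
    -- be drawn afresh, and by `value-update` the rest of the walk does not see the overwriting, so
    -- the walk restarts from a uniform position with c added to the history.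
    average-suc : ∀ f H → average (suc f) H ≡ mean cs (λ c → if ⌊ collides? c H ⌋ then end H c else step + average f (c ∷ H))
    average-suc f H = mean-cong cs unfold
      where
      open ≡-Reasoning
      ηs = allVecs cs n
      unfold : ∀ c → mean ηs (λ η → value (suc f) H η c) ≡ (if ⌊ collides? c H ⌋ then end H c else step + average f (c ∷ H))
      unfold c with collides? c H
      ... | yes _ = mean-const (allVecs-nonEmpty ne n) (end H c)
      ... | no  _ = begin
        mean ηs (λ η → step + value f (c ∷ H) η (lookup η (π c)))
          ≡⟨ mean-+ ηs (λ _ → step) (λ η → value f (c ∷ H) η (lookup η (π c))) ⟩
        mean ηs (λ _ → step) + mean ηs (λ η → value f (c ∷ H) η (lookup η (π c)))
          ≡⟨ cong₂ _+_ (mean-const (allVecs-nonEmpty ne n) step) (mean-resample ne (π c) (λ η → value f (c ∷ H) η (lookup η (π c)))) ⟩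
        step + mean cs (λ x → mean ηs (λ η → value f (c ∷ H) (η [ π c ]≔ x) (lookup (η [ π c ]≔ x) (π c))))
          ≡⟨ cong (_+_ step) (mean-cong cs (λ x → mean-cong ηs (λ η → trans
               (value-update f (c ∷ H) η _ x (here refl))
               (cong (value f (c ∷ H) η) (Vec.lookup∘update (π c) η x))))) ⟩
        step + average f (c ∷ H) ∎

  -- The final 1 counts the colliding position itself, so the duration is one more than its index.
  module Duration = Reward 1ℚ (λ H c → 1ℚ)
  module Success  = Reward 0ℚ (λ H c → ⟦ opposes? c H ⟧)

  Distinct-∷ : ∀ {c H} → ¬ Any (λ d → π c ≡ π d) H → Distinct H → Distinct (c ∷ H)
  Distinct-∷ ¬collides distinct = ¬Any⇒All¬ _ ¬collides ∷ distinct

  Distinct-exclusive : ∀ c {H} → Distinct H → AllPairs (λ d e → ¬ (π c ≡ π d × π c ≡ π e)) H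
  Distinct-exclusive c = AllPairs-map (λ d≢e (c≡d , c≡e) → d≢e (trans (sym c≡d) c≡e))

  -- By the pigeonhole principle the fuel n + 1 always reaches the first collision.
  Distinct-length : ∀ {H} → Distinct H → length H ℕ.≤ n
  Distinct-length {H} distinct = injective⇒≤ {f = λ i → π (List.lookup H i)} (λ {i} {j} → injective distinct i j)
    where
    injective : ∀ {H} → Distinct H → ∀ i j → π (List.lookup H i) ≡ π (List.lookup H j) → i ≡ j
    injective (_ ∷ _)        Fin.zero    Fin.zero    eq = refl
    injective (apart ∷ _)    Fin.zero    (Fin.suc j) eq = contradiction eq (All.lookup apart (∈-lookup j))
    injective (apart ∷ _)    (Fin.suc i) Fin.zero    eq = contradiction (sym eq) (All.lookup apart (∈-lookup i))
    injective (_ ∷ distinct) (Fin.suc i) (Fin.suc j) eq = cong Fin.suc (injective distinct i j eq)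

  hits : List C → C → ℚ
  hits H c = Σ H (λ d → ⟦ π c ≟ π d ⟧)

  oppositeHits : List C → C → ℚ
  oppositeHits H c = Σ H (λ d → ⟦ π c ≟ π d ⟧ * ⟦ side c Bool.≟ not (side d) ⟧)

  hits≤ : ∀ {H} c → Distinct H → hits H c ≤ ⟦ collides? c H ⟧
  hits≤ c distinct = Σ-⟦⟧≤⟦any⟧ (λ d → π c ≟ π d) (Distinct-exclusive c distinct)

  oppositeHits≤ : ∀ {H} c → Distinct H → oppositeHits H c ≤ ⟦ opposes? c H ⟧
  oppositeHits≤ {H} c distinct = subst (_≤ ⟦ opposes? c H ⟧)
    (sym (Σ-cong H (λ d → ⟦⟧-× (π c ≟ π d) (side c Bool.≟ not (side d)))))
    (Σ-⟦⟧≤⟦any⟧ (opposite? c) (AllPairs-map (λ excl (d , e) → excl (proj₁ d , proj₁ e)) (Distinct-exclusive c distinct)))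

  1≤hits : ∀ {H c} → Any (λ d → π c ≡ π d) H → 1ℚ ≤ hits H c
  1≤hits {c = c} collides with find collides
  ... | d , d∈H , c≡d = subst (_≤ _) (⟦⟧-yes (π c ≟ π d) c≡d) (member≤Σ (λ d → 0≤⟦⟧ (π c ≟ π d)) d∈H)

  0≤hits : ∀ H c → 0ℚ ≤ hits H c
  0≤hits H c = 0≤Σ H (λ d → 0≤⟦⟧ (π c ≟ π d))

  module Orbit (η : Vec C n) (w : C) where

    orbit : ℕ → C
    orbit = iterate (λ c → lookup η (π c)) w

    orbit-suc : ∀ t → orbit (suc t) ≡ lookup η (π (orbit t))
    orbit-suc = iterate-suc (λ c → lookup η (π c)) w

    history : ℕ → List C
    history zero    = []
    history (suc m) = orbit m ∷ history m

    length-history : ∀ m → length (history m) ≡ m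
    length-history zero    = refl
    length-history (suc m) = cong suc (length-history m)

    history-any : ∀ {P : C → Set} {m} → Any P (history m) → ∃[ l ] (l ℕ.< m × P (orbit l))
    history-any {m = suc m} (here p)  = m , ℕ.≤-refl , p
    history-any {m = suc m} (there a) with history-any a
    ... | l , l<m , p = l , ℕ.m≤n⇒m≤1+n l<m , p

    history-all : ∀ {P : C → Set} {m} → All P (history m) → ∀ {l} → l ℕ.< m → P (orbit l)
    history-all {m = suc m} (p ∷ ps) {l} l<1+m with l ℕ.≟ m
    ... | yes refl = p
    ... | no  l≢m  = history-all ps (ℕ.≤∧≢⇒< (ℕ.≤-pred l<1+m) l≢m)

    history-apart : ∀ {m} → Distinct (history m) → ∀ {i j} → i ℕ.< j → j ℕ.< m → π (orbit i) ≢ π (orbit j)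
    history-apart {suc m} (apart ∷ distinct) {i} {j} i<j j<1+m with j ℕ.≟ m
    ... | yes refl = λ eq → history-all apart i<j (sym eq)
    ... | no  j≢m  = history-apart distinct i<j (ℕ.≤∧≢⇒< (ℕ.≤-pred j<1+m) j≢m)

    record FirstCollision : Set where
      field
        earlier later : ℕ
        earlier<later : earlier ℕ.< later
        meets         : π (orbit later) ≡ π (orbit earlier)
        distinct      : Distinct (history later)

      apart : ∀ {i j} → i ℕ.< j → j ℕ.< later → π (orbit i) ≢ π (orbit j)
      apart = history-apart distinct

      later≤n : later ℕ.≤ n
      later≤n = subst (ℕ._≤ n) (length-history later) (Distinct-length distinct)

    open FirstCollision

    -- Ties the recursive values to the actual orbit of one draw after m positions have been
    -- visited. The value of `Success` is 0 or 1, and 1 is reported only with opposite sides.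
    record Outcome (f m : ℕ) : Set where
      field
        first    : FirstCollision
        duration : ι m + Duration.value f (history m) η (orbit m) ≡ ι (suc (later first))
        success  : (Success.value f (history m) η (orbit m) ≡ 0ℚ) ⊎
                   (Success.value f (history m) η (orbit m) ≡ 1ℚ ×
                    side (orbit (later first)) ≡ not (side (orbit (earlier first))))

    outcome : ∀ f m → f ℕ.+ m ≡ suc n → Distinct (history m) → Outcome f m
    outcome zero m refl distinct = contradiction (Distinct-length distinct) (ℕ.<⇒≱ (ℕ.≤-reflexive (sym (length-history m))))
    outcome (suc f) m eq distinct with collides? (orbit m) (history m)
    ... | no ¬collides = record
      { first    = first
      ; duration = begin
          ι m + Duration.value (suc f) (history m) η (orbit m)
            ≡⟨ cong (_+_ (ι m)) (Duration.value-step f η ¬collides) ⟩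
          ι m + (1ℚ + Duration.value f (orbit m ∷ history m) η (lookup η (π (orbit m))))
            ≡⟨ ℚ.+-assoc (ι m) 1ℚ (Duration.value f (orbit m ∷ history m) η (lookup η (π (orbit m)))) ⟨
          ι m + 1ℚ + Duration.value f (orbit m ∷ history m) η (lookup η (π (orbit m)))
            ≡⟨ cong₂ (λ u c → u + Duration.value f (history (suc m)) η c) (ι-suc m) (sym (orbit-suc m)) ⟩
          ι (suc m) + Duration.value f (history (suc m)) η (orbit (suc m))
            ≡⟨ duration ⟩
          ι (suc (later first)) ∎
      ; success  = subst (λ v → (v ≡ 0ℚ) ⊎ (v ≡ 1ℚ × side (orbit (later first)) ≡ not (side (orbit (earlier first)))))
                     (trans (cong (Success.value f (history (suc m)) η) (orbit-suc m)) (trans (sym (ℚ.+-identityˡ (Success.value f (orbit m ∷ history m) η (lookup η (π (orbit m)))))) (sym (Success.value-step f η ¬collides)))) success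
      }
      where
      open ≡-Reasoning
      open Outcome (outcome f (suc m) (trans (ℕ.+-suc f m) eq) (Distinct-∷ ¬collides distinct))
    ... | yes collides with opposes? (orbit m) (history m)
    ...   | yes opposes with history-any opposes
    ...     | l , l<m , meet , opp = record
      { first    = record { earlier = l ; later = m ; earlier<later = l<m ; meets = meet ; distinct = distinct }
      ; duration = trans (cong (_+_ (ι m)) (Duration.value-collision f η collides)) (ι-suc m)
      ; success  = inj₂ (trans (Success.value-collision f η collides) (⟦⟧-yes (opposes? (orbit m) (history m)) opposes) , opp)
      }
    outcome (suc f) m eq distinct | yes collides | no ¬opposes with history-any collides
    ... | l , l<m , meet = record
      { first    = record { earlier = l ; later = m ; earlier<later = l<m ; meets = meet ; distinct = distinct }
      ; duration = trans (cong (_+_ (ι m)) (Duration.value-collision f η collides)) (ι-suc m)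
      ; success  = inj₁ (trans (Success.value-collision f η collides) (⟦⟧-no (opposes? (orbit m) (history m)) ¬opposes))
      }

  module _ (mass-lower : ∀ g σ → ⅙ ≤ ι n * mean cs (λ c → ⟦ π c ≟ g ⟧ * ⟦ side c Bool.≟ σ ⟧))
           (mass-upper : ∀ g → ι n * mean cs (λ c → ⟦ π c ≟ g ⟧) ≤ 1ℚ + ½) where

    -- For every visited d, a fixed share of the elements with the product π d lies on the side
    -- opposite to d.
    mean-hits≤ : ∀ H → 1/9 * mean cs (hits H) ≤ mean cs (oppositeHits H)
    mean-hits≤ H = begin
      1/9 * mean cs (hits H)
        ≡⟨ cong (1/9 *_) (mean-Σ-swap cs H (λ c d → ⟦ π c ≟ π d ⟧)) ⟩
      1/9 * Σ H (λ d → mean cs (λ c → ⟦ π c ≟ π d ⟧))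
        ≡⟨ Σ-* H 1/9 (λ d → mean cs (λ c → ⟦ π c ≟ π d ⟧)) ⟨
      Σ H (λ d → 1/9 * mean cs (λ c → ⟦ π c ≟ π d ⟧))
        ≤⟨ Σ-mono H termwise ⟩
      Σ H (λ d → mean cs (λ c → ⟦ π c ≟ π d ⟧ * ⟦ side c Bool.≟ not (side d) ⟧))
        ≡⟨ mean-Σ-swap cs H (λ c d → ⟦ π c ≟ π d ⟧ * ⟦ side c Bool.≟ not (side d) ⟧) ⟨
      mean cs (oppositeHits H) ∎
      where
      open ℚ.≤-Reasoning
      termwise : ∀ d → 1/9 * mean cs (λ c → ⟦ π c ≟ π d ⟧) ≤ mean cs (λ c → ⟦ π c ≟ π d ⟧ * ⟦ side c Bool.≟ not (side d) ⟧)
      termwise d = ≤-scale (π d) (begin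
        ι n * (1/9 * m)    ≡⟨ solve 2 (λ n m → n :* (con 1/9 :* m) := con 1/9 :* (n :* m)) refl (ι n) m ⟩
        1/9 * (ι n * m)    ≤⟨ *-mono-≤ˡ 1/9 (ℚ.nonNegative⁻¹ 1/9) (mass-upper (π d)) ⟩
        1/9 * (1ℚ + ½)     ≡⟨⟩
        ⅙                  ≤⟨ mass-lower (π d) (not (side d)) ⟩
        ι n * mean cs (λ c → ⟦ π c ≟ π d ⟧ * ⟦ side c Bool.≟ not (side d) ⟧) ∎)
        where m = mean cs (λ c → ⟦ π c ≟ π d ⟧)

    -- A submartingale argument. The quantity 1/9 + oppositeHits - hits/9 has mean at least 1/9 and
    -- is pointwise at most the reward: at a collision hits ≥ 1 cancels the constant, and otherwise
    -- oppositeHits vanishes and the induction hypothesis applies.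
    success-average : ∀ f H → f ℕ.+ length H ≡ suc n → Distinct H → 1/9 ≤ Success.average f H
    success-average zero H eq distinct = contradiction (Distinct-length distinct) (ℕ.<⇒≱ (ℕ.≤-reflexive (sym eq)))
    success-average (suc f) H eq distinct = begin
      1/9
        ≤⟨ ≤-excess (mean cs (oppositeHits H) - 1/9 * mean cs (hits H)) (0≤difference (mean-hits≤ H)) refl ⟩
      1/9 + (mean cs (oppositeHits H) - 1/9 * mean cs (hits H))
        ≡⟨ cong₂ (λ u v → u + (mean cs (oppositeHits H) + v)) (sym (mean-const ne 1/9)) (trans (ℚ.neg-distribˡ-* 1/9 (mean cs (hits H))) (sym (mean-* cs (- 1/9) (hits H)))) ⟩
      mean cs (λ _ → 1/9) + (mean cs (oppositeHits H) + mean cs (λ c → - 1/9 * hits H c))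
        ≡⟨ trans (mean-+ cs (λ _ → 1/9) (λ c → oppositeHits H c + - 1/9 * hits H c)) (cong (_+_ (mean cs (λ _ → 1/9))) (mean-+ cs (oppositeHits H) (λ c → - 1/9 * hits H c))) ⟨
      mean cs (λ c → 1/9 + (oppositeHits H c + - 1/9 * hits H c))
        ≤⟨ mean-mono cs pointwise ⟩
      mean cs (λ c → if ⌊ collides? c H ⌋ then ⟦ opposes? c H ⟧ else 0ℚ + Success.average f (c ∷ H))
        ≡⟨ Success.average-suc f H ⟨
      Success.average (suc f) H ∎
      where
      open ℚ.≤-Reasoning
      pointwise : ∀ c → 1/9 + (oppositeHits H c + - 1/9 * hits H c) ≤
        (if ⌊ collides? c H ⌋ then ⟦ opposes? c H ⟧ else 0ℚ + Success.average f (c ∷ H))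
      pointwise c with collides? c H
      ... | yes collides = ℚ.≤-trans
        (≤-excess (1/9 * (hits H c - 1ℚ)) (0≤* (ℚ.nonNegative⁻¹ 1/9) (0≤difference (1≤hits collides)))
          (solve 2 (λ o h → o := con 1/9 :+ (o :+ con (- 1/9) :* h) :+ con 1/9 :* (h :- con 1ℚ)) refl (oppositeHits H c) (hits H c)))
        (oppositeHits≤ c distinct)
      ... | no ¬collides = begin
        1/9 + (oppositeHits H c + - 1/9 * hits H c)
          ≤⟨ ℚ.+-monoʳ-≤ 1/9 (ℚ.+-mono-≤
               (subst (oppositeHits H c ≤_) (⟦⟧-no (opposes? c H) (¬collides ∘ Any.map proj₁)) (oppositeHits≤ c distinct))
               (subst (_≤ 0ℚ) (ℚ.neg-distribˡ-* 1/9 (hits H c)) (ℚ.neg-antimono-≤ (0≤* (ℚ.nonNegative⁻¹ 1/9) (0≤hits H c))))) ⟩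
        1/9 + (0ℚ + 0ℚ)
          ≡⟨⟩
        1/9
          ≤⟨ success-average f (c ∷ H) (trans (ℕ.+-suc f (length H)) eq) (Distinct-∷ ¬collides distinct) ⟩
        Success.average f (c ∷ H)
          ≡⟨ ℚ.+-identityˡ (Success.average f (c ∷ H)) ⟨
        0ℚ + Success.average f (c ∷ H) ∎

    mean-hits≥ : ∀ H → ι (length H) * ⅙ ≤ ι n * mean cs (hits H)
    mean-hits≥ H = begin
      ι (length H) * ⅙                                       ≡⟨ Σ-const H ⅙ ⟨
      Σ H (λ _ → ⅙)                                          ≤⟨ Σ-mono H termwise ⟩
      Σ H (λ d → ι n * mean cs (λ c → ⟦ π c ≟ π d ⟧))        ≡⟨ Σ-* H (ι n) (λ d → mean cs (λ c → ⟦ π c ≟ π d ⟧)) ⟩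
      ι n * Σ H (λ d → mean cs (λ c → ⟦ π c ≟ π d ⟧))        ≡⟨ cong (ι n *_) (mean-Σ-swap cs H (λ c d → ⟦ π c ≟ π d ⟧)) ⟨
      ι n * mean cs (hits H)                                 ∎
      where
      open ℚ.≤-Reasoning
      shrink : ∀ {P Q : Set} (p : Dec P) (q : Dec Q) → ⟦ p ⟧ * ⟦ q ⟧ ≤ ⟦ p ⟧
      shrink (yes _) (yes _) = ℚ.≤-refl
      shrink (yes _) (no _)  = ℚ.nonNegative⁻¹ 1ℚ
      shrink (no _)  (yes _) = ℚ.≤-refl
      shrink (no _)  (no _)  = ℚ.≤-refl
      termwise : ∀ d → ⅙ ≤ ι n * mean cs (λ c → ⟦ π c ≟ π d ⟧)
      termwise d = ℚ.≤-trans (mass-lower (π d) true)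
        (*-mono-≤ˡ (ι n) (0≤ι n) (mean-mono cs (λ c → shrink (π c ≟ π d) (side c Bool.≟ true))))

    -- After s ≥ √n distinct positions every further step collides with
    -- probability at least 1/(6s).
    module _ (s : ℕ) (n≤s² : n ℕ.≤ s ℕ.* s) where

      -- A bound for the expected number of further steps after h positions: at most s - h to reach
      -- length s, and then 6s, the mean waiting time for an event of probability 1/(6s).
      potential : ℕ → ℚ
      potential h = ι (6 ℕ.* s ℕ.+ (s ∸ h))

      -- A supermartingale argument: a step costs 1, and a collision, whose indicator is at least
      -- `hits`, saves the potential ψ of the longer history.
      duration-average : ∀ f H → Distinct H → Duration.average f H ≤ potential (length H)
      duration-average zero H distinct = ℚ.≤-trans
        (ℚ.≤-reflexive (trans (mean-cong cs (λ c → mean-const (allVecs-nonEmpty ne n) 0ℚ)) (mean-const ne 0ℚ)))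
        (0≤ι (6 ℕ.* s ℕ.+ (s ∸ length H)))
      duration-average (suc f) H distinct = begin
        Duration.average (suc f) H
          ≡⟨ Duration.average-suc f H ⟩
        mean cs (λ c → if ⌊ collides? c H ⌋ then 1ℚ else 1ℚ + Duration.average f (c ∷ H))
          ≤⟨ mean-mono cs pointwise ⟩
        mean cs (λ c → 1ℚ + ψ + - ψ * hits H c)
          ≡⟨ mean-+ cs (λ _ → 1ℚ + ψ) (λ c → - ψ * hits H c) ⟩
        mean cs (λ c → 1ℚ + ψ) + mean cs (λ c → - ψ * hits H c)
          ≡⟨ cong₂ _+_ (mean-const ne (1ℚ + ψ)) (mean-* cs (- ψ) (hits H)) ⟩
        1ℚ + ψ + - ψ * mean cs (hits H)
          ≤⟨ descent ⟩
        potential (length H) ∎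
        where
        open ℚ.≤-Reasoning
        h = length H
        ψ = potential (suc h)
        0≤ψ : 0ℚ ≤ ψ
        0≤ψ = 0≤ι (6 ℕ.* s ℕ.+ (s ∸ suc h))

        pointwise : ∀ c → (if ⌊ collides? c H ⌋ then 1ℚ else 1ℚ + Duration.average f (c ∷ H)) ≤ 1ℚ + ψ + - ψ * hits H c
        pointwise c with collides? c H | hits≤ c distinct
        ... | yes _ | hits≤1 = ≤-excess (ψ * (1ℚ - hits H c)) (0≤* 0≤ψ (0≤difference hits≤1))
          (solve 2 (λ p x → con 1ℚ :+ p :+ (:- p) :* x := con 1ℚ :+ p :* (con 1ℚ :- x)) refl ψ (hits H c))
        ... | no ¬collides | hits≤0 = ℚ.≤-trans
          (ℚ.+-monoʳ-≤ 1ℚ (duration-average f (c ∷ H) (Distinct-∷ ¬collides distinct)))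
          (≤-excess (ψ * (0ℚ - hits H c)) (0≤* 0≤ψ (0≤difference hits≤0))
            (solve 2 (λ p x → con 1ℚ :+ p :+ (:- p) :* x := con 1ℚ :+ p :+ p :* (con 0ℚ :- x)) refl ψ (hits H c)))

        -- Below length s the drop of the potential pays for the step. From s on the potential is
        -- constant, and the savings pay: ψ is at least 6s, and the mean number of hits is at least
        -- h/(6n) with n ≤ s² ≤ s h.
        descent : 1ℚ + ψ + - ψ * mean cs (hits H) ≤ potential h
        descent with h ℕ.<? s
        ... | yes h<s = ≤-excess (ψ * mean cs (hits H)) (0≤* 0≤ψ (0≤mean cs (0≤hits H)))
          (trans eq (solve 2 (λ p x → con 1ℚ :+ p := con 1ℚ :+ p :+ (:- p) :* x :+ p :* x) refl ψ (mean cs (hits H))))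
          where
          eq : potential h ≡ 1ℚ + ψ
          eq = trans (cong ι (trans (cong (6 ℕ.* s ℕ.+_) (sym (ℕ.suc-pred (s ∸ h) ⦃ ℕ.>-nonZero (ℕ.m<n⇒0<n∸m h<s) ⦄)))
                        (trans (ℕ.+-suc (6 ℕ.* s) _) (cong (λ u → suc (6 ℕ.* s ℕ.+ u)) (ℕ.pred[m∸n]≡m∸[1+n] s h)))))
                 (trans (ι-+ 1 (6 ℕ.* s ℕ.+ (s ∸ suc h))) (cong (_+ ψ) ι-1))
        ... | no h≮s = ≤-excess (ψ * mean cs (hits H) - 1ℚ) (0≤difference 1≤ψm)
          (trans (cong (λ u → ι (6 ℕ.* s ℕ.+ u)) (trans (ℕ.m≤n⇒m∸n≡0 s≤h) (sym (ℕ.m≤n⇒m∸n≡0 (ℕ.m≤n⇒m≤1+n s≤h)))))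
            (solve 2 (λ p x → p := con 1ℚ :+ p :+ (:- p) :* x :+ (p :* x :- con 1ℚ)) refl ψ (mean cs (hits H))))
          where
          s≤h = ℕ.≮⇒≥ h≮s
          1≤ψm : 1ℚ ≤ ψ * mean cs (hits H)
          1≤ψm = ≤-scale (π (anElement ne)) (begin
            ι n * 1ℚ                               ≡⟨ ℚ.*-identityʳ (ι n) ⟩
            ι n                                    ≤⟨ ι-mono (ℕ.≤-trans n≤s² (ℕ.*-monoʳ-≤ s s≤h)) ⟩
            ι (s ℕ.* h)                            ≡⟨ ι-* s h ⟩
            ι s * ι h                              ≡⟨ solve 2 (λ s h → s :* h := con (+ 6 / 1) :* s :* (h :* con ⅙)) refl (ι s) (ι h) ⟩
            (+ 6 / 1) * ι s * (ι h * ⅙)            ≡⟨ cong (λ u → u * ι s * (ι h * ⅙)) (ι-def 6) ⟩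
            ι 6 * ι s * (ι h * ⅙)                  ≡⟨ cong (_* (ι h * ⅙)) (ι-* 6 s) ⟨
            ι (6 ℕ.* s) * (ι h * ⅙)                ≤⟨ *-mono-≤ʳ (ι h * ⅙) (0≤* (0≤ι h) (ℚ.nonNegative⁻¹ ⅙)) (ι-mono (ℕ.m≤m+n (6 ℕ.* s) (s ∸ suc h))) ⟩
            ψ * (ι h * ⅙)                          ≤⟨ *-mono-≤ˡ ψ 0≤ψ (mean-hits≥ H) ⟩
            ψ * (ι n * mean cs (hits H))           ≡⟨ solve 3 (λ p n x → p :* (n :* x) := n :* (p :* x)) refl ψ (ι n) (mean cs (hits H)) ⟩
            ι n * (ψ * mean cs (hits H))           ∎)

-- Floyd’s algorithm

leastWitness : ∀ {P : ℕ → Set} → (∀ i → Dec (P i)) → ∀ {m} → P m → ∃[ i ] (P i × (∀ {i′} → P i′ → i ℕ.≤ i′))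
leastWitness {P} P? {m} Pm = search m 0 (ℕ.+-identityʳ m) (λ _ → z≤n)
  where
  search : ∀ d k → d ℕ.+ k ≡ m → (∀ {i} → P i → k ℕ.≤ i) → ∃[ i ] (P i × (∀ {i′} → P i′ → i ℕ.≤ i′))
  search d k eq below with P? k
  ... | yes Pk = k , Pk , below
  search zero    k refl below | no ¬Pk = contradiction Pm ¬Pk
  search (suc d) k eq below | no ¬Pk =
    search d (suc k) (trans (ℕ.+-suc d k) eq) (λ Pi → ℕ.≤∧≢⇒< (below Pi) (λ { refl → ¬Pk Pi }))

module Cycle {C : Set} (_≟_ : DecidableEquality C) (f : C → C) (w : C) where

  c : ℕ → C
  c = iterate f w

  c-suc : ∀ t → c (suc t) ≡ f (c t)
  c-suc = iterate-suc f w

  shift : ∀ {i j} k → c i ≡ c j → c (k ℕ.+ i) ≡ c (k ℕ.+ j)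
  shift zero    eq = eq
  shift {i} {j} (suc k) eq = trans (c-suc (k ℕ.+ i)) (trans (cong f (shift k eq)) (sym (c-suc (k ℕ.+ j))))

  periodic : ∀ p {x y} → c (p ℕ.+ x) ≡ c x → x ℕ.≤ y → c (p ℕ.+ y) ≡ c y
  periodic p {x} {y} eq x≤y = begin
    c (p ℕ.+ y)              ≡⟨ cong (λ u → c (p ℕ.+ u)) (ℕ.m∸n+n≡m x≤y) ⟨
    c (p ℕ.+ (y ∸ x ℕ.+ x))  ≡⟨ cong c (trans (sym (ℕ.+-assoc p (y ∸ x) x)) (trans (cong (ℕ._+ x) (ℕ.+-comm p (y ∸ x))) (ℕ.+-assoc (y ∸ x) p x))) ⟩
    c (y ∸ x ℕ.+ (p ℕ.+ x))  ≡⟨ shift (y ∸ x) eq ⟩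
    c (y ∸ x ℕ.+ x)          ≡⟨ cong c (ℕ.m∸n+n≡m x≤y) ⟩
    c y                      ∎
    where open ≡-Reasoning

  multiple : ∀ p {x y} → c (p ℕ.+ x) ≡ c x → x ℕ.≤ y → ∀ r → c (r ℕ.* p ℕ.+ y) ≡ c y
  multiple p eq x≤y zero = refl
  multiple p {x} {y} eq x≤y (suc r) = trans
    (cong c (ℕ.+-assoc p (r ℕ.* p) y))
    (trans (periodic p eq (ℕ.≤-trans x≤y (ℕ.m≤n+m y (r ℕ.* p)))) (multiple p eq x≤y r))

  -- The index x i + j has the same position as j and is at least x, so it inherits the cycle length
  -- t from x.
  transfer : ∀ i j t x → 0 ℕ.< i → c (i ℕ.+ j) ≡ c j → c (t ℕ.+ x) ≡ c x → c (t ℕ.+ j) ≡ c j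
  transfer i j t x 0<i cycle₁ cycle₂ = begin
    c (t ℕ.+ j)                      ≡⟨ shift t (multiple i cycle₁ ℕ.≤-refl x) ⟨
    c (t ℕ.+ (x ℕ.* i ℕ.+ j))        ≡⟨ periodic t cycle₂ x≤ ⟩
    c (x ℕ.* i ℕ.+ j)                ≡⟨ multiple i cycle₁ ℕ.≤-refl x ⟩
    c j                              ∎
    where
    open ≡-Reasoning
    x≤ : x ℕ.≤ x ℕ.* i ℕ.+ j
    x≤ = ℕ.≤-trans (ℕ.m≤m*n x i ⦃ ℕ.>-nonZero 0<i ⦄) (ℕ.m≤m+n (x ℕ.* i) j)

  -- By `transfer`, a cycle length found at any index works at j, and an index admitting any cycle
  -- length admits t. So the least tail for t and the least period at j are together the least pair.
  leastCycle : ∀ {t j} → 0 ℕ.< t → c (t ℕ.+ j) ≡ c j → (∀ {j′} → c (t ℕ.+ j′) ≡ c j′ → j ℕ.≤ j′) →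
    ∃[ i ] (0 ℕ.< i × c (i ℕ.+ j) ≡ c j ×
            (∀ i′ j′ → 0 ℕ.< i′ → c (i′ ℕ.+ j′) ≡ c j′ → i ℕ.≤ i′ × j ℕ.≤ j′))
  leastCycle {t} {j} 0<t cycle leastTail with leastWitness (λ i → (0 ℕ.<? i) ×-dec (c (i ℕ.+ j) ≟ c j)) (0<t , cycle)
  ... | i , (0<i , cycleᵢ) , leastPeriod = i , 0<i , cycleᵢ , λ i′ j′ 0<i′ cycle′ →
    leastPeriod (0<i′ , transfer t j i′ j′ 0<t cycle cycle′) , leastTail (transfer i′ j′ t j 0<i′ cycle′ cycle)

  -- Both sides equal the position at i + t + j. Hence Floyd's meeting index t can replace the
  -- unknown least period i in Step 4.
  predecessors : ∀ {i t j} → 0 ℕ.< i → 0 ℕ.< t → c (i ℕ.+ suc j) ≡ c (suc j) → c (t ℕ.+ suc j) ≡ c (suc j) →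
    c (i ℕ.+ j) ≡ c (t ℕ.+ j)
  predecessors {suc i} {suc t} {j} _ _ cycle₁ cycle₂ = begin
    c (suc i ℕ.+ j)                      ≡⟨ cong c (ℕ.+-suc i j) ⟨
    c (i ℕ.+ suc j)                      ≡⟨ periodic (suc t) cycle₂ (ℕ.m≤n+m (suc j) i) ⟨
    c (suc t ℕ.+ (i ℕ.+ suc j))          ≡⟨ cong (λ u → c (suc u)) (trans (sym (ℕ.+-assoc t i (suc j))) (trans (cong (ℕ._+ suc j) (ℕ.+-comm t i)) (ℕ.+-assoc i t (suc j)))) ⟩
    c (suc i ℕ.+ (t ℕ.+ suc j))          ≡⟨ periodic (suc i) cycle₁ (ℕ.m≤n+m (suc j) t) ⟩
    c (t ℕ.+ suc j)                      ≡⟨ cong c (ℕ.+-suc t j) ⟩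
    c (suc t ℕ.+ j)                      ∎
    where open ≡-Reasoning

  -- t is the first multiple of the cycle length m - l beyond l. It exceeds l by at most one such
  -- length, so it does not exceed m.
  meeting : ∀ {l m} → l ℕ.< m → c l ≡ c m → ∃[ t ] (0 ℕ.< t × t ℕ.≤ m × c (t ℕ.+ t) ≡ c t)
  meeting {l} {m} l<m eq = t , 0<t , t≤m , trans (multiple p (trans (cong c (ℕ.m∸n+n≡m (ℕ.<⇒≤ l<m))) (sym eq)) l≤t (suc q)) refl
    where
    p = m ∸ l
    instance
      p≢0 : NonZero p
      p≢0 = ℕ.>-nonZero (ℕ.m<n⇒0<n∸m l<m)
    q = l ℕ./ p
    t = suc q ℕ.* p
    0<t : 0 ℕ.< t
    0<t = ℕ.<-≤-trans (ℕ.m<n⇒0<n∸m l<m) (ℕ.m≤m+n p (q ℕ.* p))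
    t≤m : t ℕ.≤ m
    t≤m = ℕ.≤-trans (ℕ.+-monoʳ-≤ p (m/n*n≤m l p)) (ℕ.≤-reflexive (ℕ.m∸n+n≡m (ℕ.<⇒≤ l<m)))
    l≤t : l ℕ.≤ t
    l≤t = ℕ.≤-trans (ℕ.≤-reflexive (m≡m%n+[m/n]*n l p)) (ℕ.+-monoˡ-≤ (q ℕ.* p) (ℕ.<⇒≤ (m%n<n l p)))

_≟𝒞_ : ∀ {a b} → DecidableEquality (𝒞 a b)
_≟𝒞_ = Sum.≡-dec (Vec.≡-dec Bool._≟_) (Vec.≡-dec Bool._≟_)

-- Tables of products

subsequence-++ : ∀ {a b} (v : Vec A (a ℕ.+ b)) (p : Subset a) (q : Subset b) →
  subsequence v (p ++ q) ≡ subsequence (take a v) p List.++ subsequence (drop a v) q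
subsequence-++ v       []            q = refl
subsequence-++ (x ∷ v) (inside ∷ p)  q = cong (x ∷_) (subsequence-++ v p q)
subsequence-++ (x ∷ v) (outside ∷ p) q = subsequence-++ v p q

subsequence-outside : ∀ {m} (v : Vec A m) → subsequence v (replicate m outside) ≡ []
subsequence-outside []      = refl
subsequence-outside (x ∷ v) = subsequence-outside v

subsequence-map : ∀ (f : A → B) {m} (v : Vec A m) p → subsequence (Vec.map f v) p ≡ map f (subsequence v p)
subsequence-map f []      []            = refl
subsequence-map f (x ∷ v) (inside ∷ p)  = cong (f x ∷_) (subsequence-map f v p)
subsequence-map f (x ∷ v) (outside ∷ p) = subsequence-map f v p

subsequence-lookup : ∀ {m} (v : Vec A m) p → subsequence v p ≡ map (lookup v) (subsequence (Vec.allFin m) p)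
subsequence-lookup v p = trans (cong (λ u → subsequence u p) (sym (Vec.map-lookup-allFin v))) (subsequence-map (lookup v) (Vec.allFin _) p)

length-subsequence : ∀ {m} (v : Vec A m) p → length (subsequence v p) ℕ.≤ m
length-subsequence []      []            = z≤n
length-subsequence (x ∷ v) (inside ∷ p)  = s≤s (length-subsequence v p)
length-subsequence (x ∷ v) (outside ∷ p) = ℕ.m≤n⇒m≤1+n (length-subsequence v p)

∈-allSubsets : ∀ {m} (p : Subset m) → p ∈ allSubsets m
∈-allSubsets []            = here refl
∈-allSubsets (inside ∷ p)  = ∈-cartesianProductWith⁺ _∷_ {xs = inside ∷ outside ∷ []} (here refl) (∈-allSubsets p)
∈-allSubsets (outside ∷ p) = ∈-cartesianProductWith⁺ _∷_ {xs = inside ∷ outside ∷ []} (there (here refl)) (∈-allSubsets p)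

-- Every subset of the k indices is cut into c consecutive pieces, so that its
-- product is obtained from c products over listed subsets.
record Table (k c : ℕ) : Set where
  field
    entries : List (Subset k)
    pieces  : Subset k → Vec (∃[ q ] (q ∈ entries)) c
    factors : ∀ {n} (G : BlackBoxGroup n) (S : Vec (Fin n) k) p → let open Products G in
      product (subsequence S p) ≡ product (Vec.toList (Vec.map (λ q → product (subsequence S (proj₁ q))) (pieces p)))

emptyTable : Table 0 0
emptyTable = record { entries = [] ; pieces = λ _ → [] ; factors = λ { G [] [] → refl } }

-- Pieces are padded with `outside` to subsets of the full index set, so the entries of all chunks
-- form one list.
joinTable : ∀ m {k c} → Table k c → Table (m ℕ.+ k) (suc c)
joinTable m {k} {c} T = record { entries = es ; pieces = cut ; factors = correct }
  where
  padʳ : Subset m → Subset (m ℕ.+ k)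
  padʳ p = p ++ replicate k outside
  padˡ : Subset k → Subset (m ℕ.+ k)
  padˡ q = replicate m outside ++ q
  es = map padʳ (allSubsets m) List.++ map padˡ (Table.entries T)

  widen : (∃[ q ] (q ∈ Table.entries T)) → ∃[ q ] (q ∈ es)
  widen (q , q∈) = padˡ q , ∈-++⁺ʳ (map padʳ (allSubsets m)) (∈-map⁺ padˡ q∈)

  cut : Subset (m ℕ.+ k) → Vec (∃[ q ] (q ∈ es)) (suc c)
  cut p = (padʳ (take m p) , ∈-++⁺ˡ (∈-map⁺ padʳ (∈-allSubsets (take m p)))) ∷ Vec.map widen (Table.pieces T (drop m p))

  correct : ∀ {n} (G : BlackBoxGroup n) (S : Vec (Fin n) (m ℕ.+ k)) p → let open Products G in
    product (subsequence S p) ≡ product (Vec.toList (Vec.map (λ q → product (subsequence S (proj₁ q))) (cut p)))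
  correct G S p = begin
    product (subsequence S p)
      ≡⟨ cong (λ u → product (subsequence S u)) (Vec.take++drop≡id m p) ⟨
    product (subsequence S (take m p ++ drop m p))
      ≡⟨ cong product (subsequence-++ S (take m p) (drop m p)) ⟩
    product (subsequence (take m S) (take m p) List.++ subsequence (drop m S) (drop m p))
      ≡⟨ product-++ (subsequence (take m S) (take m p)) _ ⟩
    product (subsequence (take m S) (take m p)) ∙ product (subsequence (drop m S) (drop m p))
      ≡⟨ cong₂ _∙_ (cong product left) (trans (Table.factors T G (drop m S) (drop m p)) (cong (λ v → product (Vec.toList v)) right)) ⟩
    product (subsequence S (padʳ (take m p))) ∙ product (Vec.toList (Vec.map (λ q → product (subsequence S (proj₁ q))) (Vec.map widen (Table.pieces T (drop m p))))) ∎
    where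
    open ≡-Reasoning
    open GroupFacts G
    left : subsequence (take m S) (take m p) ≡ subsequence S (padʳ (take m p))
    left = sym (trans (subsequence-++ S (take m p) (replicate k outside))
      (trans (cong (subsequence (take m S) (take m p) List.++_) (subsequence-outside (drop m S))) (List.++-identityʳ _)))
    right : Vec.map (λ q → product (subsequence (drop m S) (proj₁ q))) (Table.pieces T (drop m p)) ≡
            Vec.map (λ q → product (subsequence S (proj₁ q))) (Vec.map widen (Table.pieces T (drop m p)))
    right = trans
      (Vec.map-cong (λ q → cong product (sym (trans (subsequence-++ S (replicate m outside) (proj₁ q))
        (cong (List._++ subsequence (drop m S) (proj₁ q)) (subsequence-outside (take m S)))))) (Table.pieces T (drop m p)))
      (Vec.map-∘ (λ q → product (subsequence S (proj₁ q))) widen (Table.pieces T (drop m p)))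

-- The minimum `L ⊓ k` admits short or empty last chunks, so that the number of factors is always c.
table : ∀ L c k → k ℕ.≤ c ℕ.* L → Table k c
table L zero    zero k≤ = emptyTable
table L (suc c) k    k≤ = subst (λ m → Table m (suc c)) (ℕ.m⊓n+n∸m≡n L k)
  (joinTable (L ⊓ k) (table L c (k ∸ L) (ℕ.m≤n+o⇒m∸n≤o k L k≤)))

length-table : ∀ L c k k≤ → length (Table.entries (table L c k k≤)) ℕ.≤ c ℕ.* 2 ℕ.^ L
length-table L zero    zero k≤ = z≤n
length-table L (suc c) k    k≤ = ℕ.≤-trans (ℕ.≤-reflexive (trans (length-subst (ℕ.m⊓n+n∸m≡n L k) (joinTable (L ⊓ k) T))
    (trans (List.length-++ (map _ (allSubsets (L ⊓ k)))) (cong₂ ℕ._+_ (trans (List.length-map _ (allSubsets (L ⊓ k))) (length-allSubsets (L ⊓ k))) (List.length-map _ (Table.entries T))))))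
  (ℕ.+-mono-≤ (ℕ.^-monoʳ-≤ 2 (ℕ.m⊓n≤m L k)) (length-table L c (k ∸ L) (ℕ.m≤n+o⇒m∸n≤o k L k≤)))
  where
  T = table L c (k ∸ L) (ℕ.m≤n+o⇒m∸n≤o k L k≤)
  length-subst : ∀ {k k′} (eq : k ≡ k′) (U : Table k (suc c)) → length (Table.entries (subst (λ m → Table m (suc c)) eq U)) ≡ length (Table.entries U)
  length-subst refl U = refl

-- The machine

data Stage : Set where
  tortoise hare₁ hare₂ left right : Stage

-- In a working state the three stored elements are w and the two positions
-- of Floyd's algorithm (tortoise, hare₁, hare₂), or the new left position and
-- the two current positions (left, right).
data Control : Set where
  working      : Stage → Control
  succeed fail : Control

code : Control → Fin 7
code (working tortoise) = 0F
code (working hare₁)    = 1F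
code (working hare₂)    = 2F
code (working left)     = 3F
code (working right)    = 4F
code succeed            = 5F
code fail               = 6F

decode : Fin 7 → Control
decode 0F = working tortoise
decode 1F = working hare₁
decode 2F = working hare₂
decode 3F = working left
decode 4F = working right
decode 5F = succeed
decode 6F = fail

decode-code : ∀ s → decode (code s) ≡ s
decode-code (working tortoise) = refl
decode-code (working hare₁)    = refl
decode-code (working hare₂)    = refl
decode-code (working left)     = refl
decode-code (working right)    = refl
decode-code succeed            = refl
decode-code fail               = refl

-- A one-hot code that spends a whole word on each possible value. The values encoded here range
-- over sets whose size does not depend on n, so this stays within a constant number of words.
unary : ∀ ℓ {m} → Fin m → Vec (Vec Bool (suc ℓ)) m
unary ℓ i = tabulate (λ j → replicate (suc ℓ) ⌊ i ≟ j ⌋)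

unary-injective : ∀ ℓ {m} {i j : Fin m} → unary ℓ i ≡ unary ℓ j → i ≡ j
unary-injective ℓ {i = i} {j} eq = diagonal (trans (sym (bit i)) (trans (cong (λ v → Vec.head (lookup v j)) eq) (bit j)))
  where
  bit : ∀ i′ → Vec.head (lookup (unary ℓ i′) j) ≡ ⌊ i′ ≟ j ⌋
  bit i′ = cong Vec.head (Vec.lookup∘tabulate (λ j → replicate (suc ℓ) ⌊ i′ ≟ j ⌋) j)
  diagonal : ⌊ i ≟ j ⌋ ≡ ⌊ j ≟ j ⌋ → i ≡ j
  diagonal eq with i ≟ j | j ≟ j
  ... | yes i≡j | _ = i≡j
  ... | no _ | no j≢j = contradiction refl j≢j
  diagonal () | no _ | yes _

word : ∀ {a b} → 𝒞 a b → Vec Bool (suc (a ℕ.+ b))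
word {a} {b} (inj₁ x) = true  ∷ (x ++ replicate b false)
word {a} {b} (inj₂ y) = false ∷ (replicate a false ++ y)

word-injective : ∀ {a b} {c d : 𝒞 a b} → word c ≡ word d → c ≡ d
word-injective {c = inj₁ x} {inj₁ y} eq = cong inj₁ (Vec.++-injectiveˡ x y (Vec.∷-injectiveʳ eq))
word-injective {a} {c = inj₂ x} {inj₂ y} eq = cong inj₂ (Vec.++-injectiveʳ (replicate a false) (replicate a false) (Vec.∷-injectiveʳ eq))
word-injective {c = inj₁ x} {inj₂ y} eq with () ← Vec.∷-injectiveˡ eq
word-injective {c = inj₂ x} {inj₁ y} eq with () ← Vec.∷-injectiveˡ eq

module Floyd (n a b : ℕ) {c : ℕ} (T : Table (a ℕ.+ b) c) where
  open Table T

  k E ℓ R : ℕ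
  k = a ℕ.+ b
  E = length entries
  ℓ = 3 ℕ.+ c
  R = k ℕ.+ suc (3 ℕ.+ E)

  input : Fin k → Fin R
  input i = i ↑ˡ suc (3 ℕ.+ E)

  target one acc₀ acc₁ : Fin R
  target = k ↑ʳ 0F
  one    = k ↑ʳ 1F
  acc₀   = k ↑ʳ 2F
  acc₁   = k ↑ʳ 3F

  entry : Fin E → Fin R
  entry e = k ↑ʳ Fin.suc (Fin.suc (Fin.suc (Fin.suc e)))

  input≢ : ∀ i j → input i ≢ k ↑ʳ j
  input≢ i j eq = ℕ.<⇒≢ (ℕ.<-≤-trans (toℕ<n i) (ℕ.m≤m+n k (toℕ j)))
    (trans (sym (toℕ-↑ˡ i _)) (trans (cong toℕ eq) (toℕ-↑ʳ k j)))

  extra≢ : ∀ {i j : Fin (suc (3 ℕ.+ E))} → i ≢ j → k ↑ʳ i ≢ k ↑ʳ j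
  extra≢ i≢j eq = i≢j (↑ʳ-injective k _ _ eq)

  fill : Fin E → List (Operation R)
  fill e = copy (entry e) one ∷
           map (λ i → mul (entry e) (entry e) (input i)) (subsequence (Vec.allFin k) (List.lookup entries e))

  fillAll : List (Fin E) → List (Operation R)
  fillAll = List.concatMap fill

  indices : Subset k → Vec (Fin E) c
  indices p = Vec.map (λ q → Any.index (proj₂ q)) (pieces p)

  -- Blocks of operations are executed from the last one to the first one.
  multiply : ∀ {m} → Fin R → Vec (Fin E) m → Vec (Operation R) (suc m)
  multiply t []       = copy t one ∷ []
  multiply t (e ∷ es) = mul t (entry e) t ∷ multiply t es

  -- For 𝒜, two idle copies match the inversion and the multiplication by z needed for ℬ, so every
  -- evaluation has ℓ operations and one counter serves for both.
  evaluate : Fin R → 𝒞 a b → Vec (Operation R) ℓ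
  evaluate t (inj₁ x) = copy t t ∷ copy t t ∷ multiply t (indices (x ++ replicate b outside))
  evaluate t (inj₂ y) = mul t target t ∷ inv t t ∷ multiply t (indices (replicate a outside ++ y))

  Config State : Set
  Config = Control × 𝒞 a b × 𝒞 a b × 𝒞 a b
  -- The second component counts the operations left in the current block; at zero the oracle is
  -- queried.
  State  = Config × Fin (suc ℓ)

  current : Stage → 𝒞 a b × 𝒞 a b × 𝒞 a b → 𝒞 a b
  current tortoise (_ , u , v) = u
  current hare₁    (_ , u , v) = v
  current hare₂    (_ , u , v) = v
  current left     (_ , p , q) = p
  current right    (_ , p , q) = q

  -- Stage `left` has a register of its own, so that after `right` the products of both current
  -- positions are available for the test of Step 5.
  accumulator : Stage → Fin R
  accumulator tortoise = acc₀
  accumulator hare₁    = acc₀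
  accumulator hare₂    = acc₀
  accumulator left     = acc₁
  accumulator right    = acc₀

  -- A meeting at w itself means that the tail is empty, which is the retry of Step 3. Otherwise one
  -- walk restarts at w and the other continues from the meeting point.
  afterRound : (w u v : 𝒞 a b) → Dec (u ≡ v) → Dec (w ≡ u) → Config
  afterRound w u v (no  _) _       = working tortoise , w , u , v
  afterRound w u v (yes _) (yes _) = fail , w , u , v
  afterRound w u v (yes _) (no  _) = working left , w , w , u

  -- The old positions p and q are kept until the new ones have been compared, because Steps 4 to 7
  -- use the predecessors of the first common position.
  afterPair : (p q p′ q′ : 𝒞 a b) → Dec (p′ ≡ q′) → Bool → Config
  afterPair p q p′ q′ (no  _) same  = working left , p′ , p′ , q′
  afterPair p q p′ q′ (yes _) true  = succeed , p′ , p , q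
  afterPair p q p′ q′ (yes _) false = fail , p′ , p , q

  advance : Stage → 𝒞 a b × 𝒞 a b × 𝒞 a b → 𝒞 a b → Bool → Config
  advance tortoise (w  , u , v) d same = working hare₁ , w , d , v
  advance hare₁    (w  , u , v) d same = working hare₂ , w , u , d
  advance hare₂    (w  , u , v) d same = afterRound w u d (u ≟𝒞 d) (w ≟𝒞 u)
  advance left     (_  , p , q) d same = working right , d , p , q
  advance right    (p′ , p , q) d same = afterPair p q p′ d (p′ ≟𝒞 d) same

  combine : 𝒞 a b → 𝒞 a b → Result k
  combine (inj₁ x) (inj₂ y) = found (x ++ y)
  combine (inj₂ y) (inj₁ x) = found (x ++ y)
  combine (inj₁ _) (inj₁ _) = retry
  combine (inj₂ _) (inj₂ _) = retry

  start : Config → State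
  start s = s , fromℕ ℓ

  next : State → Vec (Fin n) R → Instruction R State (𝒞 a b) k
  next ((working st , xs) , Fin.suc i)  m = operate (lookup (evaluate (accumulator st) (current st xs)) i) ((working st , xs) , inject₁ i)
  next ((working st , xs) , Fin.zero)   m = query (accumulator st) (λ d → start (advance st xs d ⌊ lookup m acc₀ ≟ lookup m acc₁ ⌋))
  next ((succeed , _ , p , q) , _)      m = stop (combine q p)
  next ((fail , _) , _)                 m = stop retry

  encodeState : State → Vec (Vec Bool (suc k)) (7 ℕ.+ (suc ℓ ℕ.+ 3))
  encodeState ((s , x , y , z) , i) = unary k (code s) ++ unary k i ++ (word x ∷ word y ∷ word z ∷ [])

  encodeState-injective : ∀ {s t} → encodeState s ≡ encodeState t → s ≡ t
  encodeState-injective {(s , x , y , z) , i} {(s′ , x′ , y′ , z′) , i′} eq =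
    cong₂ _,_ (cong₂ _,_ s≡ (cong₂ _,_ (word-injective (Vec.∷-injectiveˡ eq₃))
      (cong₂ _,_ (word-injective (Vec.∷-injectiveˡ (Vec.∷-injectiveʳ eq₃))) (word-injective (Vec.∷-injectiveˡ (Vec.∷-injectiveʳ (Vec.∷-injectiveʳ eq₃)))))))
      (unary-injective k (Vec.++-injectiveˡ (unary k i) (unary k i′) eq₂))
    where
    eq₂ = Vec.++-injectiveʳ (unary k (code s)) (unary k (code s′)) eq
    eq₃ = Vec.++-injectiveʳ (unary k i) (unary k i′) eq₂
    s≡ : s ≡ s′
    s≡ = trans (sym (decode-code s)) (trans (cong decode (unary-injective k (Vec.++-injectiveˡ (unary k (code s)) (unary k (code s′)) eq))) (decode-code s′))

  -- Up to t rounds of tortoise and hare with three evaluations of φ, the final `stop`, and up to t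
  -- rounds of the left and right walks with two. An evaluation takes ℓ operations and one query.
  rounds : ℕ → ℕ
  rounds t = t ℕ.* (3 ℕ.* suc ℓ) ℕ.+ suc (t ℕ.* (2 ℕ.* suc ℓ))

  machine : Machine n a b
  machine = record
    { extra          = 3 ℕ.+ E
    ; precomputation = fillAll (List.allFin E)
    ; State          = State
    ; words          = 7 ℕ.+ (suc ℓ ℕ.+ 3)
    ; encode         = mk↣ encodeState-injective
    ; begin          = λ w → start (working tortoise , w , w , w)
    ; next           = next
    ; maxSteps       = rounds (suc n)
    }

module Simulation {n a b c} (T : Table (a ℕ.+ b) c) (G : BlackBoxGroup n) (S : Vec (Fin n) (a ℕ.+ b)) (z : Fin n) where
  open Table T
  open Floyd n a b T
  open GroupFacts G
  open PollardRho G a b S z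
  open Execution G machine S z

  -- Precomputation

  tableValue : Fin E → Fin n
  tableValue e = product (subsequence S (List.lookup entries e))

  record Loaded (m : Memory) : Set where
    field
      inputs   : ∀ i → lookup m (input i) ≡ lookup S i
      theTarget : lookup m target ≡ z
      theOne   : lookup m one ≡ ε

  unchanged : ∀ (m : Memory) {t r} v → r ≢ t → lookup (m [ t ]≔ v) r ≡ lookup m r
  unchanged m v r≢t = Vec.lookup∘update′ r≢t m v

  performAll-++ : ∀ ops ops′ m → performAll (ops List.++ ops′) m ≡ performAll ops′ (performAll ops m)
  performAll-++ []         ops′ m = refl
  performAll-++ (op ∷ ops) ops′ m = performAll-++ ops ops′ (perform op m)

  multiplications : Fin E → List (Fin k) → List (Operation R)
  multiplications e = map (λ i → mul (entry e) (entry e) (input i))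

  multiplications-unchanged : ∀ e is m {r} → r ≢ entry e → lookup (performAll (multiplications e is) m) r ≡ lookup m r
  multiplications-unchanged e []       m r≢ = refl
  multiplications-unchanged e (i ∷ is) m r≢ = trans (multiplications-unchanged e is _ r≢) (unchanged m _ r≢)

  multiplications-product : ∀ e is m → (∀ i → lookup m (input i) ≡ lookup S i) →
    lookup (performAll (multiplications e is) m) (entry e) ≡ lookup m (entry e) ∙ product (map (lookup S) is)
  multiplications-product e []       m inputs = sym (identityʳ _)
  multiplications-product e (i ∷ is) m inputs = begin
    lookup (performAll (multiplications e is) m′) (entry e)
      ≡⟨ multiplications-product e is m′ (λ j → trans (unchanged m _ (input≢ j _)) (inputs j)) ⟩
    lookup m′ (entry e) ∙ product (map (lookup S) is)
      ≡⟨ cong (_∙ product (map (lookup S) is)) (trans (Vec.lookup∘update (entry e) m _) (cong (lookup m (entry e) ∙_) (inputs i))) ⟩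
    lookup m (entry e) ∙ lookup S i ∙ product (map (lookup S) is)
      ≡⟨ assoc _ _ _ ⟩
    lookup m (entry e) ∙ product (map (lookup S) (i ∷ is)) ∎
    where
    open ≡-Reasoning
    m′ = m [ entry e ]≔ (lookup m (entry e) ∙ lookup m (input i))

  fill-unchanged : ∀ e m {r} → r ≢ entry e → lookup (performAll (fill e) m) r ≡ lookup m r
  fill-unchanged e m r≢ = trans (multiplications-unchanged e (subsequence (Vec.allFin k) (List.lookup entries e)) (m [ entry e ]≔ lookup m one) r≢) (unchanged m (lookup m one) r≢)

  fill-Loaded : ∀ e {m} → Loaded m → Loaded (performAll (fill e) m)
  fill-Loaded e {m} loaded = record
    { inputs    = λ i → trans (fill-unchanged e m (input≢ i _)) (inputs i)
    ; theTarget = trans (fill-unchanged e m (extra≢ λ ())) theTarget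
    ; theOne    = trans (fill-unchanged e m (extra≢ λ ())) theOne
    }
    where open Loaded loaded

  fill-correct : ∀ e {m} → Loaded m → lookup (performAll (fill e) m) (entry e) ≡ tableValue e
  fill-correct e {m} loaded = begin
    lookup (performAll (fill e) m) (entry e)
      ≡⟨ multiplications-product e is m′ (λ i → trans (unchanged m _ (input≢ i _)) (inputs i)) ⟩
    lookup m′ (entry e) ∙ product (map (lookup S) is)
      ≡⟨ cong₂ _∙_ (trans (Vec.lookup∘update (entry e) m _) theOne) (cong product (sym (subsequence-lookup S (List.lookup entries e)))) ⟩
    ε ∙ tableValue e
      ≡⟨ identityˡ _ ⟩
    tableValue e ∎
    where
    open ≡-Reasoning
    open Loaded loaded
    is = subsequence (Vec.allFin k) (List.lookup entries e)
    m′ = m [ entry e ]≔ lookup m one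

  entry-injective : ∀ {e e′} → entry e ≡ entry e′ → e ≡ e′
  entry-injective eq with refl ← ↑ʳ-injective k _ _ eq = refl

  fillAll-Loaded : ∀ es {m} → Loaded m → Loaded (performAll (fillAll es) m)
  fillAll-Loaded []       loaded = loaded
  fillAll-Loaded (e ∷ es) {m} loaded = subst Loaded (sym (performAll-++ (fill e) (fillAll es) m)) (fillAll-Loaded es (fill-Loaded e loaded))

  fillAll-keeps : ∀ es {m e} → Loaded m → lookup m (entry e) ≡ tableValue e → lookup (performAll (fillAll es) m) (entry e) ≡ tableValue e
  fillAll-keeps []        loaded eq = eq
  fillAll-keeps (e′ ∷ es) {m} {e} loaded eq = trans (cong (λ m → lookup m (entry e)) (performAll-++ (fill e′) (fillAll es) m))
    (fillAll-keeps es (fill-Loaded e′ loaded) now)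
    where
    now : lookup (performAll (fill e′) m) (entry e) ≡ tableValue e
    now with e ≟ e′
    ... | yes refl = fill-correct e loaded
    ... | no  e≢e′ = trans (fill-unchanged e′ m (λ eq → e≢e′ (entry-injective eq))) eq

  fillAll-correct : ∀ es {m e} → Loaded m → e ∈ es → lookup (performAll (fillAll es) m) (entry e) ≡ tableValue e
  fillAll-correct (e ∷ es) {m} loaded (here refl) = trans (cong (λ m → lookup m (entry e)) (performAll-++ (fill e) (fillAll es) m))
    (fillAll-keeps es (fill-Loaded e loaded) (fill-correct e loaded))
  fillAll-correct (e′ ∷ es) {m} {e} loaded (there e∈es) = trans (cong (λ m → lookup m (entry e)) (performAll-++ (fill e′) (fillAll es) m))
    (fillAll-correct es (fill-Loaded e′ loaded) e∈es)

  initial-Loaded : Loaded (S ++ (z ∷ replicate _ ε))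
  initial-Loaded = record
    { inputs    = λ i → Vec.lookup-++ˡ S _ i
    ; theTarget = Vec.lookup-++ʳ S _ 0F
    ; theOne    = Vec.lookup-++ʳ S _ 1F
    }

  precomputed-Loaded : Loaded precomputed
  precomputed-Loaded = fillAll-Loaded (List.allFin E) initial-Loaded

  precomputed-entry : ∀ e → lookup precomputed (entry e) ≡ tableValue e
  precomputed-entry e = fillAll-correct (List.allFin E) initial-Loaded (∈-allFin e)

  totalCost : List (Operation R) → ℕ
  totalCost = List.foldr (λ op c → cost op ℕ.+ c) 0

  totalCost-++ : ∀ ops ops′ → totalCost (ops List.++ ops′) ≡ totalCost ops ℕ.+ totalCost ops′
  totalCost-++ []         ops′ = refl
  totalCost-++ (op ∷ ops) ops′ = trans (cong (cost op ℕ.+_) (totalCost-++ ops ops′)) (sym (ℕ.+-assoc (cost op) _ _))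

  totalCost-multiplications : ∀ e is → totalCost (multiplications e is) ≡ length is
  totalCost-multiplications e []       = refl
  totalCost-multiplications e (i ∷ is) = cong suc (totalCost-multiplications e is)

  totalCost-fillAll : ∀ es → totalCost (fillAll es) ℕ.≤ length es ℕ.* k
  totalCost-fillAll []       = z≤n
  totalCost-fillAll (e ∷ es) = ℕ.≤-trans (ℕ.≤-reflexive (totalCost-++ (fill e) (fillAll es)))
    (ℕ.+-mono-≤ (ℕ.≤-trans (ℕ.≤-reflexive (totalCost-multiplications e (subsequence (Vec.allFin k) (List.lookup entries e)))) (length-subsequence (Vec.allFin k) (List.lookup entries e))) (totalCost-fillAll es))

  precomputationCost≤ : precomputationCost ℕ.≤ E ℕ.* k
  precomputationCost≤ = ℕ.≤-trans (totalCost-fillAll (List.allFin E)) (ℕ.≤-reflexive (cong (ℕ._* k) (List.length-tabulate (λ (i : Fin E) → i))))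

  -- Evaluation of π

  -- The invariant carried from one attempt to the next. Each evaluation first resets its
  -- accumulator to ε, so leftovers of earlier evaluations do no harm.
  Intact : Memory → Set
  Intact m = ∀ {r} → r ≢ acc₀ → r ≢ acc₁ → lookup m r ≡ lookup precomputed r

  -- Performs the operations with numbers i - 1 down to 0, following the descending counter of the
  -- state.
  execute : ∀ {m} → Fin (suc m) → Vec (Operation R) m → Memory → Memory
  execute Fin.zero    ops        m = m
  execute (Fin.suc i) (op ∷ ops) m = perform op (execute i ops m)

  execute-inject₁ : ∀ {l} (i : Fin l) ops m → execute (Fin.suc i) ops m ≡ execute (inject₁ i) ops (perform (lookup ops i) m)
  execute-inject₁ Fin.zero    (op ∷ ops)  m = refl
  execute-inject₁ (Fin.suc i) (op ∷ ops) m = cong (perform op) (execute-inject₁ i ops m)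

  executeAll : ∀ {l} → Vec (Operation R) l → Memory → Memory
  executeAll {l} = execute (fromℕ l)

  record Computes (t : Fin R) (m m′ : Memory) (g : Fin n) : Set where
    field
      computed : lookup m′ t ≡ g
      others   : ∀ {r} → r ≢ t → lookup m′ r ≡ lookup m r
  open Computes

  Computes-update : ∀ {t m m′ g h} v → Computes t m m′ g → v ≡ h → Computes t m (m′ [ t ]≔ v) h
  Computes-update {t} {m} {m′} v step v≡h = record
    { computed = trans (Vec.lookup∘update t m′ v) v≡h
    ; others   = λ r≢t → trans (unchanged m′ v r≢t) (others step r≢t)
    }

  IsAccumulator : Fin R → Set
  IsAccumulator t = (t ≡ acc₀) ⊎ (t ≡ acc₁)

  intact : ∀ {m t} → Intact m → IsAccumulator t → ∀ {m′ g} → Computes t m m′ g → ∀ {r} → r ≢ acc₀ → r ≢ acc₁ → lookup m′ r ≡ lookup precomputed r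
  intact I (inj₁ refl) step r≢₀ r≢₁ = trans (others step r≢₀) (I r≢₀ r≢₁)
  intact I (inj₂ refl) step r≢₀ r≢₁ = trans (others step r≢₁) (I r≢₀ r≢₁)

  multiply-computes : ∀ {l t m} → IsAccumulator t → Intact m → (es : Vec (Fin E) l) →
    Computes t m (executeAll (multiply t es) m) (product (Vec.toList (Vec.map tableValue es)))
  multiply-computes {t = t} {m} acc I [] = record
    { computed = trans (Vec.lookup∘update t m _) (trans (I (extra≢ λ ()) (extra≢ λ ())) (Loaded.theOne precomputed-Loaded))
    ; others   = λ r≢t → unchanged m _ r≢t
    }
  multiply-computes {t = t} {m} acc I (e ∷ es) = Computes-update _ step
    (cong₂ _∙_ (trans (intact I acc step (extra≢ λ ()) (extra≢ λ ())) (precomputed-entry e)) (computed step))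
    where step = multiply-computes acc I es

  product-indices : ∀ p → product (Vec.toList (Vec.map tableValue (indices p))) ≡ product (subsequence S p)
  product-indices p = begin
    product (Vec.toList (Vec.map tableValue (indices p)))
      ≡⟨ cong (λ v → product (Vec.toList v)) (sym (Vec.map-∘ tableValue (λ q → Any.index (proj₂ q)) (pieces p))) ⟩
    product (Vec.toList (Vec.map (λ q → tableValue (Any.index (proj₂ q))) (pieces p)))
      ≡⟨ cong (λ v → product (Vec.toList v)) (Vec.map-cong (λ q → cong (λ s → product (subsequence S s)) (sym (lookup-index (proj₂ q)))) (pieces p)) ⟩
    product (Vec.toList (Vec.map (λ q → product (subsequence S (proj₁ q))) (pieces p)))
      ≡⟨ factors G S p ⟨
    product (subsequence S p) ∎
    where open ≡-Reasoning

  evaluate-computes : ∀ {t m} → IsAccumulator t → Intact m → ∀ x → Computes t m (executeAll (evaluate t x) m) (π x)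
  evaluate-computes {t} {m} acc I (inj₁ x) = Computes-update _ (Computes-update _ step (computed step)) (trans
    (Vec.lookup∘update t (executeAll (multiply t (indices (x ++ replicate b outside))) m) _)
    (trans (computed step) (trans (product-indices (x ++ replicate b outside)) (cong product (begin
      subsequence S (x ++ replicate b outside)
        ≡⟨ subsequence-++ S x (replicate b outside) ⟩
      subsequence (take a S) x List.++ subsequence (drop a S) (replicate b outside)
        ≡⟨ cong (subsequence (take a S) x List.++_) (subsequence-outside (drop a S)) ⟩
      subsequence (take a S) x List.++ []
        ≡⟨ List.++-identityʳ _ ⟩
      subsequence (take a S) x ∎)))))
    where
    open ≡-Reasoning
    step = multiply-computes acc I (indices (x ++ replicate b outside))
  evaluate-computes {t} {m} acc I (inj₂ y) = Computes-update _ inverted (cong₂ _∙_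
    (trans (intact I acc inverted (extra≢ λ ()) (extra≢ λ ())) (Loaded.theTarget precomputed-Loaded))
    (trans (computed inverted) (sym (product-μ (subsequence (drop a S) y)))))
    where
    step = multiply-computes acc I (indices (replicate a outside ++ y))
    inverted = Computes-update _ step (cong _⁻¹ (trans (computed step) (trans (product-indices (replicate a outside ++ y)) (cong product (trans
      (subsequence-++ S (replicate a outside) y) (cong (List._++ subsequence (drop a S) y) (subsequence-outside (take a S))))))))

  -- Correctness of Floyd's algorithm

  module Attempts (w : 𝒞 a b) (η : Oracle n a b) where
    open Cycle _≟𝒞_ (φ η) w renaming (c to at; c-suc to at-suc)

    -- The spare fuel `f` is arbitrary, so bounds for consecutive stretches of a run compose by
    -- addition and can be weakened freely.
    record Halts (N τ : ℕ) (s : State) (m : Memory) : Set where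
      field
        {returned}  : Result k
        {spent}     : ℕ
        {final}     : Memory
        runs        : ∀ f → run (N ℕ.+ f) η s m ≡ ⟨ returned , spent , final ⟩
        spent≤      : spent ℕ.≤ τ
        finalIntact : Intact final
        attempted   : Attempt w η returned

    weaken : ∀ {N N′ τ τ′ s m} → N ℕ.≤ N′ → τ ℕ.≤ τ′ → Halts N τ s m → Halts N′ τ′ s m
    weaken {N} {N′} {s = s} {m} N≤N′ τ≤τ′ h = record
      { runs        = λ f → trans (cong (λ j → run j η s m) (trans (cong (ℕ._+ f) (sym (ℕ.m+[n∸m]≡n N≤N′))) (ℕ.+-assoc N (N′ ∸ N) f))) (runs (N′ ∸ N ℕ.+ f))
      ; spent≤      = ℕ.≤-trans spent≤ τ≤τ′
      ; finalIntact = λ {r} → finalIntact {r}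
      ; attempted   = attempted
      }
      where open Halts h

    halted : ∀ {N τ s m res} → Intact m → Attempt w η res → (∀ f → run (suc f) η s m ≡ ⟨ res , 0 , m ⟩) → Halts (suc N) τ s m
    halted {N} I attempted runs = record
      { runs        = λ f → runs (N ℕ.+ f)
      ; spent≤      = z≤n
      ; finalIntact = λ {r} → I {r}
      ; attempted   = attempted
      }

    pay : ℕ → Run → Run
    pay τ r = ⟨ result r , τ ℕ.+ time r , memory r ⟩

    pay-pay : ∀ σ τ r → pay σ (pay τ r) ≡ pay (σ ℕ.+ τ) r
    pay-pay σ τ r = cong (λ t → ⟨ result r , t , memory r ⟩) (sym (ℕ.+-assoc σ τ (time r)))

    cost≤1 : ∀ (op : Operation R) → cost op ℕ.≤ 1
    cost≤1 (mul _ _ _) = ℕ.≤-refl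
    cost≤1 (inv _ _)   = ℕ.≤-refl
    cost≤1 (copy _ _)  = z≤n

    -- The number j repeats `toℕ i` to carry the recursion, since `inject₁ i` is not a structural
    -- part of the counter.
    drain : ∀ j (i : Fin (suc ℓ)) → toℕ i ≡ j → ∀ st xs m →
      ∃[ τ ] (τ ℕ.≤ j × (∀ f → run (j ℕ.+ f) η ((working st , xs) , i) m ≡
        pay τ (run f η ((working st , xs) , 0F) (execute i (evaluate (accumulator st) (current st xs)) m))))
    drain zero    Fin.zero    refl st xs m = 0 , z≤n , λ f → refl
    drain (suc j) (Fin.suc i) eq   st xs m = cost op ℕ.+ τ , ℕ.+-mono-≤ (cost≤1 op) τ≤j , λ f → begin
      pay (cost op) (run (j ℕ.+ f) η ((working st , xs) , inject₁ i) (perform op m))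
        ≡⟨ cong (pay (cost op)) (drained f) ⟩
      pay (cost op) (pay τ (run f η ((working st , xs) , 0F) (execute (inject₁ i) ops (perform op m))))
        ≡⟨ cong (λ m′ → pay (cost op) (pay τ (run f η ((working st , xs) , 0F) m′))) (execute-inject₁ i ops m) ⟨
      pay (cost op) (pay τ (run f η ((working st , xs) , 0F) (execute (Fin.suc i) ops m)))
        ≡⟨ pay-pay (cost op) τ _ ⟩
      pay (cost op ℕ.+ τ) (run f η ((working st , xs) , 0F) (execute (Fin.suc i) ops m)) ∎
      where
      open ≡-Reasoning
      ops = evaluate (accumulator st) (current st xs)
      op  = lookup ops i
      rest = drain j (inject₁ i) (trans (toℕ-inject₁ i) (ℕ.suc-injective eq)) st xs (perform op m)
      τ = proj₁ rest
      τ≤j = proj₁ (proj₂ rest)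
      drained = proj₂ (proj₂ rest)

    isAccumulator : ∀ st → IsAccumulator (accumulator st)
    isAccumulator tortoise = inj₁ refl
    isAccumulator hare₁    = inj₁ refl
    isAccumulator hare₂    = inj₁ refl
    isAccumulator left     = inj₂ refl
    isAccumulator right    = inj₁ refl

    step : ∀ st xs {m N τ} → Intact m →
      (∀ {m′} → Intact m′ → Computes (accumulator st) m m′ (π (current st xs)) →
        Halts N τ (start (advance st xs (φ η (current st xs)) ⌊ lookup m′ acc₀ ≟ lookup m′ acc₁ ⌋)) m′) →
      Halts (suc ℓ ℕ.+ N) (ℓ ℕ.+ τ) (start (working st , xs)) m
    step st xs {m} {N} I continue = record
      { runs        = λ f → begin
          run (suc ℓ ℕ.+ N ℕ.+ f) η (start (working st , xs)) m
            ≡⟨ cong (λ j → run j η (start (working st , xs)) m) (trans (cong suc (ℕ.+-assoc ℓ N f)) (sym (ℕ.+-suc ℓ (N ℕ.+ f)))) ⟩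
          run (ℓ ℕ.+ suc (N ℕ.+ f)) η (start (working st , xs)) m
            ≡⟨ proj₂ (proj₂ evaluation) (suc (N ℕ.+ f)) ⟩
          pay cost′ (run (N ℕ.+ f) η (start (advance st xs (lookup η (lookup m′ (accumulator st))) flag)) m′)
            ≡⟨ cong (λ g → pay cost′ (run (N ℕ.+ f) η (start (advance st xs (lookup η g) flag)) m′)) (computed computes) ⟩
          pay cost′ (run (N ℕ.+ f) η (start (advance st xs (φ η (current st xs)) flag)) m′)
            ≡⟨ cong (pay cost′) (runs f) ⟩
          ⟨ returned , cost′ ℕ.+ spent , final ⟩ ∎
      ; spent≤      = ℕ.+-mono-≤ (proj₁ (proj₂ evaluation)) spent≤
      ; finalIntact = λ {r} → finalIntact {r}
      ; attempted   = attempted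
      }
      where
      open ≡-Reasoning
      ops = evaluate (accumulator st) (current st xs)
      evaluation = drain ℓ (fromℕ ℓ) (toℕ-fromℕ ℓ) st xs m
      cost′ = proj₁ evaluation
      m′ = executeAll ops m
      flag = ⌊ lookup m′ acc₀ ≟ lookup m′ acc₁ ⌋
      computes : Computes (accumulator st) m m′ (π (current st xs))
      computes = evaluate-computes (isAccumulator st) I (current st xs)
      open Halts (continue (intact I (isAccumulator st) computes) computes)

    combine-steps6-8 : ∀ s t → combine s t ≡ steps6-8 s t
    combine-steps6-8 (inj₁ _) (inj₁ _) = refl
    combine-steps6-8 (inj₁ _) (inj₂ _) = refl
    combine-steps6-8 (inj₂ _) (inj₁ _) = refl
    combine-steps6-8 (inj₂ _) (inj₂ _) = refl

    isLeast : ∀ {t j} → 0 ℕ.< t → at (t ℕ.+ j) ≡ at j → (∀ {j′} → at (t ℕ.+ j′) ≡ at j′ → j ℕ.≤ j′) →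
      ∃[ i ] IsLeastCycle η w i j
    isLeast 0<t cycle leastTail with leastCycle 0<t cycle leastTail
    ... | i , 0<i , cycleᵢ , smallest = i , record { positive = 0<i ; cycle = cycleᵢ ; least = smallest }

    module _ {t} (0<t : 0 ℕ.< t) (meet : at (t ℕ.+ t) ≡ at t) where

      -- The machine compares products at t + j, whereas `noCollision` speaks of the least period i;
      -- `predecessors` identifies the two positions.
      colliding : ∀ {j} → at (t ℕ.+ suc j) ≡ at (suc j) → (∀ {j′} → at (t ℕ.+ j′) ≡ at j′ → j ℕ.< j′) →
        Dec (π (at (t ℕ.+ j)) ≡ π (at j)) → Attempt w η retry ⊎ (π (at (t ℕ.+ j)) ≡ π (at j))
      colliding cycle tail (yes same) = inj₂ same
      colliding {j} cycle tail (no differ) with isLeast 0<t cycle tail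
      ... | i , L = inj₁ (noCollision L (λ same → differ (trans (cong π (sym (predecessors (IsLeastCycle.positive L) 0<t (IsLeastCycle.cycle L) cycle))) same)))

      collided : ∀ {j} → at (t ℕ.+ suc j) ≡ at (suc j) → (∀ {j′} → at (t ℕ.+ j′) ≡ at j′ → j ℕ.< j′) →
        π (at (t ℕ.+ j)) ≡ π (at j) → Attempt w η (combine (at (t ℕ.+ j)) (at j))
      collided {j} cycle tail same with isLeast 0<t cycle tail
      ... | i , L = subst (Attempt w η) (trans (cong (λ s → steps6-8 s (at j)) pred) (sym (combine-steps6-8 (at (t ℕ.+ j)) (at j))))
        (collision L (trans (cong π pred) same))
        where pred = predecessors (IsLeastCycle.positive L) 0<t (IsLeastCycle.cycle L) cycle

      -- The hypothesis `tail` excludes a cycle of length t starting at j or earlier, so the first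
      -- agreement, at j + 1, reveals the least tail. Agreement is certain at index t by `meet`, and
      -- d counts the indices before it.
      leftLoop : ∀ d j {x p q m} → suc d ℕ.+ j ≡ t → (∀ {j′} → at (t ℕ.+ j′) ≡ at j′ → j ℕ.< j′) →
        p ≡ at j → q ≡ at (t ℕ.+ j) → Intact m →
        Halts (suc (suc d ℕ.* (2 ℕ.* suc ℓ))) (suc d ℕ.* (2 ℕ.* ℓ)) (start (working left , x , p , q)) m
      leftLoop d j {x} {p} {q} {m} eq tail p≡ q≡ I = weaken
        (ℕ.≤-reflexive (solveℕ 2 (λ ℓ N → conℕ 1 ⊕ ℓ ⊕ (conℕ 1 ⊕ ℓ ⊕ (conℕ 1 ⊕ N)) ⊜ conℕ 1 ⊕ (conℕ 2 ⊗ (conℕ 1 ⊕ ℓ) ⊕ N)) refl ℓ (d ℕ.* (2 ℕ.* suc ℓ))))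
        (ℕ.≤-reflexive (solveℕ 2 (λ ℓ N → ℓ ⊕ (ℓ ⊕ N) ⊜ conℕ 2 ⊗ ℓ ⊕ N) refl ℓ (d ℕ.* (2 ℕ.* ℓ))))
        (step left (x , p , q) I λ I₁ computes₁ → step right (φ η p , p , q) I₁ λ {m₂} I₂ computes₂ →
          finish d eq I₂ (φ η p ≟𝒞 φ η q) (lookup m₂ acc₀ ≟ lookup m₂ acc₁)
            (trans (computed computes₂) (cong π q≡))
            (trans (others computes₂ (extra≢ λ ())) (trans (computed computes₁) (cong π p≡))))
        where
        p′≡ : φ η p ≡ at (suc j)
        p′≡ = trans (cong (φ η) p≡) (sym (at-suc j))
        q′≡ : φ η q ≡ at (t ℕ.+ suc j)
        q′≡ = trans (cong (φ η) q≡) (trans (sym (at-suc (t ℕ.+ j))) (cong at (sym (ℕ.+-suc t j))))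
        finish : ∀ d → suc d ℕ.+ j ≡ t → ∀ {m₂} → Intact m₂ → (agree : Dec (φ η p ≡ φ η q)) (same : Dec (lookup m₂ acc₀ ≡ lookup m₂ acc₁)) →
          lookup m₂ acc₀ ≡ π (at (t ℕ.+ j)) → lookup m₂ acc₁ ≡ π (at j) →
          Halts (suc (d ℕ.* (2 ℕ.* suc ℓ))) (d ℕ.* (2 ℕ.* ℓ)) (start (afterPair p q (φ η p) (φ η q) agree ⌊ same ⌋)) m₂
        finish d eq I₂ (yes p′≡q′) (yes same) acc₀≡ acc₁≡ = halted I₂
          (subst₂ (λ q p → Attempt w η (combine q p)) (sym q≡) (sym p≡)
            (collided (trans (sym q′≡) (trans (sym p′≡q′) p′≡)) tail (trans (sym acc₀≡) (trans same acc₁≡)))) (λ f → refl)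
        finish d eq I₂ (yes p′≡q′) (no differ) acc₀≡ acc₁≡
          with colliding (trans (sym q′≡) (trans (sym p′≡q′) p′≡)) tail (no (λ same → differ (trans acc₀≡ (trans same (sym acc₁≡)))))
        ... | inj₁ attempted = halted I₂ attempted (λ f → refl)
        ... | inj₂ same = contradiction (trans acc₀≡ (trans same (sym acc₁≡))) differ
        finish zero eq I₂ (no p′≢q′) same acc₀≡ acc₁≡ = contradiction (trans p′≡ (trans (sym (subst (λ i → at (t ℕ.+ i) ≡ at i) (sym eq) meet)) (sym q′≡))) p′≢q′
        finish (suc d′) eq I₂ (no p′≢q′) same acc₀≡ acc₁≡ = leftLoop d′ (suc j) (trans (ℕ.+-suc (suc d′) j) eq)
          (λ {j′} cycle → ℕ.≤∧≢⇒< (tail cycle) (λ { refl → p′≢q′ (trans p′≡ (trans (sym cycle) (sym q′≡))) }))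
          p′≡ q′≡ I₂

    -- T is an index at which tortoise and hare are known to agree. They may meet earlier, at some
    -- index at most T, so T bounds both loops.
    tortoiseLoop : ∀ {T} → at (T ℕ.+ T) ≡ at T → ∀ d t {u v m} → suc d ℕ.+ t ≡ T → u ≡ at t → v ≡ at (t ℕ.+ t) → Intact m →
      Halts (suc d ℕ.* (3 ℕ.* suc ℓ) ℕ.+ suc (T ℕ.* (2 ℕ.* suc ℓ))) (suc d ℕ.* (3 ℕ.* ℓ) ℕ.+ T ℕ.* (2 ℕ.* ℓ))
        (start (working tortoise , w , u , v)) m
    tortoiseLoop {T} meet d t {u} {v} eq u≡ v≡ I = weaken
      (ℕ.≤-reflexive (solveℕ 2 (λ ℓ N → conℕ 1 ⊕ ℓ ⊕ (conℕ 1 ⊕ ℓ ⊕ (conℕ 1 ⊕ ℓ ⊕ N)) ⊜ conℕ 3 ⊗ (conℕ 1 ⊕ ℓ) ⊕ N) refl ℓ (N d) ⟨ trans ⟩ sym (ℕ.+-assoc (3 ℕ.* suc ℓ) _ _)))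
      (ℕ.≤-reflexive (solveℕ 2 (λ ℓ N → ℓ ⊕ (ℓ ⊕ (ℓ ⊕ N)) ⊜ conℕ 3 ⊗ ℓ ⊕ N) refl ℓ (τ d) ⟨ trans ⟩ sym (ℕ.+-assoc (3 ℕ.* ℓ) _ _)))
      (step tortoise (w , u , v) I λ I₁ _ → step hare₁ (w , φ η u , v) I₁ λ I₂ _ → step hare₂ (w , φ η u , φ η v) I₂ λ I₃ _ →
        finish d eq I₃ (φ η u ≟𝒞 φ η (φ η v)) (w ≟𝒞 φ η u))
      where
      N : ℕ → ℕ
      N d = d ℕ.* (3 ℕ.* suc ℓ) ℕ.+ suc (T ℕ.* (2 ℕ.* suc ℓ))
      τ : ℕ → ℕ
      τ d = d ℕ.* (3 ℕ.* ℓ) ℕ.+ T ℕ.* (2 ℕ.* ℓ)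
      u′≡ : φ η u ≡ at (suc t)
      u′≡ = trans (cong (φ η) u≡) (sym (at-suc t))
      v′≡ : φ η (φ η v) ≡ at (suc t ℕ.+ suc t)
      v′≡ = trans (cong (λ x → φ η (φ η x)) v≡) (trans (cong (φ η) (sym (at-suc (t ℕ.+ t)))) (trans (sym (at-suc (suc t ℕ.+ t))) (cong at (sym (ℕ.+-suc (suc t) t)))))
      suc-t≤T : ∀ d → suc d ℕ.+ t ≡ T → suc t ℕ.≤ T
      suc-t≤T d eq = ℕ.≤-trans (s≤s (ℕ.m≤n+m t d)) (ℕ.≤-reflexive eq)
      finish : ∀ d → suc d ℕ.+ t ≡ T → ∀ {m₃} → Intact m₃ → (agree : Dec (φ η u ≡ φ η (φ η v))) (noTail? : Dec (w ≡ φ η u)) →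
        Halts (N d) (τ d) (start (afterRound w (φ η u) (φ η (φ η v)) agree noTail?)) m₃
      finish d eq I₃ (yes u′≡v′) (yes w≡u′) = weaken (ℕ.≤-trans (s≤s z≤n) (ℕ.m≤n+m (suc (T ℕ.* (2 ℕ.* suc ℓ))) (d ℕ.* (3 ℕ.* suc ℓ)))) ℕ.≤-refl
        (halted {0} I₃ (noTail (proj₂ (isLeast {suc t} {0} (s≤s z≤n) (trans (cong at (ℕ.+-identityʳ (suc t))) (trans (sym u′≡) (sym w≡u′))) (λ _ → z≤n)))) (λ f → refl))
      finish d eq I₃ (yes u′≡v′) (no w≢u′) = weaken
        (ℕ.≤-trans (s≤s (ℕ.*-monoˡ-≤ (2 ℕ.* suc ℓ) (suc-t≤T d eq))) (ℕ.m≤n+m _ (d ℕ.* (3 ℕ.* suc ℓ))))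
        (ℕ.≤-trans (ℕ.*-monoˡ-≤ (2 ℕ.* ℓ) (suc-t≤T d eq)) (ℕ.m≤n+m _ (d ℕ.* (3 ℕ.* ℓ))))
        (leftLoop (s≤s z≤n) (trans (sym v′≡) (trans (sym u′≡v′) u′≡)) t 0 (ℕ.+-identityʳ (suc t)) tail refl (trans u′≡ (cong at (sym (ℕ.+-identityʳ (suc t))))) I₃)
        where
        tail : ∀ {j′} → at (suc t ℕ.+ j′) ≡ at j′ → 0 ℕ.< j′
        tail {zero}  cycle = contradiction (trans (sym cycle) (trans (cong at (ℕ.+-identityʳ (suc t))) (sym u′≡))) w≢u′
        tail {suc _} cycle = s≤s z≤n
      finish zero eq I₃ (no u′≢v′) _ = contradiction (trans u′≡ (trans (sym (subst (λ i → at (i ℕ.+ i) ≡ at i) (sym eq) meet)) (sym v′≡))) u′≢v′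
      finish (suc d′) eq I₃ (no u′≢v′) _ = tortoiseLoop meet d′ (suc t) (trans (ℕ.+-suc (suc d′) t) eq) u′≡ v′≡ I₃

    attempt-halts : ∀ {l m} → l ℕ.< m → at l ≡ at m → ∀ {mem} → Intact mem →
      Halts (rounds m) (m ℕ.* (5 ℕ.* ℓ)) (start (working tortoise , w , w , w)) mem
    attempt-halts {l} {m} l<m eq I with meeting l<m eq
    ... | suc d , _ , t≤m , meet = weaken
      (ℕ.+-mono-≤ (ℕ.*-monoˡ-≤ (3 ℕ.* suc ℓ) t≤m) (s≤s (ℕ.*-monoˡ-≤ (2 ℕ.* suc ℓ) t≤m)))
      (ℕ.≤-trans (ℕ.≤-reflexive (solveℕ 2 (λ t ℓ → t ⊗ (conℕ 3 ⊗ ℓ) ⊕ t ⊗ (conℕ 2 ⊗ ℓ) ⊜ t ⊗ (conℕ 5 ⊗ ℓ)) refl (suc d) ℓ)) (ℕ.*-monoˡ-≤ (5 ℕ.* ℓ) t≤m))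
      (tortoiseLoop meet d 0 (ℕ.+-identityʳ (suc d)) refl refl I)

-- Expected time

8/9 9ℚ : ℚ
8/9 = + 8 / 9
9ℚ  = + 9 / 1

power : ℕ → ℚ
power zero    = 1ℚ
power (suc t) = 8/9 * power t

0≤power : ∀ t → 0ℚ ≤ power t
0≤power zero    = ℚ.nonNegative⁻¹ 1ℚ
0≤power (suc t) = 0≤* (ℚ.nonNegative⁻¹ 8/9) (0≤power t)

-- Bernoulli's inequality for 9/8, inverted.
power-decay : ∀ t → power t * (9ℚ + ι t) ≤ 9ℚ
power-decay zero    = ℚ.≤-reflexive (trans (cong (λ u → 1ℚ * (9ℚ + u)) ι-0) refl)
power-decay (suc t) = ℚ.≤-trans
  (≤-excess (power t * (1/9 * (1ℚ + ι t))) (0≤* (0≤power t) (0≤* (ℚ.nonNegative⁻¹ 1/9) (0≤+ (ℚ.nonNegative⁻¹ 1ℚ) (0≤ι t))))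
    (trans (solve 2 (λ p t → p :* (con 9ℚ :+ t) := con 8/9 :* p :* (con 9ℚ :+ (con 1ℚ :+ t)) :+ p :* (con 1/9 :* (con 1ℚ :+ t))) refl (power t) (ι t))
      (cong (λ u → 8/9 * power t * (9ℚ + u) + power t * (1/9 * (1ℚ + ι t))) (sym (trans (ι-+ 1 t) (cong (_+ ι t) ι-1))))))
  (power-decay t)

archimedean : ∀ δ → 0ℚ < δ → ∃[ D ] (1ℚ ≤ ι (suc D) * δ)
archimedean (mkℚ (+ zero)    d-1 c) 0<δ = contradiction (ℚ.drop-*<* 0<δ) (λ { (ℤ.+<+ ()) })
archimedean (mkℚ (ℤ.-[1+ n ]) d-1 c) 0<δ = contradiction (ℚ.drop-*<* 0<δ) (λ ())
-- A positive fraction is at least the reciprocal of its denominator.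
archimedean δ@(mkℚ (+ suc n) d-1 c) 0<δ = d-1 , (begin
  1ℚ                              ≡⟨ ι*recip d-1 ⟨
  ι (suc d-1) * recip (suc d-1)   ≤⟨ *-mono-≤ˡ (ι (suc d-1)) (0≤ι (suc d-1)) recip≤δ ⟩
  ι (suc d-1) * δ                 ∎)
  where
  open ℚ.≤-Reasoning
  recip≤δ : recip (suc d-1) ≤ δ
  recip≤δ = subst (_≤ δ) (recip-def d-1) (ℚ.toℚᵘ-cancel-≤
    (ℚᵘ.≤-respˡ-≃ (ℚᵘ.≃-sym (ℚ.toℚᵘ-fromℚᵘ (ℚᵘ.mkℚᵘ (+ 1) d-1)))
      (ℚᵘ.*≤* (ℤ.*-monoʳ-≤-nonNeg (+ suc d-1) (ℤ.+≤+ (s≤s (z≤n {n})))))))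

power-small : ∀ δ → 0ℚ < δ → ∃[ t ] (power t ≤ δ)
power-small δ 0<δ with archimedean δ 0<δ
... | D , 1≤Dδ = t , ℚ.*-cancelʳ-≤-pos (ι t) ⦃ positive (0<ι (D ℕ.+ 8 ℕ.* suc D)) ⦄ (begin
  power t * ι t           ≤⟨ *-mono-≤ˡ (power t) (0≤power t) (≤-excess 9ℚ (ℚ.nonNegative⁻¹ 9ℚ) (ℚ.+-comm 9ℚ (ι t))) ⟩
  power t * (9ℚ + ι t)    ≤⟨ power-decay t ⟩
  9ℚ                      ≡⟨⟩
  9ℚ * 1ℚ                 ≤⟨ *-mono-≤ˡ 9ℚ (ℚ.nonNegative⁻¹ 9ℚ) 1≤Dδ ⟩
  9ℚ * (ι (suc D) * δ)    ≡⟨ solve 3 (λ n x y → n :* (x :* y) := y :* (n :* x)) refl 9ℚ (ι (suc D)) δ ⟩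
  δ * (9ℚ * ι (suc D))    ≡⟨ cong (λ u → δ * (u * ι (suc D))) (ι-def 9) ⟩
  δ * (ι 9 * ι (suc D))   ≡⟨ cong (δ *_) (ι-* 9 (suc D)) ⟨
  δ * ι t                 ∎)
  where
  open ℚ.≤-Reasoning
  -- With this t, t · (8/9)^t ≤ 9 ≤ t δ.
  t = 9 ℕ.* suc D

module Expectation {n} (G : BlackBoxGroup n) {a b} (M : Machine n a b) (S : Vec (Fin n) (a ℕ.+ b)) (z : Fin n) where
  open Products G
  open Execution G M S z

  draws : _
  draws = allDraws n a b

  -- The summands contain a local function of Execution that cannot be named here;
  -- the pair lets it be inferred.
  attemptsTime-summand : ∀ t m → Σ[ f ∈ (Draw n a b → ℚ) ] attemptsTime (suc t) m ≡ mean draws f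
  attemptsTime-summand t m = _ , refl

  failure-summand : ∀ t m → Σ[ f ∈ (Draw n a b → ℚ) ] failure (suc t) m ≡ mean draws f
  failure-summand t m = _ , refl

  0≤time : ∀ τ → 0ℚ ≤ + τ / 1
  0≤time τ = subst (0ℚ ≤_) (sym (ι-def τ)) (0≤ι τ)

  0≤attemptsTime : ∀ t m → 0ℚ ≤ attemptsTime t m
  0≤attemptsTime zero    m = ℚ.≤-refl
  0≤attemptsTime (suc t) m = 0≤mean draws pointwise
    where
    pointwise : ∀ draw → 0ℚ ≤ proj₁ (attemptsTime-summand t m) draw
    pointwise draw with attempt m draw
    ... | ⟨ found _    , τ , m′ ⟩ = 0≤+ (0≤time τ) ℚ.≤-refl
    ... | ⟨ retry      , τ , m′ ⟩ = 0≤+ (0≤time τ) (0≤attemptsTime t m′)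
    ... | ⟨ unfinished , τ , m′ ⟩ = 0≤+ (0≤time τ) ℚ.≤-refl

  module _ (Inv : Memory → Set) (success duration : Draw n a b → ℚ) where

    -- `success` and `duration` see only the draw, so their means are the same in every attempt. The
    -- link `lucky` is one-sided: an attempt whose success value is 0 may end either way, and is
    -- bounded as if it were retried.
    record Good (draw : Draw n a b) (r : Run) : Set where
      field
        finished  : result r ≢ unfinished
        sound     : ∀ {x} → result r ≡ found x → product (subsequence S x) ≡ z
        lucky     : (success draw ≡ 0ℚ) ⊎ (success draw ≡ 1ℚ × result r ≢ retry)
        invariant : Inv (memory r)
        quick     : ι (time r) ≤ duration draw

    module _ (good : ∀ {m} → Inv m → ∀ draw → Good draw (attempt m draw))
             (likely : 1/9 ≤ mean draws success) (nonEmpty-draws : NonEmpty draws) where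

      luck≤ : ∀ {draw q q′} → (success draw ≡ 0ℚ) → q ≤ q′ → q ≤ (1ℚ + - 1ℚ * success draw) * q′
      luck≤ {draw} {q} {q′} unlucky q≤q′ = subst (λ s → q ≤ (1ℚ + - 1ℚ * s) * q′) (sym unlucky) (subst (q ≤_) (sym (ℚ.*-identityˡ q′)) q≤q′)

      0≤luck : ∀ {draw r q} → Good draw r → 0ℚ ≤ q → 0ℚ ≤ (1ℚ + - 1ℚ * success draw) * q
      0≤luck {draw} {r} {q} g 0≤q with Good.lucky g
      ... | inj₁ unlucky = luck≤ unlucky 0≤q
      ... | inj₂ (lucky , _) = subst (λ s → 0ℚ ≤ (1ℚ + - 1ℚ * s) * q) (sym lucky) (ℚ.≤-reflexive (sym (ℚ.*-zeroˡ q)))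

      mean-unlucky : ∀ q → 0ℚ ≤ q → mean draws (λ draw → (1ℚ + - 1ℚ * success draw) * q) ≤ 8/9 * q
      mean-unlucky q 0≤q = begin
        mean draws (λ draw → (1ℚ + - 1ℚ * success draw) * q)
          ≡⟨ mean-cong draws (λ draw → ℚ.*-comm (1ℚ + - 1ℚ * success draw) q) ⟩
        mean draws (λ draw → q * (1ℚ + - 1ℚ * success draw))
          ≡⟨ mean-* draws q (λ draw → 1ℚ + - 1ℚ * success draw) ⟩
        q * mean draws (λ draw → 1ℚ + - 1ℚ * success draw)
          ≡⟨ cong (q *_) (mean-+ draws (λ _ → 1ℚ) (λ draw → - 1ℚ * success draw)) ⟩
        q * (mean draws (λ _ → 1ℚ) + mean draws (λ draw → - 1ℚ * success draw))
          ≡⟨ cong (q *_) (cong₂ _+_ (mean-const nonEmpty-draws 1ℚ) (mean-* draws (- 1ℚ) success)) ⟩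
        q * (1ℚ + - 1ℚ * mean draws success)
          ≤⟨ ≤-excess (q * (mean draws success - 1/9)) (0≤* 0≤q (0≤difference likely))
               (solve 2 (λ q s → con 8/9 :* q := q :* (con 1ℚ :+ con (- 1ℚ) :* s) :+ q :* (s :- con 1/9)) refl q (mean draws success)) ⟩
        8/9 * q ∎
        where open ℚ.≤-Reasoning

      failure≤ : ∀ t {m} → Inv m → failure t m ≤ power t
      failure≤ zero    I = ℚ.≤-refl
      failure≤ (suc t) {m} I = ℚ.≤-trans (mean-mono draws pointwise) (mean-unlucky (power t) (0≤power t))
        where
        pointwise : ∀ draw → proj₁ (failure-summand t m) draw ≤ (1ℚ + - 1ℚ * success draw) * power t
        pointwise draw with attempt m draw | good I draw
        ... | ⟨ unfinished , τ , m′ ⟩ | g = contradiction refl (Good.finished g)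
        ... | ⟨ found x , τ , m′ ⟩ | g with product (subsequence S x) ≟ z
        ...   | yes _ = 0≤luck g (0≤power t)
        ...   | no ¬z = contradiction (Good.sound g refl) ¬z
        pointwise draw | ⟨ retry , τ , m′ ⟩ | g with Good.lucky g
        ... | inj₁ unlucky     = luck≤ unlucky (failure≤ t (Good.invariant g))
        ... | inj₂ (_ , ¬retry) = contradiction refl ¬retry

      -- An attempt costs D on average and is repeated with probability at most 8/9; 9D is the fixed
      -- point of x = D + (8/9) x.
      attemptsTime≤ : ∀ D → 0ℚ ≤ D → mean draws duration ≤ D → ∀ t {m} → Inv m → attemptsTime t m ≤ 9ℚ * D
      attemptsTime≤ D 0≤D quick zero    I = 0≤* (ℚ.nonNegative⁻¹ 9ℚ) 0≤D
      attemptsTime≤ D 0≤D quick (suc t) {m} I = begin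
        attemptsTime (suc t) m
          ≤⟨ mean-mono draws pointwise ⟩
        mean draws (λ draw → duration draw + (1ℚ + - 1ℚ * success draw) * (9ℚ * D))
          ≡⟨ mean-+ draws duration (λ draw → (1ℚ + - 1ℚ * success draw) * (9ℚ * D)) ⟩
        mean draws duration + mean draws (λ draw → (1ℚ + - 1ℚ * success draw) * (9ℚ * D))
          ≤⟨ ℚ.+-mono-≤ quick (mean-unlucky (9ℚ * D) 0≤9D) ⟩
        D + 8/9 * (9ℚ * D)
          ≡⟨ solve 1 (λ d → d :+ con 8/9 :* (con 9ℚ :* d) := con 9ℚ :* d) refl D ⟩
        9ℚ * D ∎
        where
        open ℚ.≤-Reasoning
        0≤9D : 0ℚ ≤ 9ℚ * D
        0≤9D = 0≤* (ℚ.nonNegative⁻¹ 9ℚ) 0≤D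
        quick′ : ∀ {draw r} → Good draw r → + time r / 1 ≤ duration draw
        quick′ {draw} {r} g = subst (_≤ duration draw) (sym (ι-def (time r))) (Good.quick g)
        pointwise : ∀ draw → proj₁ (attemptsTime-summand t m) draw ≤ duration draw + (1ℚ + - 1ℚ * success draw) * (9ℚ * D)
        pointwise draw with attempt m draw | good I draw
        ... | ⟨ unfinished , τ , m′ ⟩ | g = contradiction refl (Good.finished g)
        ... | ⟨ found x , τ , m′ ⟩    | g = ℚ.+-mono-≤ (quick′ g) (0≤luck g 0≤9D)
        ... | ⟨ retry , τ , m′ ⟩      | g with Good.lucky g
        ...   | inj₁ unlucky      = ℚ.+-mono-≤ (quick′ g) (luck≤ unlucky (attemptsTime≤ D 0≤D quick t (Good.invariant g)))
        ...   | inj₂ (_ , ¬retry) = contradiction refl ¬retry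

      succeeds : Inv precomputed → Succeeds
      succeeds I δ 0<δ = proj₁ (power-small δ 0<δ) , ℚ.≤-trans (failure≤ (proj₁ (power-small δ 0<δ)) I) (proj₂ (power-small δ 0<δ))

-- From the first collision to the result of an attempt

not-fixed : ∀ x → x ≢ not x
not-fixed true  ()
not-fixed false ()

module Analysis {n a b c} (T : Table (a ℕ.+ b) c) (G : BlackBoxGroup n) (S : Vec (Fin n) (a ℕ.+ b)) (z : Fin n) where
  open Floyd n a b T
  open GroupFacts G
  open PollardRho G a b S z
  open Execution G machine S z
  open Simulation {n} {a} {b} {c} T G S z
  open RandomWalk (all𝒞 a b) (all𝒞-nonEmpty a b) π side

  steps6-8-sound : ∀ s t {x} → steps6-8 s t ≡ found x → π s ≡ π t → product (subsequence S x) ≡ z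
  steps6-8-sound (inj₁ x) (inj₂ y) refl eq = begin
    product (subsequence S (x ++ y))     ≡⟨ trans (cong product (subsequence-++ S x y)) (product-++ (subsequence (take a S) x) _) ⟩
    π (inj₁ x) ∙ p                       ≡⟨ cong (_∙ p) (trans eq (cong (z ∙_) (product-μ (subsequence (drop a S) y)))) ⟩
    z ∙ p ⁻¹ ∙ p                         ≡⟨ cancel-right⁻¹ p z ⟩
    z                                    ∎
    where
    open ≡-Reasoning
    p = product (subsequence (drop a S) y)
  steps6-8-sound (inj₂ y) (inj₁ x) refl eq = steps6-8-sound (inj₁ x) (inj₂ y) refl (sym eq)

  attempt-sound : ∀ {w η res x} → Attempt w η res → res ≡ found x → product (subsequence S x) ≡ z
  attempt-sound {w} {η} (collision {i} {j} L eq) res≡ = steps6-8-sound (φ^ η (i ℕ.+ j) w) (φ^ η j w) res≡ eq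

  attempt-finished : ∀ {w η res} → Attempt w η res → res ≢ unfinished
  attempt-finished {w} {η} (collision {i} {j} L eq) = lemma (φ^ η (i ℕ.+ j) w) (φ^ η j w)
    where
    lemma : ∀ s t → steps6-8 s t ≢ unfinished
    lemma (inj₁ _) (inj₂ _) ()
    lemma (inj₂ _) (inj₁ _) ()
    lemma (inj₁ _) (inj₁ _) ()
    lemma (inj₂ _) (inj₂ _) ()

  steps6-8-opposite : ∀ s t → side s ≡ not (side t) → steps6-8 s t ≢ retry
  steps6-8-opposite (inj₁ _) (inj₂ _) _ ()
  steps6-8-opposite (inj₂ _) (inj₁ _) _ ()

  module _ (w : 𝒞 a b) (η : Oracle n a b) where
    open Orbit η w
    open FirstCollision

    firstOutcome : Outcome (suc n) 0
    firstOutcome = outcome (suc n) 0 (ℕ.+-identityʳ (suc n)) []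

    repetition : (F : FirstCollision) → orbit (suc (earlier F)) ≡ orbit (suc (later F))
    repetition F = trans (orbit-suc (earlier F)) (trans (cong (Vec.lookup η) (sym (meets F))) (sym (orbit-suc (later F))))

    -- If the first two positions with equal products lie on different sides,
    -- then they are distinct, so the ρ closes one step after them.
    cycle-of-collision : (F : FirstCollision) → side (orbit (later F)) ≡ not (side (orbit (earlier F))) →
      ∀ {i j} → IsLeastCycle η w i j → (i ℕ.+ earlier F ≡ later F) × (j ≡ suc (earlier F))
    cycle-of-collision F opposite {i} {j} L = i+l≡m , j≡1+l
      where
      open IsLeastCycle L renaming (positive to 0<i)
      l = earlier F
      m = later F
      l≤m = ℕ.<⇒≤ (earlier<later F)
      bounds : i ℕ.≤ m ∸ l × j ℕ.≤ suc l
      bounds = least (m ∸ l) (suc l) (ℕ.m<n⇒0<n∸m (earlier<later F))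
        (trans (cong orbit (trans (ℕ.+-suc (m ∸ l) l) (cong suc (ℕ.m∸n+n≡m l≤m)))) (sym (repetition F)))
      i+j≤ : i ℕ.+ j ℕ.≤ suc m
      i+j≤ = ℕ.≤-trans (ℕ.+-mono-≤ (proj₁ bounds) (proj₂ bounds)) (ℕ.≤-reflexive (trans (ℕ.+-suc (m ∸ l) l) (cong suc (ℕ.m∸n+n≡m l≤m))))
      j<i+j : j ℕ.< i ℕ.+ j
      j<i+j = ℕ.+-monoˡ-≤ j 0<i
      -- If the ρ closed at m, then position j would have the product of positions l and m. For j ≠
      -- l this repeats a product before m, and j = l makes the two colliding positions equal
      -- although their sides differ.
      i+j≢m : i ℕ.+ j ≢ m
      i+j≢m i+j≡m with ℕ.<-cmp j l
      ... | tri< j<l _ _ = apart F j<l (earlier<later F) (trans (cong π (trans (sym cycle) (cong orbit i+j≡m))) (meets F))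
      ... | tri> _ _ l<j = apart F l<j (subst (j ℕ.<_) i+j≡m j<i+j) (trans (sym (meets F)) (cong π (trans (cong orbit (sym i+j≡m)) cycle)))
      ... | tri≈ _ refl _ = not-fixed (side (orbit j)) (trans (cong side (sym (trans (cong orbit (sym i+j≡m)) cycle))) opposite)
      -- Closing before m would also repeat a product too early. So the sum of the two upper bounds
      -- in `bounds` is attained, and hence each of them is.
      i+j≡1+m : i ℕ.+ j ≡ suc m
      i+j≡1+m with ℕ.<-cmp (i ℕ.+ j) m
      ... | tri< i+j<m _ _ = contradiction (cong π (sym cycle)) (apart F j<i+j i+j<m)
      ... | tri≈ _ i+j≡m _ = contradiction i+j≡m i+j≢m
      ... | tri> _ _ m<i+j = ℕ.≤-antisym i+j≤ m<i+j
      j≡1+l : j ≡ suc l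
      j≡1+l = ℕ.≤-antisym (proj₂ bounds) (ℕ.+-cancelˡ-≤ (m ∸ l) _ _ (ℕ.≤-trans
        (ℕ.≤-reflexive (trans (trans (ℕ.+-suc (m ∸ l) l) (cong suc (ℕ.m∸n+n≡m l≤m))) (sym i+j≡1+m))) (ℕ.+-monoˡ-≤ j (proj₁ bounds))))
      i+l≡m : i ℕ.+ l ≡ m
      i+l≡m = ℕ.suc-injective (trans (sym (ℕ.+-suc i l)) (trans (cong (i ℕ.+_) (sym j≡1+l)) i+j≡1+m))

    opposite-succeeds : (F : FirstCollision) → side (orbit (later F)) ≡ not (side (orbit (earlier F))) →
      ∀ {res} → Attempt w η res → res ≢ retry
    opposite-succeeds F opposite (noTail L) with cycle-of-collision F opposite L
    ... | _ , ()
    opposite-succeeds F opposite (noCollision L differ) with cycle-of-collision F opposite L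
    ... | i+l≡m , refl = λ _ → differ (trans (cong (λ t → π (orbit t)) i+l≡m) (meets F))
    opposite-succeeds F opposite (collision {i} L same) with cycle-of-collision F opposite L
    ... | i+l≡m , refl = steps6-8-opposite (orbit (i ℕ.+ earlier F)) (orbit (earlier F)) (trans (cong (λ t → side (orbit t)) i+l≡m) opposite)

    -- Equal products give equal successors, so the orbit repeats a position at index later + 1,
    -- which is at most n + 1. This is the origin of the argument `suc n` in `maxSteps`.
    attempt-halts′ : ∀ {m} → Intact m → Attempts.Halts w η (rounds (suc n)) (suc (later (Outcome.first firstOutcome)) ℕ.* (5 ℕ.* ℓ)) (start (working tortoise , w , w , w)) m
    attempt-halts′ {m} I = Attempts.weaken w η
      (ℕ.+-mono-≤ (ℕ.*-monoˡ-≤ (3 ℕ.* suc ℓ) later≤) (s≤s (ℕ.*-monoˡ-≤ (2 ℕ.* suc ℓ) later≤))) ℕ.≤-refl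
      (Attempts.attempt-halts w η (s≤s (earlier<later F)) (repetition F) {m} I)
      where
      F = Outcome.first firstOutcome
      later≤ = s≤s (later≤n F)

    record AttemptSpec (r : Run) : Set where
      field
        attempted : Attempt w η (result r)
        intact′   : Intact (memory r)
        time≤     : time r ℕ.≤ suc (later (Outcome.first firstOutcome)) ℕ.* (5 ℕ.* ℓ)

    attempt-spec : ∀ {m} → Intact m → AttemptSpec (attempt m (w , η))
    attempt-spec {m} I = subst AttemptSpec (sym run≡) (record { attempted = attempted ; intact′ = λ {r} → finalIntact {r} ; time≤ = spent≤ })
      where
      open Attempts.Halts (attempt-halts′ {m} I)
      run≡ : attempt m (w , η) ≡ ⟨ returned , spent , final ⟩
      run≡ = trans (cong (λ j → run j η (start (working tortoise , w , w , w)) m) (sym (ℕ.+-identityʳ (rounds (suc n))))) (runs 0)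

  intact-reachable : ∀ {m} → Reachable m → Intact m
  intact-reachable first                      _ _ = refl
  intact-reachable (again {m} reach (w , η) _) = AttemptSpec.intact′ (attempt-spec w η {m} (intact-reachable reach))

  implements : Implements
  implements {m} reach w η = AttemptSpec.attempted (attempt-spec w η {m} (intact-reachable reach))

  success duration : Draw n a b → ℚ
  success  (w , η) = Success.value (suc n) [] η w
  duration (w , η) = ι (5 ℕ.* ℓ) * Duration.value (suc n) [] η w

  open Expectation G machine S z

  good : ∀ {m} → Intact m → ∀ draw → Good Intact success duration draw (attempt m draw)
  good {m} I (w , η) = record
    { finished  = attempt-finished (AttemptSpec.attempted spec)
    ; sound     = attempt-sound (AttemptSpec.attempted spec)
    ; lucky     = Sum.map₂ (map₂ (λ opposite → opposite-succeeds w η F opposite (AttemptSpec.attempted spec))) (Outcome.success (firstOutcome w η))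
    ; invariant = λ {r} → AttemptSpec.intact′ spec {r}
    ; quick     = begin
        ι (time (attempt m (w , η)))                          ≤⟨ ι-mono (AttemptSpec.time≤ spec) ⟩
        ι (suc (later F) ℕ.* (5 ℕ.* ℓ))                       ≡⟨ ι-* (suc (later F)) (5 ℕ.* ℓ) ⟩
        ι (suc (later F)) * ι (5 ℕ.* ℓ)                       ≡⟨ ℚ.*-comm (ι (suc (later F))) (ι (5 ℕ.* ℓ)) ⟩
        ι (5 ℕ.* ℓ) * ι (suc (later F))                       ≡⟨ cong (ι (5 ℕ.* ℓ) *_) (Outcome.duration (firstOutcome w η)) ⟨
        ι (5 ℕ.* ℓ) * (ι 0 + Duration.value (suc n) [] η w)   ≡⟨ cong (ι (5 ℕ.* ℓ) *_) (trans (cong (_+ Duration.value (suc n) [] η w) ι-0) (ℚ.+-identityˡ _)) ⟩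
        ι (5 ℕ.* ℓ) * Duration.value (suc n) [] η w           ∎
    }
    where
    open ℚ.≤-Reasoning
    open Orbit η w
    open FirstCollision
    F = Outcome.first (firstOutcome w η)
    spec = attempt-spec w η {m} I

  module _ (∣a-b∣≤1 : ∣ a - b ∣ ℕ.≤ 1) (balanced : Equidistribution.Balanced G (take a S) × Equidistribution.Balanced G (drop a S)) where
    open Measure G a b S z

    draws-nonEmpty : NonEmpty draws
    draws-nonEmpty = cartesianProductWith-nonEmpty _,_ (all𝒞-nonEmpty a b) (allVecs-nonEmpty (all𝒞-nonEmpty a b) n)

    mean-draws : ∀ (f : Draw n a b → ℚ) → mean draws f ≡ mean (all𝒞 a b) (λ w → mean (allVecs (all𝒞 a b) n) (λ η → f (w , η)))
    mean-draws = mean-cartesianProductWith _,_ (all𝒞 a b) (allVecs (all𝒞 a b) n)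

    likely : 1/9 ≤ mean draws success
    likely = subst (1/9 ≤_) (sym (mean-draws success))
      (success-average (mass-lower ∣a-b∣≤1 balanced) (mass-upper ∣a-b∣≤1 balanced) (suc n) [] (ℕ.+-identityʳ (suc n)) [])

    always : Succeeds
    always = succeeds Intact success duration good likely draws-nonEmpty (λ _ _ → refl)

    expectedTime≤ : ∀ s → n ℕ.≤ s ℕ.* s → ∀ t → expectedTime t ≤ ι (E ℕ.* k ℕ.+ 9 ℕ.* (5 ℕ.* ℓ ℕ.* (6 ℕ.* s ℕ.+ s)))
    expectedTime≤ s n≤s² t = begin
      expectedTime t
        ≤⟨ ℚ.+-mono-≤ (subst (_≤ ι (E ℕ.* k)) (sym (ι-def precomputationCost)) (ι-mono precomputationCost≤))
             (attemptsTime≤ Intact success duration good likely draws-nonEmpty (ι D) (0≤ι D) quick t (λ _ _ → refl)) ⟩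
      ι (E ℕ.* k) + 9ℚ * ι D
        ≡⟨ cong (_+_ (ι (E ℕ.* k))) (trans (cong (_* ι D) (ι-def 9)) (sym (ι-* 9 D))) ⟩
      ι (E ℕ.* k) + ι (9 ℕ.* D)
        ≡⟨ ι-+ (E ℕ.* k) (9 ℕ.* D) ⟨
      ι (E ℕ.* k ℕ.+ 9 ℕ.* D) ∎
      where
      open ℚ.≤-Reasoning
      -- 5ℓ is the price per position, from three evaluations in the first loop and two in the
      -- second; 6s + s is the potential of the empty history.
      D = 5 ℕ.* ℓ ℕ.* (6 ℕ.* s ℕ.+ s)
      quick : mean draws duration ≤ ι D
      quick = begin
        mean draws duration
          ≡⟨ mean-* draws (ι (5 ℕ.* ℓ)) (λ (w , η) → Duration.value (suc n) [] η w) ⟩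
        ι (5 ℕ.* ℓ) * mean draws (λ (w , η) → Duration.value (suc n) [] η w)
          ≡⟨ cong (ι (5 ℕ.* ℓ) *_) (mean-draws (λ (w , η) → Duration.value (suc n) [] η w)) ⟩
        ι (5 ℕ.* ℓ) * Duration.average (suc n) []
          ≤⟨ *-mono-≤ˡ (ι (5 ℕ.* ℓ)) (0≤ι (5 ℕ.* ℓ))
               (duration-average (mass-lower ∣a-b∣≤1 balanced) (mass-upper ∣a-b∣≤1 balanced) s n≤s² (suc n) [] []) ⟩
        ι (5 ℕ.* ℓ) * ι (6 ℕ.* s ℕ.+ s)
          ≡⟨ ι-* (5 ℕ.* ℓ) (6 ℕ.* s ℕ.+ s) ⟨
        ι D ∎

    expectedTime≤√ : ∀ s → n ℕ.≤ s ℕ.* s → ∀ K → (let X = E ℕ.* k ℕ.+ 9 ℕ.* (5 ℕ.* ℓ ℕ.* (6 ℕ.* s ℕ.+ s)) in X ℕ.* X ℕ.≤ K ℕ.* K ℕ.* n) →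
      ExpectedTime≤ K ·√n
    expectedTime≤√ s n≤s² K X²≤ t = begin
      x * x                    ≤⟨ *-mono-≤ˡ x 0≤x (expectedTime≤ s n≤s² t) ⟩
      x * ι X                  ≤⟨ *-mono-≤ʳ (ι X) (0≤ι X) (expectedTime≤ s n≤s² t) ⟩
      ι X * ι X                ≡⟨ ι-* X X ⟨
      ι (X ℕ.* X)              ≤⟨ ι-mono X²≤ ⟩
      ι (K ℕ.* K ℕ.* n)        ≡⟨ ι-def (K ℕ.* K ℕ.* n) ⟨
      + (K ℕ.* K ℕ.* n) / 1    ∎
      where
      open ℚ.≤-Reasoning
      X = E ℕ.* k ℕ.+ 9 ℕ.* (5 ℕ.* ℓ ℕ.* (6 ℕ.* s ℕ.+ s))
      x = expectedTime t
      0≤x : 0ℚ ≤ x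
      0≤x = 0≤+ (0≤time precomputationCost) (0≤attemptsTime t precomputed)

-- The implied constants

lower<upper : ∀ (x : ℝ) {q r} → q <ᴿ x → x ᴿ< r → q < r
lower<upper x {q} {r} q<x x<r with q ℚ.<? r
... | yes q<r = q<r
... | no  q≮r = contradiction (r<x , x<r) (ℝ.disjoint x r)
  where
  r<x : r <ᴿ x
  r<x with to (ℝ.lower-rounded x q) q<x
  ... | s , q<s , s<x = from (ℝ.lower-rounded x r) (s , ℚ.≤-<-trans (ℚ.≮⇒≥ q≮r) q<s , s<x)

/-* : ∀ p q → (+ p / suc q) * ι (suc q) ≡ ι p
/-* p q = trans (cong ((+ p / suc q) *_) (sym (ι-def (suc q)))) (trans (ℚ.toℚᵘ-injective (begin
  toℚᵘ ((+ p / suc q) * (+ suc q / 1))            ≈⟨ ℚ.toℚᵘ-homo-* (+ p / suc q) (+ suc q / 1) ⟩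
  toℚᵘ (+ p / suc q) ℚᵘ.* toℚᵘ (+ suc q / 1)      ≈⟨ ℚᵘ.*-cong (ℚ.toℚᵘ-fromℚᵘ (ℚᵘ.mkℚᵘ (+ p) q)) (ℚ.toℚᵘ-fromℚᵘ (ℚᵘ.mkℚᵘ (+ suc q) 0)) ⟩
  ℚᵘ.mkℚᵘ (+ p) q ℚᵘ.* ℚᵘ.mkℚᵘ (+ suc q) 0        ≈⟨ ℚᵘ.*≡* (trans (ℤ.*-assoc (+ p) (+ suc q) (+ 1)) (cong ((+ p) ℤ.*_) (ℤ.*-comm (+ suc q) (+ 1))) ⟨ trans ⟩ cong ((+ p) ℤ.*_) (cong +_ (trans (ℕ.*-identityˡ (suc q)) (sym (ℕ.*-identityʳ (suc q)))))) ⟩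
  ℚᵘ.mkℚᵘ (+ p) 0                                 ≈⟨ ℚ.toℚᵘ-fromℚᵘ (ℚᵘ.mkℚᵘ (+ p) 0) ⟨
  toℚᵘ (+ p / 1)                                  ∎)) (ι-def p))
  where open ℚᵘ.≃-Reasoning

ι-cancel-≤ : ∀ {m n} → ι m ≤ ι n → m ℕ.≤ n
ι-cancel-≤ {m} {n} ιm≤ιn with m ℕ.≤? n
... | yes m≤n = m≤n
... | no  m≰n = contradiction (ℚ.<-≤-trans ιn<ιm ιm≤ιn) (ℚ.<-irrefl refl)
  where
  ιn<ιm : ι n < ι m
  ιn<ιm = ℚ.<-≤-trans (subst (ι n <_) (trans (ℚ.+-comm (ι n) 1ℚ) (trans (cong (_+ ι n) (sym ι-1)) (sym (ι-+ 1 n))))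
    (subst (_< ι n + 1ℚ) (ℚ.+-identityʳ (ι n)) (ℚ.+-monoʳ-< (ι n) (ℚ.positive⁻¹ 1ℚ)))) (ι-mono (ℕ.≰⇒> m≰n))

-- 1/(e + 1) is at most some positive rational below ε, hence less than every p/q above ε.
positive-exponent : ∀ (ε : ℝ) → 0ℚ <ᴿ ε → ∃[ e ] (∀ p q .{{_ : NonZero q}} → ε ᴿ< (+ p / q) → q ℕ.≤ suc e ℕ.* p)
positive-exponent ε 0<ε = proj₁ arch , bound
  where
  rational = to (ℝ.lower-rounded ε 0ℚ) 0<ε
  r = proj₁ rational
  arch = archimedean r (proj₁ (proj₂ rational))
  e = proj₁ arch
  bound : ∀ p q .{{_ : NonZero q}} → ε ᴿ< (+ p / q) → q ℕ.≤ suc e ℕ.* p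
  bound p (suc q) ε<p/q = ι-cancel-≤ (begin
    ι (suc q)                                   ≡⟨ ℚ.*-identityˡ (ι (suc q)) ⟨
    1ℚ * ι (suc q)                              ≤⟨ *-mono-≤ʳ (ι (suc q)) (0≤ι (suc q)) (proj₂ arch) ⟩
    ι (suc e) * r * ι (suc q)                   ≤⟨ *-mono-≤ʳ (ι (suc q)) (0≤ι (suc q)) (*-mono-≤ˡ (ι (suc e)) (0≤ι (suc e)) (ℚ.<⇒≤ (lower<upper ε (proj₂ (proj₂ rational)) ε<p/q))) ⟩
    ι (suc e) * (+ p / suc q) * ι (suc q)       ≡⟨ trans (ℚ.*-assoc (ι (suc e)) (+ p / suc q) (ι (suc q))) (cong (ι (suc e) *_) (/-* p q)) ⟩
    ι (suc e) * ι p                             ≡⟨ ι-* (suc e) p ⟨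
    ι (suc e ℕ.* p)                             ∎)
    where open ℚ.≤-Reasoning

-- A rational strictly between 4 and d supplies the surplus exponent that `half-size` spends.
density-lower : ∀ (d : ℝ) → (+ 4 / 1) <ᴿ d → ∃[ p ] ∃[ q ] (4 ℕ.* suc q ℕ.< p × ((+ p / suc q) <ᴿ d))
density-lower d 4<d with to (ℝ.lower-rounded d (+ 4 / 1)) 4<d
... | mkℚ (+ p) q c , 4<r , r<d = p , q , ℤ.drop‿+<+ (subst₂ ℤ._<_ (sym (ℤ.pos-* 4 (suc q))) (ℤ.*-identityʳ (+ p)) (ℚ.drop-*<* 4<r)) , subst (_<ᴿ d) (sym (ℚ.↥p/↧p≡p (mkℚ (+ p) q c))) r<d
... | mkℚ (ℤ.-[1+ p ]) q c , 4<r , r<d = contradiction (ℚ.drop-*<* 4<r) (λ ())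

density-upper : ∀ (d : ℝ) → ∃[ D ] (d ᴿ< (+ suc D / 1))
density-upper d with ℝ.upper-inhabited d
... | r@(mkℚ i q c) , d<r = ℤ.∣ i ∣ , from (ℝ.upper-rounded d (+ suc ℤ.∣ i ∣ / 1)) (r , r< , d<r)
  where
  r< : r < (+ suc ℤ.∣ i ∣ / 1)
  r< = ℚ.toℚᵘ-cancel-< (ℚᵘ.<-respʳ-≃ (ℚᵘ.≃-sym (ℚ.toℚᵘ-fromℚᵘ (ℚᵘ.mkℚᵘ (+ suc ℤ.∣ i ∣) 0)))
    (ℚᵘ.*<* (below i)))
    where
    below : ∀ i → i ℤ.* (+ 1) ℤ.< + suc ℤ.∣ i ∣ ℤ.* (+ suc q)
    below (+ j)       = subst₂ ℤ._<_ (sym (ℤ.*-identityʳ (+ j))) (ℤ.pos-* (suc j) (suc q)) (ℤ.+<+ (ℕ.≤-trans (s≤s ℕ.≤-refl) (ℕ.m≤m*n (suc j) (suc q))))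
    below (ℤ.-[1+ j ]) = ℤ.-<+

-- Inequalities between natural numbers

root-≤ : ∀ d .{{_ : NonZero d}} {x y} → x ℕ.^ d ℕ.≤ y ℕ.^ d → x ℕ.≤ y
root-≤ d {x} {y} x^d≤y^d with x ℕ.≤? y
... | yes x≤y = x≤y
... | no  x≰y = contradiction (ℕ.<-≤-trans (ℕ.^-monoˡ-< d (ℕ.≰⇒> x≰y)) x^d≤y^d) (ℕ.<-irrefl refl)

^-distrib-* : ∀ x y d → (x ℕ.* y) ℕ.^ d ≡ x ℕ.^ d ℕ.* y ℕ.^ d
^-distrib-* x y zero    = refl
^-distrib-* x y (suc d) = trans (cong (x ℕ.* y ℕ.*_) (^-distrib-* x y d)) (solveℕ 4 (λ x y u v → x ⊗ y ⊗ (u ⊗ v) ⊜ x ⊗ u ⊗ (y ⊗ v)) refl x y (x ℕ.^ d) (y ℕ.^ d))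

-- An integer in place of √n; the slack factor 4 absorbs the rounding for small n as well.
sqrt : ∀ n → ∃[ s ] (n ℕ.≤ s ℕ.* s × s ℕ.* s ℕ.≤ 4 ℕ.* n)
sqrt zero    = 0 , z≤n , z≤n
sqrt (suc n) with sqrt n
... | s , n≤s² , s²≤4n with suc n ℕ.≤? s ℕ.* s
...   | yes 1+n≤s² = s , 1+n≤s² , ℕ.≤-trans s²≤4n (ℕ.*-monoʳ-≤ 4 (ℕ.n≤1+n n))
...   | no  1+n≰s² = suc s , n<[1+s]² , [1+s]²≤
  where
  n≡s² : n ≡ s ℕ.* s
  n≡s² = ℕ.≤-antisym n≤s² (ℕ.≤-pred (ℕ.≰⇒> 1+n≰s²))
  expand : suc s ℕ.* suc s ≡ suc (s ℕ.* s ℕ.+ 2 ℕ.* s)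
  expand = solveℕ 1 (λ s → (conℕ 1 ⊕ s) ⊗ (conℕ 1 ⊕ s) ⊜ conℕ 1 ⊕ (s ⊗ s ⊕ conℕ 2 ⊗ s)) refl s
  n<[1+s]² : suc n ℕ.≤ suc s ℕ.* suc s
  n<[1+s]² = subst (suc n ℕ.≤_) (sym expand) (s≤s (ℕ.≤-trans n≤s² (ℕ.m≤m+n (s ℕ.* s) (2 ℕ.* s))))
  s≤s*s : ∀ s → s ℕ.≤ s ℕ.* s
  s≤s*s zero    = z≤n
  s≤s*s (suc s) = ℕ.m≤m*n (suc s) (suc s)
  [1+s]²≤ : suc s ℕ.* suc s ℕ.≤ 4 ℕ.* suc n
  [1+s]²≤ = begin
    suc s ℕ.* suc s               ≡⟨ expand ⟩
    suc (s ℕ.* s ℕ.+ 2 ℕ.* s)     ≤⟨ s≤s (ℕ.+-mono-≤ (ℕ.≤-reflexive (sym n≡s²)) (ℕ.*-monoʳ-≤ 2 (ℕ.≤-trans (s≤s*s s) (ℕ.≤-reflexive (sym n≡s²))))) ⟩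
    suc (n ℕ.+ 2 ℕ.* n)           ≤⟨ ℕ.m≤m+n (suc (n ℕ.+ 2 ℕ.* n)) (3 ℕ.+ n) ⟩
    suc (n ℕ.+ 2 ℕ.* n) ℕ.+ (3 ℕ.+ n) ≡⟨ solveℕ 1 (λ n → conℕ 1 ⊕ (n ⊕ conℕ 2 ⊗ n) ⊕ (conℕ 3 ⊕ n) ⊜ conℕ 4 ⊗ (conℕ 1 ⊕ n)) refl n ⟩
    4 ℕ.* suc n                   ∎
    where open ℕ.≤-Reasoning

n≤2^n : ∀ n → n ℕ.≤ 2 ℕ.^ n
n≤2^n zero    = z≤n
n≤2^n (suc n) = ℕ.≤-trans (ℕ.+-mono-≤ (ℕ.m^n>0 2 n) (n≤2^n n)) (ℕ.≤-reflexive (cong (2 ℕ.^ n ℕ.+_) (sym (ℕ.+-identityʳ (2 ℕ.^ n)))))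

HasDensity-upper : ∀ (d : ℝ) {D n k} → d ᴿ< (+ suc D / 1) → HasDensity d n k → 2 ℕ.^ k ℕ.≤ 2 ℕ.* n ℕ.^ suc D
HasDensity-upper d {D} {n} {k} d<D density = subst (λ m → 2 ℕ.^ m ℕ.≤ 2 ℕ.* n ℕ.^ suc D) (ℕ.*-identityˡ k) (proj₂ (density (suc D) 1) d<D)

-- Sizes of the table and of the two halves

chunk : ℕ → ℕ → ℕ
chunk c k = suc (k ℕ./ suc c)

≤-chunk : ∀ c k → k ℕ.≤ suc c ℕ.* chunk c k
≤-chunk c k = begin
  k                                               ≡⟨ m≡m%n+[m/n]*n k (suc c) ⟩
  k ℕ.% suc c ℕ.+ k ℕ./ suc c ℕ.* suc c           ≤⟨ ℕ.+-monoˡ-≤ _ (ℕ.<⇒≤ (m%n<n k (suc c))) ⟩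
  chunk c k ℕ.* suc c                             ≡⟨ ℕ.*-comm (chunk c k) (suc c) ⟩
  suc c ℕ.* chunk c k                             ∎
  where open ℕ.≤-Reasoning

chunkTable : ∀ c k → Table k (suc c)
chunkTable c k = table (chunk c k) (suc c) k (≤-chunk c k)

-- If the k indices are cut into c + 1 = m(D + 1) chunks, the table for one
-- chunk has O(n^(1/m)) entries.
chunk-size : ∀ m D {c n k} → suc c ≡ m ℕ.* suc D → 2 ℕ.^ k ℕ.≤ 2 ℕ.* n ℕ.^ suc D →
  (2 ℕ.^ chunk c k) ℕ.^ m ℕ.≤ 4 ℕ.^ m ℕ.* n
chunk-size m D {c} {n} {k} c≡ 2^k≤ = root-≤ (suc D) (begin
  ((2 ℕ.^ L) ℕ.^ m) ℕ.^ suc D          ≡⟨ trans (ℕ.^-*-assoc (2 ℕ.^ L) m (suc D)) (trans (cong ((2 ℕ.^ L) ℕ.^_) (sym c≡)) (ℕ.^-*-assoc 2 L (suc c))) ⟩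
  2 ℕ.^ (L ℕ.* suc c)                  ≤⟨ ℕ.^-monoʳ-≤ 2 (ℕ.+-monoʳ-≤ (suc c) (m/n*n≤m k (suc c))) ⟩
  2 ℕ.^ (suc c ℕ.+ k)                  ≡⟨ ℕ.^-distribˡ-+-* 2 (suc c) k ⟩
  2 ℕ.^ suc c ℕ.* 2 ℕ.^ k              ≤⟨ ℕ.*-monoʳ-≤ (2 ℕ.^ suc c) 2^k≤ ⟩
  2 ℕ.^ suc c ℕ.* (2 ℕ.* n ℕ.^ suc D)  ≡⟨ ℕ.*-assoc (2 ℕ.^ suc c) 2 (n ℕ.^ suc D) ⟨
  2 ℕ.^ suc c ℕ.* 2 ℕ.* n ℕ.^ suc D    ≤⟨ ℕ.*-monoˡ-≤ (n ℕ.^ suc D) (ℕ.*-monoʳ-≤ (2 ℕ.^ suc c) (ℕ.^-monoʳ-≤ 2 {1} {suc c} (s≤s z≤n))) ⟩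
  2 ℕ.^ suc c ℕ.* 2 ℕ.^ suc c ℕ.* n ℕ.^ suc D ≡⟨ cong (ℕ._* n ℕ.^ suc D) (^-distrib-* 2 2 (suc c)) ⟨
  4 ℕ.^ suc c ℕ.* n ℕ.^ suc D          ≡⟨ cong (λ l → 4 ℕ.^ l ℕ.* n ℕ.^ suc D) c≡ ⟩
  4 ℕ.^ (m ℕ.* suc D) ℕ.* n ℕ.^ suc D  ≡⟨ cong (ℕ._* n ℕ.^ suc D) (ℕ.^-*-assoc 4 m (suc D)) ⟨
  (4 ℕ.^ m) ℕ.^ suc D ℕ.* n ℕ.^ suc D  ≡⟨ ^-distrib-* (4 ℕ.^ m) n (suc D) ⟨
  (4 ℕ.^ m ℕ.* n) ℕ.^ suc D            ∎)
  where
  open ℕ.≤-Reasoning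
  L = chunk c k

-- The hypothesis says y ≤ 4 n^(1/m), and q ≤ m p says 1/m ≤ p/q. Both are cleared of roots by
-- raising to the powers m and q.
power-size : ∀ m .{{_ : NonZero m}} {n y} p q → 0 ℕ.< n → y ℕ.^ m ℕ.≤ 4 ℕ.^ m ℕ.* n → q ℕ.≤ m ℕ.* p →
  y ℕ.^ q ℕ.≤ 4 ℕ.^ q ℕ.* n ℕ.^ p
power-size m {n} {y} p q 0<n y≤ q≤ = root-≤ m (begin
  (y ℕ.^ q) ℕ.^ m                      ≡⟨ trans (ℕ.^-*-assoc y q m) (trans (cong (y ℕ.^_) (ℕ.*-comm q m)) (sym (ℕ.^-*-assoc y m q))) ⟩
  (y ℕ.^ m) ℕ.^ q                      ≤⟨ ℕ.^-monoˡ-≤ q y≤ ⟩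
  (4 ℕ.^ m ℕ.* n) ℕ.^ q                ≡⟨ ^-distrib-* (4 ℕ.^ m) n q ⟩
  (4 ℕ.^ m) ℕ.^ q ℕ.* n ℕ.^ q          ≡⟨ cong (ℕ._* n ℕ.^ q) (trans (ℕ.^-*-assoc 4 m q) (trans (cong (4 ℕ.^_) (ℕ.*-comm m q)) (sym (ℕ.^-*-assoc 4 q m)))) ⟩
  (4 ℕ.^ q) ℕ.^ m ℕ.* n ℕ.^ q          ≤⟨ ℕ.*-monoʳ-≤ ((4 ℕ.^ q) ℕ.^ m) (ℕ.^-monoʳ-≤ n ⦃ ℕ.>-nonZero 0<n ⦄ q≤pm) ⟩
  (4 ℕ.^ q) ℕ.^ m ℕ.* n ℕ.^ (p ℕ.* m)  ≡⟨ cong ((4 ℕ.^ q) ℕ.^ m ℕ.*_) (ℕ.^-*-assoc n p m) ⟨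
  (4 ℕ.^ q) ℕ.^ m ℕ.* (n ℕ.^ p) ℕ.^ m  ≡⟨ ^-distrib-* (4 ℕ.^ q) (n ℕ.^ p) m ⟨
  (4 ℕ.^ q ℕ.* n ℕ.^ p) ℕ.^ m          ∎)
  where
  open ℕ.≤-Reasoning
  q≤pm : q ℕ.≤ p ℕ.* m
  q≤pm = ℕ.≤-trans q≤ (ℕ.≤-reflexive (ℕ.*-comm m p))

-- For m ≥ 4, y is at most 4 n^(1/4). The precomputation costs a constant times y², which is
-- therefore O(√n).
square-size : ∀ m {n y s} → 4 ℕ.≤ m → 0 ℕ.< n → y ℕ.^ m ℕ.≤ 4 ℕ.^ m ℕ.* n → n ℕ.≤ s ℕ.* s →
  y ℕ.* y ℕ.≤ 16 ℕ.* s
square-size m {n} {y} {s} 4≤m 0<n y≤ n≤s² = root-≤ 2 (begin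
  (y ℕ.* y) ℕ.^ 2          ≡⟨ solveℕ 1 (λ y → (y ⊗ y) ⊛ 2 ⊜ y ⊛ 4) refl y ⟩
  y ℕ.^ 4                  ≤⟨ power-size m ⦃ ℕ.>-nonZero (ℕ.≤-trans (s≤s z≤n) 4≤m) ⦄ 1 4 0<n y≤ (ℕ.≤-trans 4≤m (ℕ.≤-reflexive (sym (ℕ.*-identityʳ m)))) ⟩
  4 ℕ.^ 4 ℕ.* n ℕ.^ 1      ≡⟨ cong (256 ℕ.*_) (ℕ.^-identityʳ n) ⟩
  256 ℕ.* n                ≤⟨ ℕ.*-monoʳ-≤ 256 n≤s² ⟩
  256 ℕ.* (s ℕ.* s)        ≡⟨ solveℕ 1 (λ s → conℕ 256 ⊗ (s ⊗ s) ⊜ (conℕ 16 ⊗ s) ⊛ 2) refl s ⟩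
  (16 ℕ.* s) ℕ.^ 2         ∎)
  where
  open ℕ.≤-Reasoning

-- Here d > 4 enters. As p exceeds 4(q + 1), n^p contains a factor n beyond n^(4(q + 1)), and for
-- large n this factor absorbs (2R)^Q. On the other side a + b + 1 ≤ 2(a + 1), so extracting the
-- Q-th root gives 2n²R ≤ 2^(a + 1).
half-size : ∀ {p q n a b} R → 4 ℕ.* suc q ℕ.< p → (2 ℕ.* R) ℕ.^ (2 ℕ.* suc q) ℕ.≤ n → 0 ℕ.< n → b ℕ.≤ suc a →
  n ℕ.^ p ℕ.≤ 2 ℕ.^ (suc q ℕ.* suc (a ℕ.+ b)) → n ℕ.* n ℕ.* R ℕ.≤ 2 ℕ.^ a
half-size {p} {q} {n} {a} {b} R 4q<p R≤n 0<n b≤1+a n^p≤ = ℕ.*-cancelˡ-≤ 2 (root-≤ Q (begin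
  (2 ℕ.* (n ℕ.* n ℕ.* R)) ℕ.^ Q                 ≡⟨ cong (ℕ._^ Q) (solveℕ 2 (λ n R → conℕ 2 ⊗ (n ⊗ n ⊗ R) ⊜ conℕ 2 ⊗ R ⊗ n ⊛ 2) refl n R) ⟩
  (2 ℕ.* R ℕ.* n ℕ.^ 2) ℕ.^ Q                   ≡⟨ ^-distrib-* (2 ℕ.* R) (n ℕ.^ 2) Q ⟩
  (2 ℕ.* R) ℕ.^ Q ℕ.* (n ℕ.^ 2) ℕ.^ Q           ≤⟨ ℕ.*-monoˡ-≤ ((n ℕ.^ 2) ℕ.^ Q) R≤n ⟩
  n ℕ.* (n ℕ.^ 2) ℕ.^ Q                         ≡⟨ cong (n ℕ.*_) (trans (ℕ.^-*-assoc n 2 Q) (cong (n ℕ.^_) (sym (ℕ.*-assoc 2 2 (suc q))))) ⟩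
  n ℕ.^ suc (4 ℕ.* suc q)                       ≤⟨ ℕ.^-monoʳ-≤ n ⦃ ℕ.>-nonZero 0<n ⦄ 4q<p ⟩
  n ℕ.^ p                                       ≤⟨ n^p≤ ⟩
  2 ℕ.^ (suc q ℕ.* suc (a ℕ.+ b))               ≤⟨ ℕ.^-monoʳ-≤ 2 (ℕ.*-monoʳ-≤ (suc q) (s≤s (ℕ.+-monoʳ-≤ a b≤1+a))) ⟩
  2 ℕ.^ (suc q ℕ.* suc (a ℕ.+ suc a))           ≡⟨ cong (2 ℕ.^_) (solveℕ 2 (λ q a → (conℕ 1 ⊕ q) ⊗ (conℕ 1 ⊕ (a ⊕ (conℕ 1 ⊕ a))) ⊜ (conℕ 1 ⊕ a) ⊗ (conℕ 2 ⊗ (conℕ 1 ⊕ q))) refl q a) ⟩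
  2 ℕ.^ (suc a ℕ.* Q)                           ≡⟨ ℕ.^-*-assoc 2 (suc a) Q ⟨
  (2 ℕ.* 2 ℕ.^ a) ℕ.^ Q                         ∎))
  where
  open ℕ.≤-Reasoning
  Q = 2 ℕ.* suc q

recip-bound : ∀ {n R a} → n ℕ.* n ℕ.* suc R ℕ.≤ 2 ℕ.^ a → ι n * ι n * recip (2 ℕ.^ a) ≤ recip (suc R)
recip-bound {n} {R} {a} n²R≤2^a = begin
  ι n * ι n * r                                ≡⟨ ℚ.*-identityʳ (ι n * ι n * r) ⟨
  ι n * ι n * r * 1ℚ                           ≡⟨ cong (ι n * ι n * r *_) (ι*recip R) ⟨
  ι n * ι n * r * (ι (suc R) * recip (suc R))  ≡⟨ solve 4 (λ n r x y → n :* n :* r :* (x :* y) := n :* n :* x :* (r :* y)) refl (ι n) r (ι (suc R)) (recip (suc R)) ⟩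
  ι n * ι n * ι (suc R) * (r * recip (suc R))  ≡⟨ cong (_* (r * recip (suc R))) (trans (cong (_* ι (suc R)) (sym (ι-* n n))) (sym (ι-* (n ℕ.* n) (suc R)))) ⟩
  ι (n ℕ.* n ℕ.* suc R) * (r * recip (suc R))  ≤⟨ *-mono-≤ʳ (r * recip (suc R)) (0≤* (0≤recip (2 ℕ.^ a)) (0≤recip (suc R))) (ι-mono n²R≤2^a) ⟩
  ι (2 ℕ.^ a) * (r * recip (suc R))            ≡⟨ ℚ.*-assoc (ι (2 ℕ.^ a)) r (recip (suc R)) ⟨
  ι (2 ℕ.^ a) * r * recip (suc R)              ≡⟨ cong (_* recip (suc R)) (ι*recip′ (2 ℕ.^ a) (0<2^ a)) ⟩
  1ℚ * recip (suc R)                           ≡⟨ ℚ.*-identityˡ (recip (suc R)) ⟩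
  recip (suc R)                                ∎
  where
  open ℚ.≤-Reasoning
  r = recip (2 ℕ.^ a)

Probability≥-mono : ∀ {A : Set} {xs : List.List A} {P Q : A → Set} {p q} → q ≤ p → (∀ x → P x → Q x) → Probability≥ xs P p → Probability≥ xs Q q
Probability≥-mono q≤p P⇒Q (event , p≤ , sound) = event , ℚ.≤-trans q≤p p≤ , λ x e → P⇒Q x (sound x e)

-- The implementation and its bounds

implementation : ℕ → ∀ n a b → Implementation n a b
implementation c n a b = record
  { machine = Floyd.machine n a b T
  ; correct = λ G S z _ → Analysis.implements {n} {a} {b} {suc c} T G S z
  }
  where T = chunkTable c (a ℕ.+ b)

module Bounds (c n a b : ℕ) where
  k y : ℕ
  k = a ℕ.+ b
  y = 2 ℕ.^ chunk c k
  T = chunkTable c k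
  open Floyd n a b T using (E; ℓ)

  k≤ : k ℕ.≤ suc c ℕ.* y
  k≤ = ℕ.≤-trans (≤-chunk c k) (ℕ.*-monoʳ-≤ (suc c) (n≤2^n (chunk c k)))

  E≤ : E ℕ.≤ suc c ℕ.* y
  E≤ = length-table (chunk c k) (suc c) k (≤-chunk c k)

  storage≤ : Implementation.storage (implementation c n a b) ℕ.≤ (3 ℕ.* suc c ℕ.+ 18) ℕ.* y
  storage≤ = begin
    k ℕ.+ suc (3 ℕ.+ E) ℕ.+ (7 ℕ.+ (suc ℓ ℕ.+ 3))
      ≤⟨ ℕ.+-mono-≤ (ℕ.+-mono-≤ k≤ (ℕ.+-monoʳ-≤ 4 E≤)) (ℕ.≤-refl {7 ℕ.+ (suc ℓ ℕ.+ 3)}) ⟩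
    suc c ℕ.* y ℕ.+ (4 ℕ.+ suc c ℕ.* y) ℕ.+ (7 ℕ.+ (suc ℓ ℕ.+ 3))
      ≡⟨ solveℕ 2 (λ c z → z ⊕ (conℕ 4 ⊕ z) ⊕ (conℕ 7 ⊕ (conℕ 4 ⊕ c ⊕ conℕ 3)) ⊜ z ⊕ z ⊕ (c ⊕ conℕ 18)) refl (suc c) (suc c ℕ.* y) ⟩
    suc c ℕ.* y ℕ.+ suc c ℕ.* y ℕ.+ (suc c ℕ.+ 18)
      ≤⟨ ℕ.+-monoʳ-≤ (suc c ℕ.* y ℕ.+ suc c ℕ.* y) (ℕ.m≤m*n (suc c ℕ.+ 18) y ⦃ ℕ.m^n≢0 2 (chunk c k) ⦄) ⟩
    suc c ℕ.* y ℕ.+ suc c ℕ.* y ℕ.+ (suc c ℕ.+ 18) ℕ.* y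
      ≡⟨ solveℕ 2 (λ c y → c ⊗ y ⊕ c ⊗ y ⊕ (c ⊕ conℕ 18) ⊗ y ⊜ (conℕ 3 ⊗ c ⊕ conℕ 18) ⊗ y) refl (suc c) y ⟩
    (3 ℕ.* suc c ℕ.+ 18) ℕ.* y ∎
    where open ℕ.≤-Reasoning

  -- The factor 16 comes from `square-size`, and 315 = 9 · 5 · 7 from nine expected attempts, five
  -- evaluations per position, and the potential 7s.
  time≤ : ∀ {s} → y ℕ.* y ℕ.≤ 16 ℕ.* s →
    E ℕ.* k ℕ.+ 9 ℕ.* (5 ℕ.* ℓ ℕ.* (6 ℕ.* s ℕ.+ s)) ℕ.≤ (16 ℕ.* (suc c ℕ.* suc c) ℕ.+ 315 ℕ.* ℓ) ℕ.* s
  time≤ {s} y²≤ = begin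
    E ℕ.* k ℕ.+ 9 ℕ.* (5 ℕ.* ℓ ℕ.* (6 ℕ.* s ℕ.+ s))
      ≤⟨ ℕ.+-monoˡ-≤ _ (ℕ.*-mono-≤ E≤ k≤) ⟩
    suc c ℕ.* y ℕ.* (suc c ℕ.* y) ℕ.+ 9 ℕ.* (5 ℕ.* ℓ ℕ.* (6 ℕ.* s ℕ.+ s))
      ≡⟨ cong (ℕ._+ 9 ℕ.* (5 ℕ.* ℓ ℕ.* (6 ℕ.* s ℕ.+ s))) (solveℕ 2 (λ c y → c ⊗ y ⊗ (c ⊗ y) ⊜ c ⊗ c ⊗ (y ⊗ y)) refl (suc c) y) ⟩
    suc c ℕ.* suc c ℕ.* (y ℕ.* y) ℕ.+ 9 ℕ.* (5 ℕ.* ℓ ℕ.* (6 ℕ.* s ℕ.+ s))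
      ≤⟨ ℕ.+-monoˡ-≤ _ (ℕ.*-monoʳ-≤ (suc c ℕ.* suc c) y²≤) ⟩
    suc c ℕ.* suc c ℕ.* (16 ℕ.* s) ℕ.+ 9 ℕ.* (5 ℕ.* ℓ ℕ.* (6 ℕ.* s ℕ.+ s))
      ≡⟨ solveℕ 3 (λ c ℓ s → c ⊗ c ⊗ (conℕ 16 ⊗ s) ⊕ conℕ 9 ⊗ (conℕ 5 ⊗ ℓ ⊗ (conℕ 6 ⊗ s ⊕ s)) ⊜ (conℕ 16 ⊗ (c ⊗ c) ⊕ conℕ 315 ⊗ ℓ) ⊗ s) refl (suc c) ℓ s ⟩
    (16 ℕ.* (suc c ℕ.* suc c) ℕ.+ 315 ℕ.* ℓ) ℕ.* s ∎
    where open ℕ.≤-Reasoning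

mainTheorem2 : ∀ (d ε : ℝ) → (+ 4 / 1) <ᴿ d → 0ℚ <ᴿ ε →
    Σ[ K ∈ ℕ ] Σ[ impl ∈ (∀ n a b → Implementation n a b) ]
    (∀ (δ : ℚ) → 0ℚ < δ → Σ[ N ∈ ℕ ]
    (∀ n → N ℕ.≤ n → ∀ a b → ∣ a - b ∣ ℕ.≤ 1 → HasDensity d n (a ℕ.+ b) →
    (Implementation.storage (impl n a b) ≤ K · n ^ᴿ ε) ×
    (∀ (G : BlackBoxGroup n) →
    RandomSequence≥ n (a ℕ.+ b) (1ℚ - δ) (λ S →
    ∀ (z : Fin n) → Products.Representable G S z →
    Execution.Succeeds G (Implementation.machine (impl n a b)) S z ×
    Execution.ExpectedTime≤_·√n G (Implementation.machine (impl n a b)) S z K))))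
-- Each half contributes at most 1/R to the mean energy and Markov's inequality multiplies by 4. The
-- failure probability is thus at most 8/R, which the factor 8 in R turns into at most δ. The bound
-- on n is the one required by `half-size`, and its `suc` also ensures n > 0.
mainTheorem2 d ε 4<d 0<ε = K , implementation c , λ δ 0<δ → let R = 8 ℕ.* suc (proj₁ (archimedean δ 0<δ)) in
  suc ((2 ℕ.* R) ℕ.^ (2 ℕ.* suc q)) , λ n N≤n a b ∣a-b∣≤1 density →
    storageBound n a b (ℕ.≤-trans (s≤s z≤n) N≤n) density ,
    λ G → Probability≥-mono {xs = allVecs (List.allFin n) (a ℕ.+ b)} (close (proj₂ (archimedean δ 0<δ)))
      (λ S balanced z _ →
        let open Analysis {n} {a} {b} {suc c} (chunkTable c (a ℕ.+ b)) G S z in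
        always ∣a-b∣≤1 balanced ,
        expectedTime≤√ ∣a-b∣≤1 balanced (proj₁ (sqrt n)) (proj₁ (proj₂ (sqrt n))) K
          (timeBound n a b (ℕ.≤-trans (s≤s z≤n) N≤n) density))
      (Equidistribution.balanced-likely G a b _ (deviationBound {n} {a} {b} (ℕ.<⇒≤ N≤n) (ℕ.≤-trans (s≤s z≤n) N≤n) ∣a-b∣≤1 density))
  where
  exponent = positive-exponent ε 0<ε
  lower = density-lower d 4<d
  upper = density-upper d
  p = proj₁ lower
  q = proj₁ (proj₂ lower)
  -- The summand 4 keeps the precomputation within O(√n), and the exponent makes 1/m smaller than ε.
  m = 4 ℕ.+ proj₁ exponent
  D = proj₁ upper
  c = ℕ.pred (m ℕ.* suc D)
  K₁ = 16 ℕ.* (suc c ℕ.* suc c) ℕ.+ 315 ℕ.* (4 ℕ.+ c)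
  K₂ = 3 ℕ.* suc c ℕ.+ 18
  -- One constant for both bounds: s ≤ 2√n doubles K₁, and y ≤ 4 n^(1/m) quadruples K₂.
  K = 2 ℕ.* K₁ ℕ.+ 4 ℕ.* K₂

  size : ∀ n a b → HasDensity d n (a ℕ.+ b) → (2 ℕ.^ chunk c (a ℕ.+ b)) ℕ.^ m ℕ.≤ 4 ℕ.^ m ℕ.* n
  size n a b density = chunk-size m D {c} {n} {a ℕ.+ b} refl (HasDensity-upper d {D} {n} {a ℕ.+ b} (proj₂ upper) density)

  storageBound : ∀ n a b → 0 ℕ.< n → HasDensity d n (a ℕ.+ b) → Implementation.storage (implementation c n a b) ≤ K · n ^ᴿ ε
  storageBound n a b 0<n density p q ε<p/q = begin
    storage ℕ.^ q                    ≤⟨ ℕ.^-monoˡ-≤ q storage≤ ⟩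
    (K₂ ℕ.* y) ℕ.^ q                 ≡⟨ ^-distrib-* K₂ y q ⟩
    K₂ ℕ.^ q ℕ.* y ℕ.^ q             ≤⟨ ℕ.*-monoʳ-≤ (K₂ ℕ.^ q) (power-size m {n} {y} p q 0<n (size n a b density) q≤mp) ⟩
    K₂ ℕ.^ q ℕ.* (4 ℕ.^ q ℕ.* n ℕ.^ p) ≡⟨ ℕ.*-assoc (K₂ ℕ.^ q) (4 ℕ.^ q) (n ℕ.^ p) ⟨
    K₂ ℕ.^ q ℕ.* 4 ℕ.^ q ℕ.* n ℕ.^ p ≡⟨ cong (ℕ._* n ℕ.^ p) (^-distrib-* K₂ 4 q) ⟨
    (K₂ ℕ.* 4) ℕ.^ q ℕ.* n ℕ.^ p     ≤⟨ ℕ.*-monoˡ-≤ (n ℕ.^ p) (ℕ.^-monoˡ-≤ q (ℕ.≤-trans (ℕ.≤-reflexive (ℕ.*-comm K₂ 4)) (ℕ.m≤n+m (4 ℕ.* K₂) (2 ℕ.* K₁)))) ⟩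
    K ℕ.^ q ℕ.* n ℕ.^ p              ∎
    where
    open ℕ.≤-Reasoning
    open Bounds c n a b
    storage = Implementation.storage (implementation c n a b)
    q≤mp : q ℕ.≤ m ℕ.* p
    q≤mp = ℕ.≤-trans (proj₂ exponent p q ε<p/q) (ℕ.*-monoˡ-≤ p (ℕ.m≤n+m (suc (proj₁ exponent)) 3))

  timeBound : ∀ n a b → 0 ℕ.< n → HasDensity d n (a ℕ.+ b) → let open Floyd n a b (Bounds.T c n a b); s = proj₁ (sqrt n); X = E ℕ.* k ℕ.+ 9 ℕ.* (5 ℕ.* ℓ ℕ.* (6 ℕ.* s ℕ.+ s)) in
    X ℕ.* X ℕ.≤ K ℕ.* K ℕ.* n
  timeBound n a b 0<n density = begin
    X ℕ.* X                          ≤⟨ ℕ.*-mono-≤ X≤ X≤ ⟩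
    (K₁ ℕ.* s) ℕ.* (K₁ ℕ.* s)        ≡⟨ solveℕ 2 (λ k s → k ⊗ s ⊗ (k ⊗ s) ⊜ k ⊗ k ⊗ (s ⊗ s)) refl K₁ s ⟩
    K₁ ℕ.* K₁ ℕ.* (s ℕ.* s)          ≤⟨ ℕ.*-monoʳ-≤ (K₁ ℕ.* K₁) (proj₂ (proj₂ (sqrt n))) ⟩
    K₁ ℕ.* K₁ ℕ.* (4 ℕ.* n)          ≡⟨ solveℕ 2 (λ k n → k ⊗ k ⊗ (conℕ 4 ⊗ n) ⊜ conℕ 2 ⊗ k ⊗ (conℕ 2 ⊗ k) ⊗ n) refl K₁ n ⟩
    2 ℕ.* K₁ ℕ.* (2 ℕ.* K₁) ℕ.* n    ≤⟨ ℕ.*-monoˡ-≤ n (ℕ.*-mono-≤ 2K₁≤K 2K₁≤K) ⟩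
    K ℕ.* K ℕ.* n                    ∎
    where
    open ℕ.≤-Reasoning
    s = proj₁ (sqrt n)
    open Floyd n a b (Bounds.T c n a b) using (E; k; ℓ)
    X = E ℕ.* k ℕ.+ 9 ℕ.* (5 ℕ.* ℓ ℕ.* (6 ℕ.* s ℕ.+ s))
    X≤ : X ℕ.≤ K₁ ℕ.* s
    X≤ = Bounds.time≤ c n a b {s} (square-size m {n} {2 ℕ.^ chunk c (a ℕ.+ b)} {s} (ℕ.m≤m+n 4 (proj₁ exponent)) 0<n (size n a b density) (proj₁ (proj₂ (sqrt n))))
    2K₁≤K = ℕ.m≤m+n (2 ℕ.* K₁) (4 ℕ.* K₂)

  deviationBound : ∀ {n a b R} → (2 ℕ.* suc R) ℕ.^ (2 ℕ.* suc q) ℕ.≤ n → 0 ℕ.< n → ∣ a - b ∣ ℕ.≤ 1 → HasDensity d n (a ℕ.+ b) →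
    ι n * ι n * (recip (2 ℕ.^ a) + recip (2 ℕ.^ b)) ≤ recip (suc R) + recip (suc R)
  deviationBound {n} {a} {b} {R} R≤n 0<n ∣a-b∣≤1 density = begin
    ι n * ι n * (recip (2 ℕ.^ a) + recip (2 ℕ.^ b))
      ≡⟨ ℚ.*-distribˡ-+ (ι n * ι n) (recip (2 ℕ.^ a)) (recip (2 ℕ.^ b)) ⟩
    ι n * ι n * recip (2 ℕ.^ a) + ι n * ι n * recip (2 ℕ.^ b)
      ≤⟨ ℚ.+-mono-≤
           (recip-bound {a = a} (half-size {a = a} {b} (suc R) 4q<p R≤n 0<n (proj₂ (∣-∣≤1 a b ∣a-b∣≤1)) n^p≤))
           (recip-bound {a = b} (half-size {a = b} {a} (suc R) 4q<p R≤n 0<n (proj₁ (∣-∣≤1 a b ∣a-b∣≤1)) (subst (λ k → n ℕ.^ p ℕ.≤ 2 ℕ.^ (suc q ℕ.* suc k)) (ℕ.+-comm a b) n^p≤))) ⟩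
    recip (suc R) + recip (suc R) ∎
    where
    open ℚ.≤-Reasoning
    4q<p = proj₁ (proj₂ (proj₂ lower))
    n^p≤ : n ℕ.^ p ℕ.≤ 2 ℕ.^ (suc q ℕ.* suc (a ℕ.+ b))
    n^p≤ = proj₁ (density p (suc q)) (proj₂ (proj₂ (proj₂ lower)))

  close : ∀ {A δ} → 1ℚ ≤ ι (suc A) * δ → 1ℚ - δ ≤ 1ℚ - (1ℚ + 1ℚ) * (1ℚ + 1ℚ) * (recip (8 ℕ.* suc A) + recip (8 ℕ.* suc A))
  close {A} {δ} 1≤Aδ = ℚ.+-monoʳ-≤ 1ℚ (ℚ.neg-antimono-≤ (begin
    (1ℚ + 1ℚ) * (1ℚ + 1ℚ) * (recip (8 ℕ.* suc A) + recip (8 ℕ.* suc A))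
      ≡⟨ solve 1 (λ r → con ((1ℚ + 1ℚ) * (1ℚ + 1ℚ)) :* (r :+ r) := con (+ 8 / 1) :* r) refl (recip (8 ℕ.* suc A)) ⟩
    (+ 8 / 1) * recip (8 ℕ.* suc A)
      ≡⟨ cong₂ _*_ (ι-def 8) (recip-* 8 (suc A)) ⟩
    ι 8 * (recip 8 * recip (suc A))
      ≡⟨ trans (sym (ℚ.*-assoc (ι 8) (recip 8) (recip (suc A)))) (trans (cong (_* recip (suc A)) (ι*recip 7)) (ℚ.*-comm 1ℚ (recip (suc A)))) ⟩
    recip (suc A) * 1ℚ
      ≤⟨ *-mono-≤ˡ (recip (suc A)) (0≤recip (suc A)) 1≤Aδ ⟩
    recip (suc A) * (ι (suc A) * δ)
      ≡⟨ solve 3 (λ r i d → r :* (i :* d) := i :* r :* d) refl (recip (suc A)) (ι (suc A)) δ ⟩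
    ι (suc A) * recip (suc A) * δ
      ≡⟨ trans (cong (_* δ) (ι*recip A)) (ℚ.*-identityˡ δ) ⟩
    δ ∎))
    where open ℚ.≤-Reasoning
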